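{- Let $q$ be a prime power, let $n\ge 1$, and let $\psi(T)\in\mathbb{F}_q[T]$ be a monic irreducible polynomial of degree $n$. For an integer $m\ge1$, a polynomial $\gamma(T)\in\mathbb{F}_q[T]$ and an integer $k\ge1$, let $N_k(\gamma,m,\psi)$ denote the number of $2k$-tuples $(x_1,\dots,x_{2k})$ of polynomials $x_i\in\mathbb{F}_q[T]$ with $\deg_T x_i\le m-1$ and $x_i(T)+\gamma(T)\not\equiv 0\pmod{\psi(T)}$ for all $i$, satisfying the congruence $$\frac{1}{x_1(T)+\gamma(T)}+\cdots+\frac{1}{x_k(T)+\gamma(T)}\equiv \frac{1}{x_{k+1}(T)+\gamma(T)}+\cdots+\frac{1}{x_{2k}(T)+\gamma(T)}\pmod{\psi(T)}.$$ Then, for every fixed $k\ge 1$, uniformly over $q$ and $\gamma\in\mathbb{F}_q[T]$ (and $\psi$), if $m<n/(4k^2-2k)$ then $$N_k(\gamma,m,\psi)\le q^{(k+o(1))m}\quad\text{as } m\to\infty.$$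
   Context: Inverses are taken in the field $\mathbb{F}_q[T]/(\psi(T))\cong\mathbb{F}_{q^n}$. The $o(1)$ term tends to $0$ as $m\to\infty$ and depends only on $k$. -}

module Defs where

open import Level using (Level; _⊔_)
open import Data.Nat using (ℕ; zero; suc)
open import Data.Fin using (Fin)
open import Data.List as L using (List; []; _∷_; length; filter; concatMap; allFin)
open import Data.List.Relation.Unary.All using (All)
open import Data.Vec as V using (Vec; []; _∷_)
open import Data.Bool using (Bool; true; false; _∧_; if_then_else_)
open import Data.Product using (Σ; _×_; _,_; proj₁; proj₂)
open import Data.Sum using (_⊎_)
open import Relation.Nullary using (¬_; Dec)
open import Relation.Nullary.Decidable using (⌊_⌋)
open import Relation.Unary using (Pred)
open import Algebra.Bundles using (CommutativeRing)
open import Function using (_∘_)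
open import Relation.Binary.PropositionalEquality using (_≡_)
import Data.Bool

record FiniteField (q : ℕ) (c ℓ : Level) : Set (Level.suc (c ⊔ ℓ)) where
  field
    commRing  : CommutativeRing c ℓ
  open CommutativeRing commRing public
  field
    0≉1       : ¬ (0# ≈ 1#)
    inverse   : ∀ x → ¬ (x ≈ 0#) → Σ Carrier λ y → x * y ≈ 1#
    _≟_       : (x y : Carrier) → Dec (x ≈ y)
    enum      : Fin q → Carrier
    enum-inj  : ∀ i j → enum i ≈ enum j → i ≡ j
    enum-surj : ∀ x → Σ (Fin q) λ i → enum i ≈ x

allVecs : ∀ {a} {A : Set a} → List A → (n : ℕ) → List (Vec A n)
allVecs xs zero    = [] ∷ []
allVecs xs (suc n) = concatMap (λ x → L.map (x ∷_) (allVecs xs n)) xs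

cartesian : ∀ {a b} {A : Set a} {B : Set b} → List A → List B → List (A × B)
cartesian xs ys = concatMap (λ x → L.map (x ,_) ys) xs

-- Polynomials over a finite field F, as coefficient lists
-- (the i-th entry is the coefficient of T^i).

module Poly {q c ℓ} (F : FiniteField q c ℓ) where
  open FiniteField F

  Pol : Set c
  Pol = List Carrier

  infixl 6 _+ₚ_
  infixl 7 _*ₚ_

  _+ₚ_ : Pol → Pol → Pol
  []       +ₚ bs       = bs
  (a ∷ as) +ₚ []       = a ∷ as
  (a ∷ as) +ₚ (b ∷ bs) = (a + b) ∷ (as +ₚ bs)

  -ₚ_ : Pol → Pol
  -ₚ_ = L.map (-_)

  _*ₚ_ : Pol → Pol → Pol
  []       *ₚ bs = []
  (a ∷ as) *ₚ bs = L.map (a *_) bs +ₚ (0# ∷ (as *ₚ bs))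

  IsZeroP : Pol → Set (c ⊔ ℓ)
  IsZeroP = All (_≈ 0#)

  _≈ₚ_ : Pol → Pol → Set (c ⊔ ℓ)
  a ≈ₚ b = IsZeroP (a +ₚ (-ₚ b))

  IsUnitP : Pol → Set (c ⊔ ℓ)
  IsUnitP a = Σ Carrier λ u → ¬ (u ≈ 0#) × (a ≈ₚ (u ∷ []))

  monic : ∀ {n} → Vec Carrier n → Pol
  monic p = V.toList p L.++ (1# ∷ [])

  Irreducible : Pol → Set (c ⊔ ℓ)
  Irreducible f = ¬ IsUnitP f × (∀ a b → (a *ₚ b) ≈ₚ f → IsUnitP a ⊎ IsUnitP b)

  -- Arithmetic in 𝔽_q[T]/(ψ), ψ = monic p of degree n.  Residues are
  -- represented by their canonical representative of degree < n.

  module Residue {n : ℕ} (p : Vec Carrier n) where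

    Res : Set c
    Res = Vec Carrier n

    zeroR : Res
    zeroR = V.replicate n 0#

    _+ᵣ_ : Res → Res → Res
    _+ᵣ_ = V.zipWith _+_

    timesT : Res → Res
    timesT {- n = 0 -} [] = []
    timesT r@(_ ∷ _) =
      V.zipWith (λ a b → a - (V.last r * b)) (0# ∷ V.init r) p

    addConst : Carrier → Res → Res
    addConst a []       = []
    addConst a (r ∷ rs) = (a + r) ∷ rs

    -- reduction of a polynomial modulo ψ (Horner scheme)
    reduce : Pol → Res
    reduce = L.foldr (λ a r → addConst a (timesT r)) zeroR

    _*ᵣ_ : Res → Res → Res
    r *ᵣ s = reduce (V.toList r *ₚ V.toList s)

    oneR : Res
    oneR = reduce (1# ∷ [])

    eqVec? : ∀ {j} → Vec Carrier j → Vec Carrier j → Bool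
    eqVec? [] [] = true
    eqVec? (a ∷ as) (b ∷ bs) = ⌊ a ≟ b ⌋ ∧ eqVec? as bs

    _≈ᵣ?_ : Res → Res → Bool
    _≈ᵣ?_ = eqVec?

    isZeroR : Res → Bool
    isZeroR r = r ≈ᵣ? zeroR

    allRes : List Res
    allRes = L.map (V.map enum) (allVecs (allFin q) n)

    findInv : Res → List Res → Res
    findInv r []       = zeroR
    findInv r (s ∷ ss) = if (r *ᵣ s) ≈ᵣ? oneR then s else findInv r ss

    inv : Res → Res
    inv r = findInv r allRes

    sumR : ∀ {k} → Vec Res k → Res
    sumR = V.foldr _ _+ᵣ_ zeroR

module Count {q c ℓ} (F : FiniteField q c ℓ) where
  open FiniteField F
  open Poly F

  N : (k : ℕ) (γ : Pol) (m : ℕ) {n : ℕ} (p : Vec Carrier n) → ℕ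
  N k γ m p = length (filter (λ t → good (proj₁ t) (proj₂ t)) tuples)
    where
      open Residue p
      polys : List Pol
      polys = L.map (V.toList ∘ V.map enum) (allVecs (allFin q) m)
      tuples : List (Vec Pol k × Vec Pol k)
      tuples = cartesian (allVecs polys k) (allVecs polys k)
      shifted : Pol → Res
      shifted x = reduce (x +ₚ γ)
      nonzeroAll : ∀ {j} → Vec Pol j → Bool
      nonzeroAll = V.foldr _ (λ x b → Data.Bool.not (isZeroR (shifted x)) ∧ b) true
      goodB : Vec Pol k → Vec Pol k → Bool
      goodB xs ys = nonzeroAll xs ∧ nonzeroAll ys ∧
                    (sumR (V.map (inv ∘ shifted) xs) ≈ᵣ? sumR (V.map (inv ∘ shifted) ys))
      good : (xs ys : Vec Pol k) → Dec (goodB xs ys ≡ true)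
      good xs ys = goodB xs ys Data.Bool.≟ true

{-# OPTIONS --safe #-}
module Submission where

-- Clearing denominators, a solution x₁,…,x₂ₖ gives a polynomial P = Σᵢ ± Πⱼ≠ᵢ (xⱼ + Z) over
-- R = 𝔽_q[T] with ψ ∣ P(γ). Give Z the weight m, so that P has weight at most (2k−1)m, and let
-- f ∈ R[Z] be primitive of least Z-degree d among the nonzero polynomials of weight at most
-- (2k−1)m with ψ ∣ f(γ). As (2k−1)²m < n, Siegel's lemma and Gauss' lemma show that f divides
-- every P up to a factor from R; if there is no f, then every P is zero. Comparing contents
-- after Z ↦ ΛZ − xᵢ gives f(−xᵢ) ∣ (lcmⱼ≠ᵢ gcd(f(−xᵢ), xⱼ − xᵢ))^d.
-- Now read the tuple from left to right, or from right to left. The gcds with the terms already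
-- read divide the known values f(−xⱼ), so the divisor bound leaves q^o(m) choices for them, and
-- they fix xᵢ modulo their lcm. As deg f(−x) < d h confines x to d balls of radius h, the two
-- directions together allow at most q^(m+o(m)) choices of xᵢ, whence one of the two
-- directions yields at most q^(km+o(m)) tuples.

-- That f divides P is elimination with a pigeonhole in place of a resultant. Let D = 2k - 1, and
-- look for u, v of Z-degree below D and d such that R = u f + v P has no coefficient of positive
-- Z-degree. The weight bounds give exactly one more free scalar than there are conditions. What is
-- left of R is a polynomial in T of degree at most D² m < n which ψ divides, hence zero, so v P = -
-- u f with v of smaller degree than f. As ψ is prime and d is minimal, f is irreducible, and it
-- must divide P. The two directions are balanced term by term. If f(-x) has degree about d h, and
-- the gcds before and after x have lcms of degrees e₁ and e₂, then deg f(-x) ≤ d (e₁ + e₂) gives h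
-- ≤ e₁ + e₂ + 1. The two readings leave about q^(h - e₁) and q^(h - e₂) choices, and (h - e₁) + (h
-- - e₂) ≤ h + 1 ≤ m + 1. Uniformity in q comes from two divisor bounds: 2^(D m) suffices for large
-- q, and for bounded q the primes of small degree are bounded in number.

open import Defs
open import Level using (Level; _⊔_; 0ℓ)
import Level
open import Algebra.Bundles using (CommutativeRing; RawRing)
open import Algebra.Structures using (IsCommutativeRing)
import Algebra.Properties.AbelianGroup
import Algebra.Properties.CommutativeSemigroup.Divisibility as Div
import Algebra.Properties.Ring
import Algebra.Properties.Semiring.Divisibility as SDiv
import Algebra.Properties.Semiring.Exp as Exp
import Algebra.Properties.Semiring.Mult.TCOptimised as Mult
import Algebra.Solver.Ring
open import Algebra.Solver.Ring.AlmostCommutativeRing using (fromCommutativeRing; _-Raw-AlmostCommutative⟶_)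
import Algebra.Solver.Ring.NaturalCoefficients.Default as SemiringSolver
open import Data.Bool as Bool using (Bool; true; false; _∧_; not)
import Data.Bool.Properties as Bool
open import Data.Empty using (⊥; ⊥-elim)
open import Data.Fin as Fin using (Fin; toℕ; fromℕ<; funToFin; finToFun; splitAt; _↑ˡ_; _↑ʳ_)
import Data.Fin.Properties as Fin
open import Data.List as List using (List; []; _∷_; map; _++_; _ʳ++_; length; lookup; concatMap; allFin; upTo)
import Data.List.Properties as List
open import Data.List.Membership.Propositional using (_∈_; find; lose)
import Data.List.Membership.Propositional.Properties as ∈
open import Data.List.Relation.Binary.Pointwise as LP using ()
  renaming (Pointwise to Pointwiseᴸ; [] to []ᴸ; _∷_ to _∷ᴸ_)
open import Data.List.Relation.Unary.All as All using (All; []; _∷_)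
import Data.List.Relation.Unary.All.Properties as All
open import Data.List.Relation.Unary.AllPairs as AllPairs using (AllPairs; []; _∷_)
import Data.List.Relation.Unary.AllPairs.Properties as AllPairs
open import Data.List.Relation.Unary.Any as Any using (Any; here; there)
import Data.List.Relation.Unary.Any.Properties as Any
open import Data.Maybe using (Maybe; just; nothing)
open import Data.Nat as ℕ using (ℕ; zero; suc; z≤n; s≤s; _≤_; _<_)
import Data.Nat.DivMod as ℕ
import Data.Nat.Properties as ℕ
open import Data.Nat.Properties using (≤-refl; ≤-reflexive; ≤-trans; <-≤-trans; ≤-<-trans)
import Data.Nat.Solver as NatSolver
open import Data.Product using (Σ; ∃; _,_; _×_; proj₁; proj₂)
open import Data.Sum using (_⊎_; inj₁; inj₂; [_,_]′)
open import Data.Vec as Vec using (Vec; []; _∷_)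
import Data.Vec.Properties as Vec
open import Data.Vec.Relation.Binary.Pointwise.Inductive using (Pointwise; []; _∷_)
open import Function using (_∘_)
open import Relation.Binary using (Setoid)
open import Relation.Binary.PropositionalEquality as ≡ using (_≡_; _≢_)
import Relation.Binary.Reasoning.Setoid as SR
open import Relation.Nullary using (¬_; ¬?; Dec; yes; no)
open import Relation.Nullary.Decidable using (toSum; map′; decidable-stable; _×-dec_; _⊎-dec_)

-- Ring solver with integer coefficients over an arbitrary commutative ring.

-- An integer coefficient is a pair (a , b) of naturals standing for a − b.
module RingSolver {c ℓ} (R : CommutativeRing c ℓ) where
  open CommutativeRing R
  private
    module M = Mult semiring
    open Algebra.Properties.Ring ring
      using (-‿distribˡ-*; -‿distribʳ-*; -0#≈0#; -‿involutive)
    open Algebra.Properties.AbelianGroup +-abelianGroup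
      using () renaming (⁻¹-∙-comm to -‿+-comm; ⁻¹-anti-homo‿- to neg-sub; identityʳ-unique to unique0; inverseʳ-unique to uniq)
    module S = SemiringSolver commutativeSemiring

    pairs : RawRing _ _
    pairs = record
      { Carrier = ℕ × ℕ
      ; _≈_ = _≡_
      ; _+_ = λ (a , b) (x , y) → a ℕ.+ x , b ℕ.+ y
      ; _*_ = λ (a , b) (x , y) → a ℕ.* x ℕ.+ b ℕ.* y , a ℕ.* y ℕ.+ b ℕ.* x
      ; -_ = λ (a , b) → b , a
      ; 0# = 0 , 0
      ; 1# = 1 , 0
      }

    ι : ℕ → Carrier
    ι n = n M.× 1#

    -- The case split avoids a trailing `- 0#`, so that the coefficients 0 and 1 reduce to `0#` and
    -- `1#` and the last two fields of `morphism` are `refl`.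
    val : ℕ × ℕ → Carrier
    val (n , zero) = ι n
    val (zero , suc n) = - ι (suc n)
    val (suc m , suc n) = ι (suc m) + - ι (suc n)

    val-≈ : ∀ a b → val (a , b) ≈ ι a + - ι b
    val-≈ a zero = sym (trans (+-congˡ -0#≈0#) (+-identityʳ _))
    val-≈ zero (suc b) = sym (+-identityˡ _)
    val-≈ (suc a) (suc b) = refl

    negMul : ∀ a b → - a * - b ≈ a * b
    negMul a b = trans (sym (-‿distribˡ-* a (- b)))
      (trans (-‿cong (sym (-‿distribʳ-* a b))) (-‿involutive _))

    open SR setoid
    abstract
      add : ∀ p q → val (RawRing._+_ pairs p q) ≈ val p + val q
      add (a , b) (x , y) = begin
        val (a ℕ.+ x , b ℕ.+ y)          ≈⟨ val-≈ (a ℕ.+ x) (b ℕ.+ y) ⟩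
        ι (a ℕ.+ x) + - ι (b ℕ.+ y)      ≈⟨ +-cong (M.×-homo-+ 1# a x) (-‿cong (M.×-homo-+ 1# b y)) ⟩
        (ι a + ι x) + - (ι b + ι y)      ≈⟨ +-congˡ (sym (-‿+-comm _ _)) ⟩
        (ι a + ι x) + (- ι b + - ι y)    ≈⟨ S.solve 4 (λ a x b y → (a S.:+ x) S.:+ (b S.:+ y) S.:= (a S.:+ b) S.:+ (x S.:+ y)) refl _ _ _ _ ⟩
        (ι a + - ι b) + (ι x + - ι y)    ≈⟨ +-cong (sym (val-≈ a b)) (sym (val-≈ x y)) ⟩
        val (a , b) + val (x , y) ∎

      mul : ∀ p q → val (RawRing._*_ pairs p q) ≈ val p * val q
      mul (a , b) (x , y) = begin
        val (a ℕ.* x ℕ.+ b ℕ.* y , a ℕ.* y ℕ.+ b ℕ.* x)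
          ≈⟨ val-≈ (a ℕ.* x ℕ.+ b ℕ.* y) (a ℕ.* y ℕ.+ b ℕ.* x) ⟩
        ι (a ℕ.* x ℕ.+ b ℕ.* y) + - ι (a ℕ.* y ℕ.+ b ℕ.* x)
          ≈⟨ +-cong (hom a x b y) (-‿cong (hom a y b x)) ⟩
        (ι a * ι x + ι b * ι y) + - (ι a * ι y + ι b * ι x)
          ≈⟨ +-cong (+-congˡ (sym (negMul _ _)))
               (trans (sym (-‿+-comm _ _)) (+-cong (-‿distribʳ-* _ _) (-‿distribˡ-* _ _))) ⟩
        (ι a * ι x + - ι b * - ι y) + (ι a * - ι y + - ι b * ι x)
          ≈⟨ S.solve 4 (λ a x b y → (a S.:* x S.:+ b S.:* y) S.:+ (a S.:* y S.:+ b S.:* x)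
               S.:= (a S.:+ b) S.:* (x S.:+ y)) refl _ _ _ _ ⟩
        (ι a + - ι b) * (ι x + - ι y)    ≈⟨ *-cong (sym (val-≈ a b)) (sym (val-≈ x y)) ⟩
        val (a , b) * val (x , y) ∎
        where
        hom : ∀ a x b y → ι (a ℕ.* x ℕ.+ b ℕ.* y) ≈ ι a * ι x + ι b * ι y
        hom a x b y = trans (M.×-homo-+ 1# (a ℕ.* x) (b ℕ.* y)) (+-cong (M.×1-homo-* a x) (M.×1-homo-* b y))

      neg : ∀ p → val (RawRing.-_ pairs p) ≈ - val p
      neg (a , b) = trans (val-≈ b a) (trans (sym (neg-sub _ _)) (-‿cong (sym (val-≈ a b))))

    morphism : pairs -Raw-AlmostCommutative⟶ fromCommutativeRing R
    morphism = record
      { ⟦_⟧ = val ; +-homo = add ; *-homo = mul ; -‿homo = neg ; 0-homo = refl ; 1-homo = refl }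

    abstract
      dec-sound : ∀ a b x y → a ℕ.+ y ≡ x ℕ.+ b → val (a , b) ≈ val (x , y)
      dec-sound a b x y e = begin
        val (a , b)                    ≈⟨ val-≈ a b ⟩
        ι a + - ι b                    ≈⟨ shift (ι a) (ι b) (ι y) ⟩
        (ι a + ι y) + (- ι b + - ι y)  ≈⟨ +-congʳ (trans (sym (M.×-homo-+ 1# a y))
                                            (trans (reflexive (≡.cong ι e)) (M.×-homo-+ 1# x b))) ⟩
        (ι x + ι b) + (- ι b + - ι y)  ≈⟨ +-congˡ (+-comm _ _) ⟩
        (ι x + ι b) + (- ι y + - ι b)  ≈⟨ sym (shift (ι x) (ι y) (ι b)) ⟩
        ι x + - ι y                    ≈⟨ sym (val-≈ x y) ⟩
        val (x , y) ∎
        where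
        shift : ∀ u v w → u + - v ≈ (u + w) + (- v + - w)
        shift u v w = begin
          u + - v                 ≈⟨ +-identityʳ _ ⟨
          (u + - v) + 0#          ≈⟨ +-congˡ (-‿inverseʳ w) ⟨
          (u + - v) + (w + - w)   ≈⟨ S.solve 4 (λ a x b y → (a S.:+ x) S.:+ (b S.:+ y) S.:= (a S.:+ b) S.:+ (x S.:+ y)) refl _ _ _ _ ⟩
          (u + w) + (- v + - w) ∎

    dec : ∀ p q → Maybe (val p ≈ val q)
    dec (a , b) (x , y) with a ℕ.+ y ℕ.≟ x ℕ.+ b
    ... | no _  = nothing
    ... | yes e = just (dec-sound a b x y e)

  open Algebra.Solver.Ring pairs (fromCommutativeRing R) morphism dec public
    using (solve; _:=_; _:+_; _:*_; _:-_; :-_; con)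

-- Polynomials over a commutative ring as coefficient lists.

module Polynomial {c ℓ} (R : CommutativeRing c ℓ) where
  open CommutativeRing R
  open RingSolver R
  open Algebra.Properties.Ring ring using (-0#≈0#)

  Poly : Set c
  Poly = List Carrier

  coeff : Poly → ℕ → Carrier
  coeff []      _       = 0#
  coeff (a ∷ p) zero    = a
  coeff (a ∷ p) (suc i) = coeff p i

  infix 4 _≋_
  -- Coefficient lists are not normalised, so trailing zeros have to be ignored. Being a record, the
  -- equation determines `p` and `q` for unification.
  record _≋_ (p q : Poly) : Set ℓ where
    constructor mk
    field at : ∀ i → coeff p i ≈ coeff q i
  open _≋_ public

  ≋-refl : ∀ {p} → p ≋ p
  ≋-refl .at i = refl
  ≋-sym : ∀ {p q} → p ≋ q → q ≋ p
  ≋-sym e .at i = sym (at e i)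
  ≋-trans : ∀ {p q r} → p ≋ q → q ≋ r → p ≋ r
  ≋-trans e f .at i = trans (at e i) (at f i)

  ≋-setoid : Setoid c ℓ
  ≋-setoid = record { Carrier = Poly ; _≈_ = _≋_
    ; isEquivalence = record { refl = ≋-refl ; sym = ≋-sym ; trans = ≋-trans } }

  infixl 6 _⊕_
  infixl 7 _⊛_ _·_
  _⊕_ : Poly → Poly → Poly
  []      ⊕ q       = q
  (a ∷ p) ⊕ []      = a ∷ p
  (a ∷ p) ⊕ (b ∷ q) = (a + b) ∷ (p ⊕ q)

  ⊖_ : Poly → Poly
  ⊖_ = map (-_)

  _·_ : Carrier → Poly → Poly
  a · p = map (a *_) p

  _⊛_ : Poly → Poly → Poly
  []      ⊛ q = []
  (a ∷ p) ⊛ q = a · q ⊕ (0# ∷ p ⊛ q)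

  const : Carrier → Poly
  const a = a ∷ []

  coeff-⊕ : ∀ p q i → coeff (p ⊕ q) i ≈ coeff p i + coeff q i
  coeff-⊕ []      q       i       = sym (+-identityˡ _)
  coeff-⊕ (a ∷ p) []      i       = sym (+-identityʳ _)
  coeff-⊕ (a ∷ p) (b ∷ q) zero    = refl
  coeff-⊕ (a ∷ p) (b ∷ q) (suc i) = coeff-⊕ p q i

  coeff-· : ∀ a p i → coeff (a · p) i ≈ a * coeff p i
  coeff-· a []      i       = sym (zeroʳ a)
  coeff-· a (b ∷ p) zero    = refl
  coeff-· a (b ∷ p) (suc i) = coeff-· a p i

  coeff-⊖ : ∀ p i → coeff (⊖ p) i ≈ - coeff p i
  coeff-⊖ []      i       = sym -0#≈0#
  coeff-⊖ (b ∷ p) zero    = refl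
  coeff-⊖ (b ∷ p) (suc i) = coeff-⊖ p i

  ⊕-cong : ∀ {p p′ q q′} → p ≋ p′ → q ≋ q′ → p ⊕ q ≋ p′ ⊕ q′
  ⊕-cong {p} {p′} {q} {q′} e f .at i =
    trans (coeff-⊕ p q i) (trans (+-cong (at e i) (at f i)) (sym (coeff-⊕ p′ q′ i)))

  ·-cong : ∀ {a b p q} → a ≈ b → p ≋ q → a · p ≋ b · q
  ·-cong {a} {b} {p} {q} e f .at i =
    trans (coeff-· a p i) (trans (*-cong e (at f i)) (sym (coeff-· b q i)))

  ⊖-cong : ∀ {p q} → p ≋ q → ⊖ p ≋ ⊖ q
  ⊖-cong {p} {q} f .at i = trans (coeff-⊖ p i) (trans (-‿cong (at f i)) (sym (coeff-⊖ q i)))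

  ∷-cong : ∀ {a b p q} → a ≈ b → p ≋ q → (a ∷ p) ≋ (b ∷ q)
  ∷-cong e f .at zero    = e
  ∷-cong e f .at (suc i) = at f i

  ≋-tail : ∀ {a b p q} → (a ∷ p) ≋ (b ∷ q) → p ≋ q
  ≋-tail e .at i = at e (suc i)

  ≋-tail-[] : ∀ {a p} → (a ∷ p) ≋ [] → p ≋ []
  ≋-tail-[] e .at i = at e (suc i)

  0∷[] : (0# ∷ []) ≋ []
  0∷[] .at zero    = refl
  0∷[] .at (suc i) = refl

  ∷-≋[] : ∀ {a p} → a ≈ 0# → p ≋ [] → (a ∷ p) ≋ []
  ∷-≋[] e f .at zero    = e
  ∷-≋[] e f .at (suc i) = at f i

  ⊕-assoc : ∀ p q r → (p ⊕ q) ⊕ r ≋ p ⊕ (q ⊕ r)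
  ⊕-assoc p q r .at i = begin
    coeff ((p ⊕ q) ⊕ r) i                 ≈⟨ trans (coeff-⊕ (p ⊕ q) r i) (+-congʳ (coeff-⊕ p q i)) ⟩
    coeff p i + coeff q i + coeff r i     ≈⟨ +-assoc _ _ _ ⟩
    coeff p i + (coeff q i + coeff r i)   ≈⟨ trans (coeff-⊕ p (q ⊕ r) i) (+-congˡ (coeff-⊕ q r i)) ⟨
    coeff (p ⊕ (q ⊕ r)) i ∎
    where open SR setoid

  ⊕-comm : ∀ p q → p ⊕ q ≋ q ⊕ p
  ⊕-comm p q .at i = trans (coeff-⊕ p q i) (trans (+-comm _ _) (sym (coeff-⊕ q p i)))

  ⊕-identityʳ : ∀ p → p ⊕ [] ≋ p
  ⊕-identityʳ []      = ≋-refl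
  ⊕-identityʳ (a ∷ p) = ≋-refl

  ⊖-inverseʳ : ∀ p → p ⊕ (⊖ p) ≋ []
  ⊖-inverseʳ p .at i = trans (coeff-⊕ p (⊖ p) i)
    (trans (+-congˡ (coeff-⊖ p i)) (-‿inverseʳ _))

  ⊖-inverseˡ : ∀ p → (⊖ p) ⊕ p ≋ []
  ⊖-inverseˡ p = ≋-trans (⊕-comm (⊖ p) p) (⊖-inverseʳ p)

  ⊕-interchange : ∀ p q r s → (p ⊕ q) ⊕ (r ⊕ s) ≋ (p ⊕ r) ⊕ (q ⊕ s)
  ⊕-interchange p q r s .at i = begin
    coeff ((p ⊕ q) ⊕ (r ⊕ s)) i ≈⟨ trans (coeff-⊕ (p ⊕ q) (r ⊕ s) i) (+-cong (coeff-⊕ p q i) (coeff-⊕ r s i)) ⟩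
    (coeff p i + coeff q i) + (coeff r i + coeff s i)
      ≈⟨ solve 4 (λ p q r s → (p :+ q) :+ (r :+ s) := (p :+ r) :+ (q :+ s)) refl _ _ _ _ ⟩
    (coeff p i + coeff r i) + (coeff q i + coeff s i)
      ≈⟨ trans (coeff-⊕ (p ⊕ r) (q ⊕ s) i) (+-cong (coeff-⊕ p r i) (coeff-⊕ q s i)) ⟨
    coeff ((p ⊕ r) ⊕ (q ⊕ s)) i ∎
    where open SR setoid

  ·-distrib-⊕ : ∀ a p q → a · (p ⊕ q) ≋ a · p ⊕ a · q
  ·-distrib-⊕ a p q .at i = begin
    coeff (a · (p ⊕ q)) i             ≈⟨ trans (coeff-· a (p ⊕ q) i) (*-congˡ (coeff-⊕ p q i)) ⟩
    a * (coeff p i + coeff q i)       ≈⟨ distribˡ _ _ _ ⟩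
    a * coeff p i + a * coeff q i     ≈⟨ trans (coeff-⊕ (a · p) (a · q) i) (+-cong (coeff-· a p i) (coeff-· a q i)) ⟨
    coeff (a · p ⊕ a · q) i ∎
    where open SR setoid

  +-distrib-· : ∀ a b p → (a + b) · p ≋ a · p ⊕ b · p
  +-distrib-· a b p .at i = begin
    coeff ((a + b) · p) i             ≈⟨ coeff-· (a + b) p i ⟩
    (a + b) * coeff p i               ≈⟨ distribʳ _ _ _ ⟩
    a * coeff p i + b * coeff p i     ≈⟨ trans (coeff-⊕ (a · p) (b · p) i) (+-cong (coeff-· a p i) (coeff-· b p i)) ⟨
    coeff (a · p ⊕ b · p) i ∎
    where open SR setoid

  ·-· : ∀ a b p → a · (b · p) ≋ (a * b) · p
  ·-· a b p .at i = begin
    coeff (a · (b · p)) i   ≈⟨ trans (coeff-· a (b · p) i) (*-congˡ (coeff-· b p i)) ⟩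
    a * (b * coeff p i)     ≈⟨ *-assoc _ _ _ ⟨
    (a * b) * coeff p i     ≈⟨ coeff-· (a * b) p i ⟨
    coeff ((a * b) · p) i ∎
    where open SR setoid

  0·≋[] : ∀ {a} p → a ≈ 0# → a · p ≋ []
  0·≋[] {a} p e .at i = trans (coeff-· a p i) (trans (*-congʳ e) (zeroˡ _))

  1·≋ : ∀ p → 1# · p ≋ p
  1·≋ p .at i = trans (coeff-· 1# p i) (*-identityˡ _)

  ⊛-congʳ : ∀ p {q q′} → q ≋ q′ → p ⊛ q ≋ p ⊛ q′
  ⊛-congʳ []      e = ≋-refl
  ⊛-congʳ (a ∷ p) e = ⊕-cong (·-cong refl e) (∷-cong refl (⊛-congʳ p e))

  ⊛-zeroˡ : ∀ {p} q → p ≋ [] → p ⊛ q ≋ []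
  ⊛-zeroˡ {[]}    q e = ≋-refl
  ⊛-zeroˡ {a ∷ p} q e = ⊕-cong (0·≋[] q (at e 0))
    (∷-≋[] refl (⊛-zeroˡ q (≋-tail-[] e)))

  ⊛-congˡ : ∀ {p p′} q → p ≋ p′ → p ⊛ q ≋ p′ ⊛ q
  ⊛-congˡ {[]}    {p′}     q e = ≋-sym (⊛-zeroˡ q (≋-sym e))
  ⊛-congˡ {a ∷ p} {[]}     q e = ⊛-zeroˡ q e
  ⊛-congˡ {a ∷ p} {b ∷ p′} q e = ⊕-cong (·-cong (at e 0) (≋-refl {q}))
    (∷-cong refl (⊛-congˡ q (≋-tail e)))

  ⊛-cong : ∀ {p p′ q q′} → p ≋ p′ → q ≋ q′ → p ⊛ q ≋ p′ ⊛ q′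
  ⊛-cong {p} {p′} {q} {q′} e f = ≋-trans (⊛-congʳ p f) (⊛-congˡ q′ e)

  shift-⊕ : ∀ p q → (0# ∷ p) ⊕ (0# ∷ q) ≋ 0# ∷ (p ⊕ q)
  shift-⊕ p q = ∷-cong (+-identityˡ 0#) ≋-refl

  ·-shift : ∀ a p → a · (0# ∷ p) ≋ 0# ∷ a · p
  ·-shift a p = ∷-cong (zeroʳ a) ≋-refl

  ⊛-distribʳ : ∀ r p q → (p ⊕ q) ⊛ r ≋ p ⊛ r ⊕ q ⊛ r
  ⊛-distribʳ r []      q       = ≋-refl
  ⊛-distribʳ r (a ∷ p) []      = ≋-sym (⊕-identityʳ _)
  ⊛-distribʳ r (a ∷ p) (b ∷ q) = begin
    (a + b) · r ⊕ (0# ∷ (p ⊕ q) ⊛ r)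
      ≈⟨ ⊕-cong (+-distrib-· a b r) (∷-cong refl (⊛-distribʳ r p q)) ⟩
    (a · r ⊕ b · r) ⊕ (0# ∷ (p ⊛ r ⊕ q ⊛ r))
      ≈⟨ ⊕-cong (≋-refl {a · r ⊕ b · r}) (≋-sym (shift-⊕ (p ⊛ r) (q ⊛ r))) ⟩
    (a · r ⊕ b · r) ⊕ ((0# ∷ p ⊛ r) ⊕ (0# ∷ q ⊛ r))
      ≈⟨ ⊕-interchange (a · r) (b · r) _ _ ⟩
    (a · r ⊕ (0# ∷ p ⊛ r)) ⊕ (b · r ⊕ (0# ∷ q ⊛ r)) ∎
    where open SR ≋-setoid

  ·-⊛ : ∀ a p q → (a · p) ⊛ q ≋ a · (p ⊛ q)
  ·-⊛ a []      q = ≋-refl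
  ·-⊛ a (b ∷ p) q = begin
    (a * b) · q ⊕ (0# ∷ (a · p) ⊛ q)    ≈⟨ ⊕-cong (≋-sym (·-· a b q)) (∷-cong refl (·-⊛ a p q)) ⟩
    a · (b · q) ⊕ (0# ∷ a · (p ⊛ q))    ≈⟨ ⊕-cong (≋-refl {a · (b · q)}) (≋-sym (·-shift a (p ⊛ q))) ⟩
    a · (b · q) ⊕ a · (0# ∷ p ⊛ q)      ≈⟨ ≋-sym (·-distrib-⊕ a (b · q) (0# ∷ p ⊛ q)) ⟩
    a · (b · q ⊕ (0# ∷ p ⊛ q)) ∎
    where open SR ≋-setoid

  shift-⊛ : ∀ p q → (0# ∷ p) ⊛ q ≋ 0# ∷ (p ⊛ q)
  shift-⊛ p q = ⊕-cong {0# · q} {[]} (0·≋[] q refl) ≋-refl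

  ⊛-assoc : ∀ p q r → (p ⊛ q) ⊛ r ≋ p ⊛ (q ⊛ r)
  ⊛-assoc []      q r = ≋-refl
  ⊛-assoc (a ∷ p) q r = begin
    (a · q ⊕ (0# ∷ p ⊛ q)) ⊛ r            ≈⟨ ⊛-distribʳ r (a · q) (0# ∷ p ⊛ q) ⟩
    (a · q) ⊛ r ⊕ (0# ∷ p ⊛ q) ⊛ r        ≈⟨ ⊕-cong (·-⊛ a q r) (shift-⊛ (p ⊛ q) r) ⟩
    a · (q ⊛ r) ⊕ (0# ∷ (p ⊛ q) ⊛ r)      ≈⟨ ⊕-cong (≋-refl {a · (q ⊛ r)}) (∷-cong refl (⊛-assoc p q r)) ⟩
    a · (q ⊛ r) ⊕ (0# ∷ p ⊛ (q ⊛ r)) ∎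
    where open SR ≋-setoid

  ⊛-zeroʳ : ∀ p → p ⊛ [] ≋ []
  ⊛-zeroʳ []      = ≋-refl
  ⊛-zeroʳ (a ∷ p) = ∷-≋[] refl (⊛-zeroʳ p)

  ⊛-∷ : ∀ p b q → p ⊛ (b ∷ q) ≋ b · p ⊕ (0# ∷ p ⊛ q)
  ⊛-∷ []      b q = ≋-sym 0∷[]
  ⊛-∷ (a ∷ p) b q = ∷-cong (+-congʳ (*-comm a b)) (begin
    a · q ⊕ p ⊛ (b ∷ q)              ≈⟨ ⊕-cong (≋-refl {a · q}) (⊛-∷ p b q) ⟩
    a · q ⊕ (b · p ⊕ (0# ∷ p ⊛ q))   ≈⟨ ≋-sym (⊕-assoc (a · q) (b · p) _) ⟩
    (a · q ⊕ b · p) ⊕ (0# ∷ p ⊛ q)   ≈⟨ ⊕-cong (⊕-comm (a · q) (b · p)) ≋-refl ⟩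
    (b · p ⊕ a · q) ⊕ (0# ∷ p ⊛ q)   ≈⟨ ⊕-assoc (b · p) (a · q) _ ⟩
    b · p ⊕ (a · q ⊕ (0# ∷ p ⊛ q)) ∎)
    where open SR ≋-setoid

  ⊛-comm : ∀ p q → p ⊛ q ≋ q ⊛ p
  ⊛-comm []      q = ≋-sym (⊛-zeroʳ q)
  ⊛-comm (a ∷ p) q = ≋-trans (⊕-cong (≋-refl {a · q}) (∷-cong refl (⊛-comm p q))) (≋-sym (⊛-∷ q a p))

  const-⊛ : ∀ a q → const a ⊛ q ≋ a · q
  const-⊛ a q = ≋-trans (⊕-cong (≋-refl {a · q}) 0∷[]) (⊕-identityʳ _)

  ⊛-identityˡ : ∀ p → const 1# ⊛ p ≋ p
  ⊛-identityˡ p = ≋-trans (const-⊛ 1# p) (1·≋ p)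

  abstract
    poly-isCommutativeRing : IsCommutativeRing _≋_ _⊕_ _⊛_ ⊖_ [] (const 1#)
    poly-isCommutativeRing = record
      { isRing = record
        { +-isAbelianGroup = record
          { isGroup = record
            { isMonoid = record
              { isSemigroup = record
                { isMagma = record { isEquivalence = Setoid.isEquivalence ≋-setoid ; ∙-cong = ⊕-cong }
                ; assoc = ⊕-assoc }
              ; identity = (λ p → ≋-refl) , ⊕-identityʳ }
            ; inverse = ⊖-inverseˡ , ⊖-inverseʳ
            ; ⁻¹-cong = ⊖-cong }
          ; comm = ⊕-comm }
        ; *-cong = ⊛-cong
        ; *-assoc = ⊛-assoc
        ; *-identity = ⊛-identityˡ , λ p → ≋-trans (⊛-comm p _) (⊛-identityˡ p)
        ; distrib = (λ p q r → ≋-trans (⊛-comm p (q ⊕ r)) (≋-trans (⊛-distribʳ p q r) (⊕-cong (⊛-comm q p) (⊛-comm r p))))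
                  , ⊛-distribʳ }
      ; *-comm = ⊛-comm }

  polyRing : CommutativeRing c ℓ
  polyRing = record { isCommutativeRing = poly-isCommutativeRing }

  -- One homomorphism serves for evaluation at a polynomial in T, for substitutions in Z and for the
  -- change of variables behind the weighted degree.
  module Eval {c′ ℓ′} (S : CommutativeRing c′ ℓ′) (φ : Carrier → CommutativeRing.Carrier S)
    (φ-cong : ∀ {a b} → a ≈ b → CommutativeRing._≈_ S (φ a) (φ b))
    (φ-+ : ∀ a b → CommutativeRing._≈_ S (φ (a + b)) (CommutativeRing._+_ S (φ a) (φ b)))
    (φ-* : ∀ a b → CommutativeRing._≈_ S (φ (a * b)) (CommutativeRing._*_ S (φ a) (φ b)))
    (φ-0 : CommutativeRing._≈_ S (φ 0#) (CommutativeRing.0# S))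
    (s : CommutativeRing.Carrier S) where
    private
      module S = CommutativeRing S
      module ES = RingSolver S

    ev : Poly → S.Carrier
    ev []      = S.0#
    ev (a ∷ p) = φ a S.+ s S.* ev p

    ev-≋[] : ∀ {p} → p ≋ [] → ev p S.≈ S.0#
    ev-≋[] {[]}    e = S.refl
    ev-≋[] {a ∷ p} e = S.trans (S.+-cong (S.trans (φ-cong (at e 0)) φ-0) (S.*-congˡ (ev-≋[] (≋-tail-[] e))))
      (S.trans (S.+-identityˡ _) (S.zeroʳ s))

    ev-cong : ∀ {p q} → p ≋ q → ev p S.≈ ev q
    ev-cong {[]}    {q}     e = S.sym (ev-≋[] (≋-sym e))
    ev-cong {a ∷ p} {[]}    e = ev-≋[] e
    ev-cong {a ∷ p} {b ∷ q} e = S.+-cong (φ-cong (at e 0)) (S.*-congˡ (ev-cong (≋-tail e)))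

    ev-⊕ : ∀ p q → ev (p ⊕ q) S.≈ ev p S.+ ev q
    ev-⊕ []      q       = S.sym (S.+-identityˡ _)
    ev-⊕ (a ∷ p) []      = S.sym (S.+-identityʳ _)
    ev-⊕ (a ∷ p) (b ∷ q) = begin
      φ (a + b) S.+ s S.* ev (p ⊕ q)                    ≈⟨ S.+-cong (φ-+ a b) (S.*-congˡ (ev-⊕ p q)) ⟩
      (φ a S.+ φ b) S.+ s S.* (ev p S.+ ev q)
        ≈⟨ ES.solve 5 (λ a b s p q → (a ES.:+ b) ES.:+ s ES.:* (p ES.:+ q) ES.:= (a ES.:+ s ES.:* p) ES.:+ (b ES.:+ s ES.:* q)) S.refl _ _ _ _ _ ⟩
      (φ a S.+ s S.* ev p) S.+ (φ b S.+ s S.* ev q) ∎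
      where open SR S.setoid

    ev-· : ∀ a p → ev (a · p) S.≈ φ a S.* ev p
    ev-· a []      = S.sym (S.zeroʳ _)
    ev-· a (b ∷ p) = begin
      φ (a * b) S.+ s S.* ev (a · p)        ≈⟨ S.+-cong (φ-* a b) (S.*-congˡ (ev-· a p)) ⟩
      φ a S.* φ b S.+ s S.* (φ a S.* ev p)  ≈⟨ ES.solve 4 (λ a b s p → a ES.:* b ES.:+ s ES.:* (a ES.:* p) ES.:= a ES.:* (b ES.:+ s ES.:* p)) S.refl _ _ _ _ ⟩
      φ a S.* (φ b S.+ s S.* ev p) ∎
      where open SR S.setoid

    ev-⊛ : ∀ p q → ev (p ⊛ q) S.≈ ev p S.* ev q
    ev-⊛ []      q = S.sym (S.zeroˡ _)
    ev-⊛ (a ∷ p) q = begin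
      ev (a · q ⊕ (0# ∷ p ⊛ q))                     ≈⟨ ev-⊕ (a · q) (0# ∷ p ⊛ q) ⟩
      ev (a · q) S.+ (φ 0# S.+ s S.* ev (p ⊛ q))    ≈⟨ S.+-cong (ev-· a q) (S.+-cong φ-0 (S.*-congˡ (ev-⊛ p q))) ⟩
      φ a S.* ev q S.+ (S.0# S.+ s S.* (ev p S.* ev q)) ≈⟨ S.+-congˡ (S.+-identityˡ _) ⟩
      φ a S.* ev q S.+ s S.* (ev p S.* ev q)
        ≈⟨ ES.solve 4 (λ a q s p → a ES.:* q ES.:+ s ES.:* (p ES.:* q) ES.:= (a ES.:+ s ES.:* p) ES.:* q) S.refl _ _ _ _ ⟩
      (φ a S.+ s S.* ev p) S.* ev q ∎
      where open SR S.setoid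

-- Domains, degrees and pseudo-division.

record Domain c ℓ : Set (Level.suc (c ⊔ ℓ)) where
  field
    cring   : CommutativeRing c ℓ
  open CommutativeRing cring
  field
    _≟0     : ∀ x → Dec (x ≈ 0#)
    noZeroDivisors : ∀ x y → x * y ≈ 0# → x ≈ 0# ⊎ y ≈ 0#
    1≉0     : ¬ (1# ≈ 0#)

record Field c ℓ : Set (Level.suc (c ⊔ ℓ)) where
  field
    domain  : Domain c ℓ
  open Domain domain using (cring)
  open CommutativeRing cring
  field
    inverse : ∀ x → ¬ (x ≈ 0#) → Σ Carrier λ y → x * y ≈ 1#

module DomainProperties {c ℓ} (D : Domain c ℓ) where
  open Domain D
  open CommutativeRing cring
  open RingSolver cring

  *-nonzero : ∀ {x y} → ¬ (x ≈ 0#) → ¬ (y ≈ 0#) → ¬ (x * y ≈ 0#)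
  *-nonzero nx ny e = [ nx , ny ]′ (noZeroDivisors _ _ e)

  x≈y⇒x-y≈0 : ∀ {x y} → x ≈ y → x - y ≈ 0#
  x≈y⇒x-y≈0 e = trans (+-congʳ e) (-‿inverseʳ _)

  x-y≈0⇒x≈y : ∀ {x y} → x - y ≈ 0# → x ≈ y
  x-y≈0⇒x≈y {x} {y} e = begin
    x            ≈⟨ solve 2 (λ x y → x := (x :- y) :+ y) refl x y ⟩
    (x - y) + y  ≈⟨ trans (+-congʳ e) (+-identityˡ y) ⟩
    y ∎
    where open SR setoid

  *-cancelˡ : ∀ {x y z} → ¬ (x ≈ 0#) → x * y ≈ x * z → y ≈ z
  *-cancelˡ {x} {y} {z} nx e with noZeroDivisors x (y - z)
    (trans (solve 3 (λ x y z → x :* (y :- z) := x :* y :- x :* z) refl x y z) (x≈y⇒x-y≈0 e))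
  ... | inj₁ p = ⊥-elim (nx p)
  ... | inj₂ p = x-y≈0⇒x≈y p

module Degree {c ℓ} (D : Domain c ℓ) where
  open Domain D
  open CommutativeRing cring
  open RingSolver cring
  open DomainProperties D
  open Polynomial cring
  open Algebra.Properties.Ring ring using (-0#≈0#)
  module PR = CommutativeRing polyRing
  module PS = RingSolver polyRing

  -- A strict bound holds for the zero polynomial too, and `Deg< 0` forces a polynomial to be zero;
  -- no degree has to be assigned to zero.
  Deg< : ℕ → Poly → Set ℓ
  Deg< n p = ∀ i → n ≤ i → coeff p i ≈ 0#

  record HasDeg (n : ℕ) (p : Poly) : Set ℓ where
    constructor hasDeg
    field
      bounded : Deg< (suc n) p
      leading : ¬ (coeff p n ≈ 0#)
  open HasDeg public

  Deg<-cong : ∀ {n p q} → p ≋ q → Deg< n p → Deg< n q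
  Deg<-cong e d i l = trans (sym (at e i)) (d i l)

  HasDeg-cong : ∀ {n p q} → p ≋ q → HasDeg n p → HasDeg n q
  HasDeg-cong {n} {p} {q} e (hasDeg b l) = hasDeg (Deg<-cong {p = p} {q} e b) (λ z → l (trans (at e n) z))

  Deg<-mono : ∀ {m n} p → m ≤ n → Deg< m p → Deg< n p
  Deg<-mono p l d i h = d i (≤-trans l h)

  Deg<-zero : ∀ {p} → Deg< 0 p → p ≋ []
  Deg<-zero d .at i = d i z≤n

  Deg<-[] : ∀ {n p} → p ≋ [] → Deg< n p
  Deg<-[] e i _ = at e i

  Deg<-⊕ : ∀ {n} p q → Deg< n p → Deg< n q → Deg< n (p ⊕ q)
  Deg<-⊕ p q d e i l = trans (coeff-⊕ p q i) (trans (+-cong (d i l) (e i l)) (+-identityˡ _))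

  Deg<-· : ∀ {n} a p → Deg< n p → Deg< n (a · p)
  Deg<-· a p d i l = trans (coeff-· a p i) (trans (*-congˡ (d i l)) (zeroʳ _))

  Deg<-⊖ : ∀ {n} p → Deg< n p → Deg< n (⊖ p)
  Deg<-⊖ p d i l = trans (coeff-⊖ p i) (trans (-‿cong (d i l)) -0#≈0#)

  Deg<-tail : ∀ {n a p} → Deg< (suc n) (a ∷ p) → Deg< n p
  Deg<-tail d i l = d (suc i) (s≤s l)

  Deg<-⊛ : ∀ {a b} p q → Deg< a p → Deg< (suc b) q → Deg< (a ℕ.+ b) (p ⊛ q)
  Deg<-⊛ {zero}      p       q d e = Deg<-[] {p = p ⊛ q} (⊛-zeroˡ {p} q (Deg<-zero {p} d))
  Deg<-⊛ {suc a}     []      q d e i l = refl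
  Deg<-⊛ {suc a} {b} (x ∷ p) q d e (suc i) (s≤s l) = trans (coeff-⊕ (x · q) (0# ∷ p ⊛ q) (suc i))
    (trans (+-cong (Deg<-· x q e (suc i) (s≤s (≤-trans (ℕ.m≤n+m b a) l)))
                   (Deg<-⊛ p q (Deg<-tail {a = x} {p} d) e i l)) (+-identityˡ _))

  coeff-⊛-top : ∀ {a b} p q → Deg< (suc a) p → Deg< (suc b) q →
    coeff (p ⊛ q) (a ℕ.+ b) ≈ coeff p a * coeff q b
  coeff-⊛-top {a}     {b} []      q d e = sym (zeroˡ _)
  coeff-⊛-top {zero}  {b} (x ∷ p) q d e = begin
    coeff (x · q ⊕ (0# ∷ p ⊛ q)) b           ≈⟨ coeff-⊕ (x · q) (0# ∷ p ⊛ q) b ⟩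
    coeff (x · q) b + coeff (0# ∷ p ⊛ q) b   ≈⟨ +-cong (coeff-· x q b)
      (at (∷-≋[] refl (⊛-zeroˡ q (Deg<-zero {p} (Deg<-tail {a = x} {p} d)))) b) ⟩
    x * coeff q b + 0#                       ≈⟨ +-identityʳ _ ⟩
    x * coeff q b ∎
    where open SR setoid
  coeff-⊛-top {suc a} {b} (x ∷ p) q d e = begin
    coeff (x · q ⊕ (0# ∷ p ⊛ q)) (suc (a ℕ.+ b))       ≈⟨ coeff-⊕ (x · q) (0# ∷ p ⊛ q) (suc (a ℕ.+ b)) ⟩
    coeff (x · q) (suc (a ℕ.+ b)) + coeff (p ⊛ q) (a ℕ.+ b)
      ≈⟨ +-cong (Deg<-· x q e (suc (a ℕ.+ b)) (s≤s (ℕ.m≤n+m b a))) (coeff-⊛-top p q (Deg<-tail {a = x} {p} d) e) ⟩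
    0# + coeff p a * coeff q b               ≈⟨ +-identityˡ _ ⟩
    coeff p a * coeff q b ∎
    where open SR setoid

  HasDeg-⊛ : ∀ {a b} p q → HasDeg a p → HasDeg b q → HasDeg (a ℕ.+ b) (p ⊛ q)
  HasDeg-⊛ p q (hasDeg d l) (hasDeg e k) = hasDeg (Deg<-⊛ p q d e)
    (λ z → *-nonzero l k (trans (sym (coeff-⊛-top p q d e)) z))

  degree? : ∀ p → (p ≋ []) ⊎ (∃ λ n → HasDeg n p)
  degree? [] = inj₁ ≋-refl
  degree? (a ∷ p) with degree? p
  ... | inj₂ (n , hasDeg d l) = inj₂ (suc n , hasDeg (λ { (suc i) (s≤s h) → d i h }) l)
  ... | inj₁ e with a ≟0
  ...   | yes z = inj₁ (∷-≋[] z e)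
  ...   | no z  = inj₂ (0 , hasDeg (λ { (suc i) _ → at e i }) z)

  HasDeg-nonzero : ∀ {n p} → HasDeg n p → ¬ (p ≋ [])
  HasDeg-nonzero (hasDeg _ l) e = l (at e _)

  nonzero-HasDeg : ∀ {p} → ¬ (p ≋ []) → ∃ λ n → HasDeg n p
  nonzero-HasDeg {p} nz with degree? p
  ... | inj₁ e = ⊥-elim (nz e)
  ... | inj₂ h = h

  HasDeg-Deg< : ∀ {n m p} → HasDeg n p → Deg< m p → n < m
  HasDeg-Deg< {n} {m} (hasDeg _ l) d = ℕ.≰⇒> (λ h → l (d n h))

  HasDeg-unique : ∀ {n m p} → HasDeg n p → HasDeg m p → n ≡ m
  HasDeg-unique {p = p} h k = ℕ.≤-antisym (ℕ.≤-pred (HasDeg-Deg< {p = p} h (bounded k))) (ℕ.≤-pred (HasDeg-Deg< {p = p} k (bounded h)))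

  Deg<-exists : ∀ p → ∃ λ n → Deg< n p
  Deg<-exists []      = 0 , λ i _ → refl
  Deg<-exists (a ∷ p) with Deg<-exists p
  ... | n , d = suc n , λ { (suc i) (s≤s l) → d i l }

  ≋[]? : ∀ p → Dec (p ≋ [])
  ≋[]? p with degree? p
  ... | inj₁ e       = yes e
  ... | inj₂ (n , h) = no (HasDeg-nonzero {p = p} h)

  polyDomain : Domain c ℓ
  polyDomain = record
    { cring = polyRing
    ; _≟0 = ≋[]?
    ; noZeroDivisors = nzd
    ; 1≉0 = λ e → 1≉0 (at e 0)
    }
    where
    nzd : ∀ p q → p ⊛ q ≋ [] → (p ≋ []) ⊎ (q ≋ [])
    nzd p q e with degree? p | degree? q
    ... | inj₁ z       | _            = inj₁ z
    ... | inj₂ _       | inj₁ z       = inj₂ z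
    ... | inj₂ (a , h) | inj₂ (b , k) = ⊥-elim (HasDeg-nonzero {p = p ⊛ q} (HasDeg-⊛ p q h k) e)

  mono : ℕ → Carrier → Poly
  mono zero    a = const a
  mono (suc k) a = 0# ∷ mono k a

  mono-Deg< : ∀ k a → Deg< (suc k) (mono k a)
  mono-Deg< zero    a (suc i) (s≤s l) = refl
  mono-Deg< (suc k) a (suc i) (s≤s l) = mono-Deg< k a i l

  coeff-mono : ∀ k a → coeff (mono k a) k ≡ a
  coeff-mono zero    a = ≡.refl
  coeff-mono (suc k) a = coeff-mono k a

  coeff-sub : ∀ p q i → coeff (p PR.- q) i ≈ coeff p i - coeff q i
  coeff-sub p q i = trans (coeff-⊕ p (⊖ q) i) (+-congˡ (coeff-⊖ q i))

  Deg<-pred : ∀ {n p} → Deg< (suc n) p → coeff p n ≈ 0# → Deg< n p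
  Deg<-pred {n} {p} d z i l with ℕ.m≤n⇒m<n∨m≡n l
  ... | inj₁ h      = d i h
  ... | inj₂ ≡.refl = z

  -- Leading coefficients in K[T][Z] have no inverses, so f is first multiplied by a scalar, for
  -- which `pseudoDivide` takes a power of the leading coefficient of v.
  record PseudoDivision (e : ℕ) (f v : Poly) : Set (c ⊔ ℓ) where
    field
      {multiplier}        : Carrier
      {quotient remainder} : Poly
      multiplier≉0 : ¬ (multiplier ≈ 0#)
      equation     : multiplier · f ≋ v ⊛ quotient ⊕ remainder
      small        : Deg< e remainder

  pseudoDivide : ∀ {e v} → HasDeg e v → ∀ N f → Deg< N f → PseudoDivision e f v
  pseudoDivide {e} {v} hv zero f d = record
    { multiplier = 1# ; quotient = [] ; remainder = f ; multiplier≉0 = 1≉0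
    ; equation = ≋-trans (1·≋ f) (≋-sym (⊕-cong (⊛-zeroʳ v) (≋-refl {f})))
    ; small = Deg<-mono f z≤n d }
  pseudoDivide {e} {v} hv (suc N) f d with suc N ℕ.≤? e
  ... | yes l = record
    { multiplier = 1# ; quotient = [] ; remainder = f ; multiplier≉0 = 1≉0
    ; equation = ≋-trans (1·≋ f) (≋-sym (⊕-cong (⊛-zeroʳ v) (≋-refl {f})))
    ; small = Deg<-mono f l d }
  ... | no nl = record
    { multiplier = c′ * lc ; quotient = q′ ⊕ c′ · s ; remainder = remainder
    ; multiplier≉0 = *-nonzero multiplier≉0 (leading hv)
    ; equation = begin
        (c′ * lc) · f                           ≈⟨ ·-· c′ lc f ⟨
        c′ · (lc · f)                           ≈⟨ ·-cong (refl {c′}) (PS.solve 2 (λ x y → x PS.:= (x PS.:- y) PS.:+ y) ≋-refl (lc · f) (s ⊛ v)) ⟩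
        c′ · (f′ ⊕ s ⊛ v)                       ≈⟨ ·-distrib-⊕ c′ f′ (s ⊛ v) ⟩
        c′ · f′ ⊕ c′ · (s ⊛ v)                  ≈⟨ ⊕-cong equation (≋-sym (·-⊛ c′ s v)) ⟩
        (v ⊛ q′ ⊕ remainder) ⊕ (c′ · s) ⊛ v
          ≈⟨ PS.solve 4 (λ v q r s → (v PS.:* q PS.:+ r) PS.:+ s PS.:* v PS.:= v PS.:* (q PS.:+ s) PS.:+ r) ≋-refl v q′ remainder (c′ · s) ⟩
        v ⊛ (q′ ⊕ c′ · s) ⊕ remainder ∎
    ; small = small }
    where
    open SR ≋-setoid
    e≤N : e ≤ N
    e≤N = ℕ.≤-pred (ℕ.≰⇒> nl)
    lc = coeff v e
    s = mono (N ℕ.∸ e) (coeff f N)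
    f′ = lc · f PR.- s ⊛ v
    ds : Deg< (suc (N ℕ.∸ e ℕ.+ e)) (s ⊛ v)
    ds = Deg<-⊛ s v (mono-Deg< (N ℕ.∸ e) _) (bounded hv)
    top : coeff (s ⊛ v) N ≈ coeff f N * lc
    top = trans (reflexive (≡.cong (coeff (s ⊛ v)) (≡.sym (ℕ.m∸n+n≡m e≤N))))
      (trans (coeff-⊛-top s v (mono-Deg< (N ℕ.∸ e) _) (bounded hv))
        (*-congʳ (reflexive (coeff-mono (N ℕ.∸ e) _))))
    d′ : Deg< N f′
    d′ = Deg<-pred {p = f′} (Deg<-⊕ (lc · f) (⊖ (s ⊛ v)) (Deg<-· lc f d)
           (Deg<-⊖ (s ⊛ v) (≡.subst (λ k → Deg< (suc k) (s ⊛ v)) (ℕ.m∸n+n≡m e≤N) ds)))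
      (trans (coeff-sub (lc · f) (s ⊛ v) N) (x≈y⇒x-y≈0 (trans (coeff-· lc f N) (trans (*-comm _ _) (sym top)))))
    open PseudoDivision (pseudoDivide hv N f′ d′) renaming (multiplier to c′; quotient to q′)

-- Divisibility, the Euclidean algorithm, primes and lcms in K[T].

module Divisibility {c ℓ} (R : CommutativeRing c ℓ) where
  open CommutativeRing R
  open RingSolver R
  open Div *-commutativeSemigroup public
    using (_∣_; module _∣ʳ_; _,_; x∣xy; ∣-respʳ-≈; ∣-respˡ-≈)
    renaming (∣ʳ-trans to ∣-trans; x∣ʳyx to x∣yx; x∣y⇒zx∣zy to ∣-*-monoʳ; ∙-cong-∣ to ∣-*-mono)
  open SDiv semiring public using (_∣0; 1∣_) renaming (∣ʳ-refl to ∣-refl)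

  ∣-+ : ∀ {d x y} → d ∣ x → d ∣ y → d ∣ x + y
  ∣-+ {d} (p , e) (q , f) = p + q , trans (distribʳ d p q) (+-cong e f)

  ∣-*ˡ : ∀ {d x} y → d ∣ x → d ∣ y * x
  ∣-*ˡ y h = ∣-trans h (x∣yx _ y)

  ∣-*ʳ : ∀ {d x} y → d ∣ x → d ∣ x * y
  ∣-*ʳ y h = ∣-trans h (x∣xy _ y)

  ∣-neg : ∀ {d x} → d ∣ x → d ∣ - x
  ∣-neg {d} (p , e) = - p , trans (solve 2 (λ p d → (:- p) :* d := :- (p :* d)) refl p d) (-‿cong e)

  ∣-sub : ∀ {d x y} → d ∣ x → d ∣ y → d ∣ x - y
  ∣-sub h k = ∣-+ h (∣-neg k)

module Euclid {c ℓ} (K : Field c ℓ) where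
  open Field K using (inverse) renaming (domain to D)
  open CommutativeRing (Domain.cring D)
  open Domain D using (cring; _≟0; 1≉0)
  open Polynomial cring public
  open Degree D public
  open Divisibility polyRing public
  open DomainProperties polyDomain using () renaming (*-cancelˡ to ⊛-cancelˡ; *-nonzero to ⊛-nonzero) public


  record Division (e : ℕ) (f v : Poly) : Set (c ⊔ ℓ) where
    field
      {quotient remainder} : Poly
      equation : f ≋ v ⊛ quotient ⊕ remainder
      small    : Deg< e remainder

  divide : ∀ {e v} → HasDeg e v → ∀ f → Division e f v
  divide {e} {v} hv f = record
    { quotient = i · quotient ; remainder = i · remainder
    ; equation = begin
        f                                    ≈⟨ 1·≋ f ⟨
        1# · f                               ≈⟨ ·-cong (trans (sym ii) (*-comm multiplier i)) (≋-refl {f}) ⟩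
        (i * multiplier) · f                 ≈⟨ ·-· i multiplier f ⟨
        i · (multiplier · f)                 ≈⟨ ·-cong (refl {i}) equation ⟩
        i · (v ⊛ quotient ⊕ remainder)       ≈⟨ ·-distrib-⊕ i (v ⊛ quotient) remainder ⟩
        i · (v ⊛ quotient) ⊕ i · remainder
          ≈⟨ ⊕-cong (≋-trans (≋-sym (·-⊛ i v quotient)) (≋-trans (⊛-comm (i · v) quotient)
               (≋-trans (⊛-comm quotient (i · v)) (≋-trans (·-⊛ i v quotient)
               (≋-trans (·-cong (refl {i}) (⊛-comm v quotient)) (≋-trans (≋-sym (·-⊛ i quotient v)) (⊛-comm (i · quotient) v))))))) ≋-refl ⟩
        v ⊛ (i · quotient) ⊕ i · remainder ∎
    ; small = Deg<-· i remainder small }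
    where
    open SR ≋-setoid
    N = proj₁ (Deg<-exists f)
    open PseudoDivision (pseudoDivide hv N f (proj₂ (Deg<-exists f)))
    i = proj₁ (inverse multiplier multiplier≉0)
    ii = proj₂ (inverse multiplier multiplier≉0)

  ∣-degree : ∀ {e d p} → HasDeg e d → d ∣ p → Deg< e p → p ≋ []
  ∣-degree {e} {d} {p} hd (q , eq) dp with degree? q
  ... | inj₁ z = ≋-trans (≋-sym eq) (⊛-zeroˡ d z)
  ... | inj₂ (k , hk) = ⊥-elim (ℕ.<-irrefl ≡.refl (≤-<-trans (ℕ.m≤n+m e k)
          (HasDeg-Deg< {p = p} (HasDeg-cong eq (HasDeg-⊛ q d hk hd)) dp)))

  ∣-HasDeg : ∀ {a b d p} → HasDeg a d → HasDeg b p → d ∣ p → a ≤ b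
  ∣-HasDeg {a} {b} {d} {p} hd hp h with a ℕ.≤? b
  ... | yes l = l
  ... | no nl = ⊥-elim (HasDeg-nonzero {p = p} hp (∣-degree hd h (Deg<-mono p (ℕ.≰⇒> nl) (bounded hp))))

  ∣-nonzero : ∀ {d p} → d ∣ p → ¬ (p ≋ []) → ¬ (d ≋ [])
  ∣-nonzero {d} (q , eq) np z = np (≋-trans (≋-sym eq) (≋-trans (⊛-congʳ q z) (⊛-zeroʳ q)))

  divides? : ∀ {d} → ¬ (d ≋ []) → ∀ p → Dec (d ∣ p)
  divides? {d} nd p with nonzero-HasDeg nd
  ... | e , hd with ≋[]? remainder
    where open Division (divide hd p)
  ...   | yes z = yes (quotient , ≋-sym (≋-trans equation (≋-trans (⊕-cong (⊛-comm d quotient) z) (⊕-identityʳ _))))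
    where open Division (divide hd p)
  ...   | no nz = no λ h → nz (∣-degree hd (∣-respʳ-≈ (≋-sym rem≋) (∣-sub h (x∣xy d quotient))) small)
    where
    open Division (divide hd p)
    rem≋ : remainder ≋ (p PR.- d ⊛ quotient)
    rem≋ = ≋-trans (PS.solve 2 (λ a r → r PS.:= (a PS.:+ r) PS.:- a) ≋-refl (d ⊛ quotient) remainder)
      (⊕-cong (≋-sym equation) ≋-refl)

  record Bezout (a b : Poly) : Set (c ⊔ ℓ) where
    field
      gcd s t  : Poly
      gcd∣a    : gcd ∣ a
      gcd∣b    : gcd ∣ b
      identity : gcd ≋ s ⊛ a ⊕ t ⊛ b

  bezout′ : ∀ N a b → Deg< N b → Bezout a b
  bezout′ zero a b d = record
    { gcd = a ; s = const 1# ; t = [] ; gcd∣a = ∣-refl ; gcd∣b = ∣-respʳ-≈ (≋-sym (Deg<-zero {b} d)) (a ∣0)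
    ; identity = ≋-sym (≋-trans (⊕-identityʳ _) (⊛-identityˡ a)) }
  bezout′ (suc N) a b d with degree? b
  ... | inj₁ z = bezout′ 0 a b (λ i _ → at z i)
  ... | inj₂ (e , hb) = record
    { gcd = gcd ; s = t ; t = s PR.- t ⊛ quotient
    ; gcd∣a = ∣-respʳ-≈ (≋-sym equation) (∣-+ (∣-*ʳ quotient gcd∣a) gcd∣b)
    ; gcd∣b = gcd∣a
    ; identity = begin
        gcd                          ≈⟨ identity ⟩
        s ⊛ b ⊕ t ⊛ remainder
          ≈⟨ PS.solve 5 (λ s t b q r → s PS.:* b PS.:+ t PS.:* r PS.:= t PS.:* (b PS.:* q PS.:+ r) PS.:+ (s PS.:- t PS.:* q) PS.:* b) ≋-refl s t b quotient remainder ⟩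
        t ⊛ (b ⊛ quotient ⊕ remainder) ⊕ (s PR.- t ⊛ quotient) ⊛ b
          ≈⟨ ⊕-cong (⊛-congʳ t (≋-sym equation)) ≋-refl ⟩
        t ⊛ a ⊕ (s PR.- t ⊛ quotient) ⊛ b ∎ }
    where
    open SR ≋-setoid
    open Division (divide hb a)
    open Bezout (bezout′ N b remainder (Deg<-mono remainder (ℕ.≤-pred (HasDeg-Deg< {p = b} hb d)) small))

  bezout : ∀ a b → Bezout a b
  bezout a b = bezout′ _ a b (proj₂ (Deg<-exists b))

  one : Poly
  one = const 1#

  ∣one⇒∣ : ∀ {p} x → p ∣ one → p ∣ x
  ∣one⇒∣ x h = ∣-trans h (1∣ x)

  HasDeg-0⇒∣one : ∀ {p} → HasDeg 0 p → p ∣ one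
  HasDeg-0⇒∣one {p} h = const i , (begin
      const i ⊛ p                ≈⟨ const-⊛ i p ⟩
      i · p                      ≈⟨ ·-cong (refl {i}) p≋ ⟩
      const (i * coeff p 0)      ≈⟨ ∷-cong (trans (*-comm _ _) ii) ≋-refl ⟩
      one ∎)
    where
    open SR ≋-setoid
    i = proj₁ (inverse _ (leading h))
    ii = proj₂ (inverse _ (leading h))
    p≋ : p ≋ const (coeff p 0)
    p≋ .at zero    = refl
    p≋ .at (suc j) = bounded h (suc j) (s≤s z≤n)

  HasDeg-one : HasDeg 0 one
  HasDeg-one = hasDeg (λ { (suc i) _ → refl }) 1≉0

  -- Euclid's property is the form in which Gauss' lemma and the divisor count use primes; the
  -- successor in the degree excludes units.
  record Prime (π : Poly) : Set (c ⊔ ℓ) where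
    field
      {degree-1} : ℕ
      hasDegree  : HasDeg (suc degree-1) π
      euclid     : ∀ a b → π ∣ a ⊛ b → (π ∣ a) ⊎ (π ∣ b)

  Prime-nonzero : ∀ {π} → Prime π → ¬ (π ≋ [])
  Prime-nonzero {π} P = HasDeg-nonzero {p = π} (Prime.hasDegree P)

  -- Over a general field this would require a factorisation algorithm, so it stays a hypothesis
  -- until the finite field supplies it by search.
  PrimeFactors : Set (c ⊔ ℓ)
  PrimeFactors = ∀ {e p} → HasDeg (suc e) p → ∃ λ π → Prime π × π ∣ p

  -- The gcd of p and a is a unit or an associate of p. In the first case Bézout writes b as a
  -- combination of p and a b; in the second p divides a.
  irreducible⇒prime : ∀ {e p} → HasDeg (suc e) p →
    (∀ {d} g → g ∣ p → HasDeg d g → d ≡ 0 ⊎ d ≡ suc e) → Prime p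
  irreducible⇒prime {e} {p} hp irr = record { hasDegree = hp ; euclid = euc }
    where
    np : ¬ (p ≋ [])
    np = HasDeg-nonzero {p = p} hp
    euc : ∀ a b → p ∣ a ⊛ b → (p ∣ a) ⊎ (p ∣ b)
    euc a b h = go (irr gcd gcd∣a hg)
      where
      open Bezout (bezout p a)
      hg′ = nonzero-HasDeg (∣-nonzero gcd∣a np)
      hg = proj₂ hg′
      go : proj₁ hg′ ≡ 0 ⊎ proj₁ hg′ ≡ suc e → (p ∣ a) ⊎ (p ∣ b)
      go (inj₁ z) = inj₂ (∣-trans (1∣b (HasDeg-0⇒∣one (≡.subst (λ n → HasDeg n gcd) z hg))) ∣-refl)
        where
        1∣b : gcd ∣ one → p ∣ b
        1∣b (w , eq) = ∣-respʳ-≈ (begin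
            (w ⊛ s ⊛ b) ⊛ p ⊕ w ⊛ t ⊛ (a ⊛ b)
              ≈⟨ PS.solve 6 (λ w s b p t a → (w PS.:* s PS.:* b) PS.:* p PS.:+ w PS.:* t PS.:* (a PS.:* b)
                   PS.:= (w PS.:* (s PS.:* p PS.:+ t PS.:* a)) PS.:* b) ≋-refl w s b p t a ⟩
            (w ⊛ (s ⊛ p ⊕ t ⊛ a)) ⊛ b  ≈⟨ ⊛-congˡ b (⊛-congʳ w (≋-sym identity)) ⟩
            (w ⊛ gcd) ⊛ b              ≈⟨ ⊛-congˡ b eq ⟩
            one ⊛ b                    ≈⟨ ⊛-identityˡ b ⟩
            b ∎) (∣-+ (∣-*ˡ (w ⊛ s ⊛ b) ∣-refl) (∣-*ˡ (w ⊛ t) h))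
          where open SR ≋-setoid
      go (inj₂ f) = inj₁ (∣-trans (cofactor gcd∣a) gcd∣b)
        where
        cofactor : gcd ∣ p → p ∣ gcd
        cofactor (w , eq) with degree? w
        ... | inj₁ z = ⊥-elim (np (≋-trans (≋-sym eq) (⊛-zeroˡ gcd z)))
        ... | inj₂ (k , hw) with HasDeg-0⇒∣one (≡.subst (λ n → HasDeg n w) k≡0 hw)
          where
          k≡0 : k ≡ 0
          k≡0 = ℕ.+-cancelʳ-≡ (suc e) k 0 (≡.trans (≡.cong (k ℕ.+_) (≡.sym f))
                  (HasDeg-unique {p = p} (HasDeg-cong eq (HasDeg-⊛ w gcd hw hg)) hp))
        ...   | i , ieq = i , (begin
                  i ⊛ p            ≈⟨ ⊛-congʳ i (≋-sym eq) ⟩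
                  i ⊛ (w ⊛ gcd)    ≈⟨ ⊛-assoc i w gcd ⟨
                  (i ⊛ w) ⊛ gcd    ≈⟨ ⊛-congˡ gcd ieq ⟩
                  one ⊛ gcd        ≈⟨ ⊛-identityˡ gcd ⟩
                  gcd ∎)
          where open SR ≋-setoid

  -- Besides the universal property the record keeps coprime cofactors x and y with their Bézout
  -- relation, since `lcm-combination` computes with them.
  record LCM (a b : Poly) : Set (c ⊔ ℓ) where
    field
      lcm x y s t : Poly
      xb      : x ⊛ b ≋ lcm
      ya      : y ⊛ a ≋ lcm
      coprime : s ⊛ x ⊕ t ⊛ y ≋ one
      a∣lcm : a ∣ lcm
      b∣lcm : b ∣ lcm
      least : ∀ z → a ∣ z → b ∣ z → lcm ∣ z
      ∣product : lcm ∣ a ⊛ b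

  lcm-exists : ∀ a b → ¬ (a ≋ []) → LCM a b
  lcm-exists a b na = record
    { lcm = x ⊛ b ; x = x ; y = y ; s = s ; t = t ; xb = ≋-refl ; ya = eq₁ ; coprime = coprime
    ; a∣lcm = y , eq₁
    ; b∣lcm = x , ≋-refl
    ; least = least
    ; ∣product = gcd , ≋-trans (≋-sym (⊛-assoc gcd x b)) (⊛-congˡ b (≋-trans (⊛-comm gcd x) ex)) }
    where
    open SR ≋-setoid
    open Bezout (bezout a b)
    x = _∣ʳ_.quotient gcd∣a
    ex : x ⊛ gcd ≋ a
    ex = _∣ʳ_.equality gcd∣a
    y = _∣ʳ_.quotient gcd∣b
    ey : y ⊛ gcd ≋ b
    ey = _∣ʳ_.equality gcd∣b
    ng : ¬ (gcd ≋ [])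
    ng = ∣-nonzero gcd∣a na
    eq₁ : y ⊛ a ≋ x ⊛ b
    eq₁ = begin
      y ⊛ a            ≈⟨ ⊛-congʳ y ex ⟨
      y ⊛ (x ⊛ gcd)    ≈⟨ PS.solve 3 (λ x y g → y PS.:* (x PS.:* g) PS.:= x PS.:* (y PS.:* g)) ≋-refl x y gcd ⟩
      x ⊛ (y ⊛ gcd)    ≈⟨ ⊛-congʳ x ey ⟩
      x ⊛ b ∎
    coprime : s ⊛ x ⊕ t ⊛ y ≋ one
    coprime = ⊛-cancelˡ {gcd} {s ⊛ x ⊕ t ⊛ y} {one} ng (begin
      gcd ⊛ (s ⊛ x ⊕ t ⊛ y)
        ≈⟨ PS.solve 5 (λ g s x t y → g PS.:* (s PS.:* x PS.:+ t PS.:* y) PS.:= s PS.:* (x PS.:* g) PS.:+ t PS.:* (y PS.:* g)) ≋-refl gcd s x t y ⟩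
      s ⊛ (x ⊛ gcd) ⊕ t ⊛ (y ⊛ gcd) ≈⟨ ⊕-cong (⊛-congʳ s ex) (⊛-congʳ t ey) ⟩
      s ⊛ a ⊕ t ⊛ b   ≈⟨ identity ⟨
      gcd             ≈⟨ PR.*-identityʳ gcd ⟨
      gcd ⊛ one ∎)
    -- Write z as s x z + t y z and insert z = v b in the first summand, z = u a in the second; both
    -- become multiples of x b.
    least : ∀ z → a ∣ z → b ∣ z → x ⊛ b ∣ z
    least z (u , eu) (v , ev) = s ⊛ v ⊕ t ⊛ u , (begin
      (s ⊛ v ⊕ t ⊛ u) ⊛ (x ⊛ b)
        ≈⟨ PS.solve 6 (λ s v t u x b → (s PS.:* v PS.:+ t PS.:* u) PS.:* (x PS.:* b)
             PS.:= s PS.:* x PS.:* (v PS.:* b) PS.:+ t PS.:* u PS.:* (x PS.:* b)) ≋-refl s v t u x b ⟩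
      s ⊛ x ⊛ (v ⊛ b) ⊕ t ⊛ u ⊛ (x ⊛ b) ≈⟨ ⊕-cong (⊛-congʳ (s ⊛ x) ev) (⊛-congʳ (t ⊛ u) (≋-sym eq₁)) ⟩
      s ⊛ x ⊛ z ⊕ t ⊛ u ⊛ (y ⊛ a)
        ≈⟨ PS.solve 7 (λ s x z t u y a → s PS.:* x PS.:* z PS.:+ t PS.:* u PS.:* (y PS.:* a)
             PS.:= s PS.:* x PS.:* z PS.:+ t PS.:* y PS.:* (u PS.:* a)) ≋-refl s x z t u y a ⟩
      s ⊛ x ⊛ z ⊕ t ⊛ y ⊛ (u ⊛ a) ≈⟨ ⊕-cong ≋-refl (⊛-congʳ (t ⊛ y) eu) ⟩
      s ⊛ x ⊛ z ⊕ t ⊛ y ⊛ z       ≈⟨ ⊛-distribʳ z (s ⊛ x) (t ⊛ y) ⟨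
      (s ⊛ x ⊕ t ⊛ y) ⊛ z         ≈⟨ ⊛-congˡ z coprime ⟩
      one ⊛ z                     ≈⟨ ⊛-identityˡ z ⟩
      z ∎)

  -- Iterated, this gives lcmⱼ gcd(D , yⱼ) ∈ (D , lcmⱼ yⱼ): gcd distributes over lcm.
  lcm-combination : ∀ {D a b g K M p r α β} (l : LCM a b) →
    g ≋ p ⊛ D ⊕ r ⊛ a → K ≋ α ⊛ D ⊕ β ⊛ b → g ∣ M → K ∣ M →
    ∃ λ A → ∃ λ B → M ≋ A ⊛ D ⊕ B ⊛ LCM.lcm l
  lcm-combination {D} {a} {b} {g} {K} {M} {p} {r} {α} {β} l eg eK (u , eu) (v , ev) =
    s ⊛ x ⊛ v ⊛ α ⊕ t ⊛ y ⊛ u ⊛ p , s ⊛ v ⊛ β ⊕ t ⊛ u ⊛ r , (begin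
      M                                 ≈⟨ ⊛-identityˡ M ⟨
      one ⊛ M                           ≈⟨ ⊛-congˡ M coprime ⟨
      (s ⊛ x ⊕ t ⊛ y) ⊛ M               ≈⟨ ⊛-distribʳ M (s ⊛ x) (t ⊛ y) ⟩
      s ⊛ x ⊛ M ⊕ t ⊛ y ⊛ M
        ≈⟨ ⊕-cong (⊛-congʳ (s ⊛ x) (≋-trans (≋-sym ev) (⊛-congʳ v eK)))
                  (⊛-congʳ (t ⊛ y) (≋-trans (≋-sym eu) (⊛-congʳ u eg))) ⟩
      s ⊛ x ⊛ (v ⊛ (α ⊛ D ⊕ β ⊛ b)) ⊕ t ⊛ y ⊛ (u ⊛ (p ⊛ D ⊕ r ⊛ a))
        ≈⟨ ⊕-cong (regroup s x v α β b) (regroup t y u p r a) ⟩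
      ((s ⊛ x ⊛ v ⊛ α) ⊛ D ⊕ (s ⊛ v ⊛ β) ⊛ (x ⊛ b)) ⊕ ((t ⊛ y ⊛ u ⊛ p) ⊛ D ⊕ (t ⊛ u ⊛ r) ⊛ (y ⊛ a))
        ≈⟨ ⊕-cong (⊕-cong (≋-refl {(s ⊛ x ⊛ v ⊛ α) ⊛ D}) (⊛-congʳ (s ⊛ v ⊛ β) xb))
             (⊕-cong (≋-refl {(t ⊛ y ⊛ u ⊛ p) ⊛ D}) (⊛-congʳ (t ⊛ u ⊛ r) ya)) ⟩
      ((s ⊛ x ⊛ v ⊛ α) ⊛ D ⊕ (s ⊛ v ⊛ β) ⊛ lcm) ⊕ ((t ⊛ y ⊛ u ⊛ p) ⊛ D ⊕ (t ⊛ u ⊛ r) ⊛ lcm)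
        ≈⟨ PS.solve 6 (λ A B C E D L → (A PS.:* D PS.:+ B PS.:* L) PS.:+ (C PS.:* D PS.:+ E PS.:* L)
             PS.:= (A PS.:+ C) PS.:* D PS.:+ (B PS.:+ E) PS.:* L) ≋-refl
             (s ⊛ x ⊛ v ⊛ α) (s ⊛ v ⊛ β) (t ⊛ y ⊛ u ⊛ p) (t ⊛ u ⊛ r) D lcm ⟩
      (s ⊛ x ⊛ v ⊛ α ⊕ t ⊛ y ⊛ u ⊛ p) ⊛ D ⊕ (s ⊛ v ⊛ β ⊕ t ⊛ u ⊛ r) ⊛ lcm ∎)
    where
    open SR ≋-setoid
    open LCM l
    regroup : ∀ s x v α β b → s ⊛ x ⊛ (v ⊛ (α ⊛ D ⊕ β ⊛ b)) ≋ (s ⊛ x ⊛ v ⊛ α) ⊛ D ⊕ (s ⊛ v ⊛ β) ⊛ (x ⊛ b)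
    regroup s x v α β b = PS.solve 7 (λ s x v α D β b → s PS.:* x PS.:* (v PS.:* (α PS.:* D PS.:+ β PS.:* b))
      PS.:= (s PS.:* x PS.:* v PS.:* α) PS.:* D PS.:+ (s PS.:* v PS.:* β) PS.:* (x PS.:* b)) ≋-refl s x v α D β b

-- Polynomials in Z over K[T]: Gauss' lemma and the weighted degree.

module Bivariate {c ℓ} (K : Field c ℓ) where
  open Field K using (inverse) renaming (domain to D)
  open CommutativeRing (Domain.cring D)
  open Domain D using (cring; _≟0; 1≉0)
  open Euclid K public
  module B  = Polynomial polyRing
  module BD = Degree polyDomain
  module BS = RingSolver B.polyRing
  module BDom = DomainProperties BD.polyDomain

  infix 4 _∣ᵇ_
  -- Divisibility of the content, phrased so that no content has to be computed.
  _∣ᵇ_ : Poly → B.Poly → Set (c ⊔ ℓ)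
  d ∣ᵇ A = ∀ i → d ∣ B.coeff A i

  ∣ᵇ-cong : ∀ {d A A′} → A B.≋ A′ → d ∣ᵇ A → d ∣ᵇ A′
  ∣ᵇ-cong e h i = ∣-respʳ-≈ (B.at e i) (h i)

  ∣ᵇ-· : ∀ d A → d ∣ᵇ d B.· A
  ∣ᵇ-· d A i = ∣-respʳ-≈ (≋-sym (B.coeff-· d A i)) (x∣xy d _)

  ∣ᵇ-mono : ∀ {d e A} → d ∣ e → e ∣ᵇ A → d ∣ᵇ A
  ∣ᵇ-mono h k i = ∣-trans h (k i)

  ∣ᵇ-quotient : ∀ {d} A → d ∣ᵇ A → ∃ λ A′ → A B.≋ d B.· A′
  ∣ᵇ-quotient [] h = [] , B.≋-refl
  ∣ᵇ-quotient {d} (a ∷ A) h with ∣ᵇ-quotient A (λ i → h (suc i)) | h 0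
  ... | A′ , e | q , f = q ∷ A′ , B.∷-cong (≋-trans (≋-sym f) (⊛-comm q d)) e

  ·-cancel : ∀ {d A A′} → ¬ (d ≋ []) → d B.· A B.≋ d B.· A′ → A B.≋ A′
  ·-cancel {d} {A} {A′} nd e .B.at i = ⊛-cancelˡ nd
    (≋-trans (≋-sym (B.coeff-· d A i)) (≋-trans (B.at e i) (B.coeff-· d A′ i)))

  HasDeg-·⁻ : ∀ {n d} A → BD.HasDeg n (d B.· A) → ¬ (d ≋ []) → BD.HasDeg n A
  HasDeg-·⁻ {n} {d} A (BD.hasDeg b l) nd = BD.hasDeg
    (λ i h → [ (λ z → ⊥-elim (nd z)) , (λ z → z) ]′
      (Domain.noZeroDivisors polyDomain d _ (≋-trans (≋-sym (B.coeff-· d A i)) (b i h))))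
    (λ z → l (≋-trans (B.coeff-· d A n) (≋-trans (⊛-congʳ d z) (⊛-zeroʳ d))))

  ∣ᵇ-∷ : ∀ {d a A} → d ∣ a → d ∣ᵇ A → d ∣ᵇ a ∷ A
  ∣ᵇ-∷ h k zero    = h
  ∣ᵇ-∷ h k (suc i) = k i

  -- Modulo d the left factor is Z times A, so the coefficients of A (b ∷ A′) are those of the
  -- product shifted by one.
  ⊛-stripˡ : ∀ {d} a A b A′ → d ∣ a → d ∣ᵇ (a ∷ A) B.⊛ (b ∷ A′) → d ∣ᵇ A B.⊛ (b ∷ A′)
  ⊛-stripˡ a A b A′ da h i = ∣-respʳ-≈
    (≋-trans (⊕-cong (B.coeff-⊕ (a B.· (b ∷ A′)) ([] ∷ A B.⊛ (b ∷ A′)) (suc i)) ≋-refl)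
      (PS.solve 2 (λ x y → (x PS.:+ y) PS.:- x PS.:= y) ≋-refl (B.coeff (a B.· (b ∷ A′)) (suc i)) (B.coeff (A B.⊛ (b ∷ A′)) i)))
    (∣-sub (h (suc i)) (∣-respʳ-≈ (≋-sym (B.coeff-· a (b ∷ A′) (suc i))) (∣-*ʳ (B.coeff A′ i) da)))

  ⊛-stripʳ : ∀ {d} a A b A′ → d ∣ b → d ∣ᵇ (a ∷ A) B.⊛ (b ∷ A′) → d ∣ᵇ (a ∷ A) B.⊛ A′
  ⊛-stripʳ a A b A′ db h = ∣ᵇ-cong (B.⊛-comm A′ (a ∷ A))
    (⊛-stripˡ b A′ a A db (∣ᵇ-cong (B.⊛-comm (a ∷ A) (b ∷ A′)) h))

  -- If π divides a constant term, that term can be stripped and the induction continues on the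
  -- shorter list. It does divide one of the two, because it divides their product, the constant
  -- term of A A′.
  gaussLemma : ∀ {π} → Prime π → ∀ A A′ → π ∣ᵇ A B.⊛ A′ → π ∣ᵇ A ⊎ π ∣ᵇ A′
  gaussLemma {π} P [] A′ h = inj₁ λ i → π ∣0
  gaussLemma {π} P (a ∷ A) [] h = inj₂ λ i → π ∣0
  gaussLemma {π} P (a ∷ A) (b ∷ A′) h =
    [ (λ da → [ (λ k → inj₁ (∣ᵇ-∷ da k)) , inj₂ ]′ (gaussLemma P A (b ∷ A′) (⊛-stripˡ a A b A′ da h)))
    , (λ nda → [ (λ da → ⊥-elim (nda da))
               , (λ db → [ inj₁ , (λ k → inj₂ (∣ᵇ-∷ db k)) ]′ (gaussLemma P (a ∷ A) A′ (⊛-stripʳ a A b A′ db h)))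
               ]′ (Prime.euclid P a b (∣-respʳ-≈ (⊕-identityʳ (a ⊛ b)) (h 0))))
    ]′ (toSum (divides? (Prime-nonzero P) a))

  -- The weighted degree, with T of weight 1 and Z of weight μ, is the T-degree
  -- after the substitution Z ↦ S T^μ, hence multiplicative.
  module Weight (μ : ℕ) where
    S : Poly
    S = 0# ∷ 1# ∷ []

    X⊛ : ∀ p → S ⊛ p ≋ 0# ∷ p
    X⊛ p = ≋-trans (shift-⊛ one p) (∷-cong refl (⊛-identityˡ p))

    -- The indeterminates trade places: T becomes the outer variable and the inner one is the new S,
    -- so that the T-degree of a twisted polynomial is its degree in the sense of `BD.Deg<`.
    embed : Poly → B.Poly
    embed = map const

    embed-cong : ∀ {p q} → p ≋ q → embed p B.≋ embed q
    embed-cong {p} {q} e .B.at i = ≋-trans (coeff-embed p i) (≋-trans (const-cong (at e i)) (≋-sym (coeff-embed q i)))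
      where
      const-cong : ∀ {a b} → a ≈ b → const a ≋ const b
      const-cong f = ∷-cong f ≋-refl
      coeff-embed : ∀ p i → B.coeff (embed p) i ≋ const (coeff p i)
      coeff-embed []      i       = ≋-sym 0∷[]
      coeff-embed (a ∷ p) zero    = ≋-refl
      coeff-embed (a ∷ p) (suc i) = coeff-embed p i

    embed-⊕ : ∀ p q → embed (p ⊕ q) B.≋ embed p B.⊕ embed q
    embed-⊕ []      q       = B.≋-refl
    embed-⊕ (a ∷ p) []      = B.≋-refl
    embed-⊕ (a ∷ p) (b ∷ q) = B.∷-cong ≋-refl (embed-⊕ p q)

    embed-· : ∀ a p → embed (a · p) B.≋ const a B.· embed p
    embed-· a []      = B.≋-refl
    embed-· a (b ∷ p) = B.∷-cong (≋-sym (const-⊛ a (const b))) (embed-· a p)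

    embed-⊛ : ∀ p q → embed (p ⊛ q) B.≋ embed p B.⊛ embed q
    embed-⊛ []      q = B.≋-refl
    embed-⊛ (a ∷ p) q = B.≋-trans (embed-⊕ (a · q) (0# ∷ p ⊛ q))
      (B.⊕-cong (embed-· a q) (B.∷-cong 0∷[] (embed-⊛ p q)))

    coeff-embed-0 : ∀ p n → coeff (B.coeff (embed p) n) 0 ≈ coeff p n
    coeff-embed-0 []      n       = refl
    coeff-embed-0 (a ∷ p) zero    = refl
    coeff-embed-0 (a ∷ p) (suc n) = coeff-embed-0 p n

    coeff-embed-suc : ∀ p n i → coeff (B.coeff (embed p) n) (suc i) ≈ 0#
    coeff-embed-suc []      n       i = refl
    coeff-embed-suc (a ∷ p) zero    i = refl
    coeff-embed-suc (a ∷ p) (suc n) i = coeff-embed-suc p n i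

    open B.Eval B.polyRing embed embed-cong embed-⊕ embed-⊛ B.≋-refl (BD.mono μ S)
      renaming (ev to twist; ev-cong to twist-cong; ev-⊕ to twist-⊕; ev-⊛ to twist-⊛) using () public

    coeff-mono-⊛-low : ∀ k q n → n < k → B.coeff (BD.mono k S B.⊛ q) n ≋ []
    coeff-mono-⊛-low (suc k) q zero    _       = B.at (B.shift-⊛ (BD.mono k S) q) 0
    coeff-mono-⊛-low (suc k) q (suc n) (s≤s l) =
      ≋-trans (B.at (B.shift-⊛ (BD.mono k S) q) (suc n)) (coeff-mono-⊛-low k q n l)

    coeff-mono-⊛ : ∀ k q n → B.coeff (BD.mono k S B.⊛ q) (k ℕ.+ n) ≋ 0# ∷ B.coeff q n
    coeff-mono-⊛ zero    q n = ≋-trans (B.at (B.const-⊛ S q) n) (≋-trans (B.coeff-· S q n) (X⊛ _))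
    coeff-mono-⊛ (suc k) q n = ≋-trans (B.at (B.shift-⊛ (BD.mono k S) q) (suc (k ℕ.+ n))) (coeff-mono-⊛ k q n)

    coeff-twist-∷ : ∀ a A n i → coeff (B.coeff (twist (a ∷ A)) n) i
      ≈ coeff (B.coeff (embed a) n) i + coeff (B.coeff (BD.mono μ S B.⊛ twist A) n) i
    coeff-twist-∷ a A n i = trans (at (B.coeff-⊕ (embed a) (BD.mono μ S B.⊛ twist A) n) i)
      (coeff-⊕ (B.coeff (embed a) n) _ i)

    coeff-mono-⊛-0 : ∀ k q n → coeff (B.coeff (BD.mono k S B.⊛ q) n) 0 ≈ 0#
    coeff-mono-⊛-0 k q n with n ℕ.<? k
    ... | yes l = at (coeff-mono-⊛-low k q n l) 0
    ... | no nl = ≡.subst (λ n → coeff (B.coeff (BD.mono k S B.⊛ q) n) 0 ≈ 0#) (ℕ.m+[n∸m]≡n (ℕ.≮⇒≥ nl))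
                    (at (coeff-mono-⊛ k q (n ℕ.∸ k)) 0)

    -- The exponent of S still records i, so distinct monomials of A do not meet and nothing
    -- cancels.
    coeff-twist : ∀ A i t → coeff (B.coeff (twist A) (i ℕ.* μ ℕ.+ t)) i ≈ coeff (B.coeff A i) t
    coeff-twist []      i       t = refl
    coeff-twist (a ∷ A) zero    t = trans (coeff-twist-∷ a A t 0)
      (trans (+-cong (coeff-embed-0 a t) (coeff-mono-⊛-0 μ (twist A) t)) (+-identityʳ _))
    coeff-twist (a ∷ A) (suc i) t = trans (coeff-twist-∷ a A ((μ ℕ.+ i ℕ.* μ) ℕ.+ t) (suc i))
      (trans (+-cong (coeff-embed-suc a _ i)
        (trans (reflexive (≡.cong (λ n → coeff (B.coeff (BD.mono μ S B.⊛ twist A) n) (suc i)) (ℕ.+-assoc μ (i ℕ.* μ) t)))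
          (trans (at (coeff-mono-⊛ μ (twist A) (i ℕ.* μ ℕ.+ t)) (suc i)) (coeff-twist A i t)))) (+-identityˡ _))

    coeff-twist-low : ∀ A i n → n < i ℕ.* μ → coeff (B.coeff (twist A) n) i ≈ 0#
    coeff-twist-low []      i       n l = refl
    coeff-twist-low (a ∷ A) (suc i) n l = trans (coeff-twist-∷ a A n (suc i))
      (trans (+-cong (coeff-embed-suc a n i) low) (+-identityˡ _))
      where
      low : coeff (B.coeff (BD.mono μ S B.⊛ twist A) n) (suc i) ≈ 0#
      low with n ℕ.<? μ
      ... | yes h = at (coeff-mono-⊛-low μ (twist A) n h) (suc i)
      ... | no nh = ≡.subst (λ n → coeff (B.coeff (BD.mono μ S B.⊛ twist A) n) (suc i) ≈ 0#) (ℕ.m+[n∸m]≡n (ℕ.≮⇒≥ nh))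
              (trans (at (coeff-mono-⊛ μ (twist A) (n ℕ.∸ μ)) (suc i)) (coeff-twist-low A i (n ℕ.∸ μ)
                (ℕ.+-cancelˡ-< μ (n ℕ.∸ μ) (i ℕ.* μ) (≡.subst (_< μ ℕ.+ i ℕ.* μ) (≡.sym (ℕ.m+[n∸m]≡n (ℕ.≮⇒≥ nh))) l))))

    W≤ : ℕ → B.Poly → Set ℓ
    W≤ w A = ∀ i t → w < i ℕ.* μ ℕ.+ t → coeff (B.coeff A i) t ≈ 0#

    W≤⇒twist : ∀ {w} A → W≤ w A → BD.Deg< (suc w) (twist A)
    W≤⇒twist A h n l .at i with n ℕ.<? i ℕ.* μ
    ... | yes k = coeff-twist-low A i n k
    ... | no nk = ≡.subst (λ n → coeff (B.coeff (twist A) n) i ≈ 0#) (ℕ.m+[n∸m]≡n (ℕ.≮⇒≥ nk))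
      (trans (coeff-twist A i (n ℕ.∸ i ℕ.* μ)) (h i _ (≡.subst (_ <_) (≡.sym (ℕ.m+[n∸m]≡n (ℕ.≮⇒≥ nk))) l)))

    twist⇒W≤ : ∀ {w} A → BD.Deg< (suc w) (twist A) → W≤ w A
    twist⇒W≤ A d i t l = trans (sym (coeff-twist A i t)) (at (d (i ℕ.* μ ℕ.+ t) l) i)

    W≤-cong : ∀ {w A A′} → A B.≋ A′ → W≤ w A → W≤ w A′
    W≤-cong e h i t l = trans (sym (at (B.at e i) t)) (h i t l)

    W≤-mono : ∀ {v w} A → v ≤ w → W≤ v A → W≤ w A
    W≤-mono A l h i t k = h i t (≤-<-trans l k)

    W≤-⊛ : ∀ {v w} A A′ → W≤ v A → W≤ w A′ → W≤ (v ℕ.+ w) (A B.⊛ A′)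
    W≤-⊛ A A′ h k = twist⇒W≤ (A B.⊛ A′) (BD.Deg<-cong (B.≋-sym (twist-⊛ A A′))
      (BD.Deg<-⊛ (twist A) (twist A′) (W≤⇒twist A h) (W≤⇒twist A′ k)))

    W≤-⊕ : ∀ {w} A A′ → W≤ w A → W≤ w A′ → W≤ w (A B.⊕ A′)
    W≤-⊕ A A′ h k i t l = trans (at (B.coeff-⊕ A A′ i) t)
      (trans (coeff-⊕ (B.coeff A i) _ t) (trans (+-cong (h i t l) (k i t l)) (+-identityˡ _)))

    -- `twist` is multiplicative, injective and lands in a domain, so the weights of the factors add
    -- up without cancellation.
    W≤-factor : ∀ {w} A A′ → ¬ (A′ B.≋ []) → W≤ w (A B.⊛ A′) → W≤ w A
    W≤-factor {w} A A′ nz h = twist⇒W≤ A bound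
      where
      nt : ¬ (twist A′ B.≋ [])
      nt e = nz (record { at = λ i → record { at = λ t → trans (sym (coeff-twist A′ i t)) (at (B.at e _) i) } })
      bound : BD.Deg< (suc w) (twist A)
      bound with BD.degree? (twist A)
      ... | inj₁ z = BD.Deg<-[] z
      ... | inj₂ (a , ha) with BD.nonzero-HasDeg nt
      ...   | b , hb = BD.Deg<-mono (twist A) (s≤s (≤-trans (ℕ.m≤m+n a b) (ℕ.≤-pred
                (BD.HasDeg-Deg< (BD.HasDeg-⊛ (twist A) (twist A′) ha hb)
                  (BD.Deg<-cong (twist-⊛ A A′) (W≤⇒twist (A B.⊛ A′) h)))))) (BD.bounded ha)

-- Removing prime factors from contents.

summand-< : ∀ {a k n} → suc a ℕ.+ k ≡ n → k < n
summand-< {a} ≡.refl = s≤s (ℕ.m≤n+m _ a)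

module Content {c ℓ} (K : Field c ℓ) (primeFactor : Euclid.PrimeFactors K) where
  open Field K using (inverse) renaming (domain to D)
  open CommutativeRing (Domain.cring D)
  open Bivariate K public

  cofactor-degree : ∀ {e n d x p} → p ≋ d ⊛ x → HasDeg e d → HasDeg n p → ∃ λ k → HasDeg k x × e ℕ.+ k ≡ n
  cofactor-degree {e} {n} {d} {x} {p} eq hd hp with degree? x
  ... | inj₁ z = ⊥-elim (HasDeg-nonzero {p = p} hp (≋-trans eq (≋-trans (⊛-congʳ d z) (⊛-zeroʳ d))))
  ... | inj₂ (k , hx) = k , hx , HasDeg-unique {p = p} (HasDeg-cong (≋-sym eq) (HasDeg-⊛ d x hd hx)) hp

  private
    peel : ∀ {π α β A A₁ A′ U} → ¬ (π ≋ []) → A B.≋ π B.· A₁ → α ≋ π ⊛ B.coeff A₁ 0 →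
      A B.⊛ A′ B.≋ (α ⊛ β) B.· U → A₁ B.⊛ A′ B.≋ (B.coeff A₁ 0 ⊛ β) B.· U
    peel {π} {α} {β} {A} {A₁} {A′} {U} nπ eA eα eq = ·-cancel nπ (begin
      π B.· (A₁ B.⊛ A′)                  ≈⟨ B.·-⊛ π A₁ A′ ⟨
      (π B.· A₁) B.⊛ A′                  ≈⟨ B.⊛-congˡ A′ eA ⟨
      A B.⊛ A′                           ≈⟨ eq ⟩
      (α ⊛ β) B.· U                      ≈⟨ B.·-cong (≋-trans (⊛-congˡ β eα) (⊛-assoc π (B.coeff A₁ 0) β)) B.≋-refl ⟩
      (π ⊛ (B.coeff A₁ 0 ⊛ β)) B.· U     ≈⟨ B.·-· π _ U ⟨
      π B.· ((B.coeff A₁ 0 ⊛ β) B.· U) ∎)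
      where open SR B.≋-setoid

    constantTerm : ∀ {π α A A₁} → A B.≋ π B.· A₁ → B.coeff A 0 ≋ α → α ≋ π ⊛ B.coeff A₁ 0
    constantTerm {π} {α} {A} {A₁} eA eα = ≋-trans (≋-sym eα) (≋-trans (B.at eA 0) (B.coeff-· π A₁ 0))

  -- α β divides the content of A A′, while the contents of A and A′ divide their constant terms α
  -- and β; by Gauss' lemma this forces equality. The induction cancels one prime π of α at a time,
  -- either from A and α or from A′ and β.
  gauss-divides : ∀ n {a b α β A A′ U} → a ℕ.+ b < n → HasDeg a α → HasDeg b β →
    A B.⊛ A′ B.≋ (α ⊛ β) B.· U → B.coeff A 0 ≋ α → B.coeff A′ 0 ≋ β → α ∣ᵇ A
  gauss-divides (suc n) {zero}  {b} {α} {A = A} l hα hβ eq eα eβ i = ∣one⇒∣ (B.coeff A i) (HasDeg-0⇒∣one hα)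
  gauss-divides (suc n) {suc a} {b} {α} {β} {A} {A′} {U} (s≤s l) hα hβ eq eα eβ with primeFactor hα
  ... | π , P , π∣α with gaussLemma P A A′ (∣ᵇ-cong (B.≋-sym eq) (∣ᵇ-mono {A = (α ⊛ β) B.· U} (∣-*ʳ β π∣α) (∣ᵇ-· (α ⊛ β) U)))
  ...   | inj₁ π∣A with ∣ᵇ-quotient A π∣A
  ...     | A₁ , eA with cofactor-degree {d = π} {B.coeff A₁ 0} (constantTerm {π} {α} {A} {A₁} eA eα) (Prime.hasDegree P) hα
  ...       | k , hk , ek = λ i → ∣-respʳ-≈ (≋-sym (≋-trans (B.at eA i) (B.coeff-· π A₁ i)))
                (∣-respˡ-≈ (≋-sym (constantTerm {π} {α} {A} {A₁} eA eα)) (∣-*-monoʳ {B.coeff A₁ 0} {B.coeff A₁ i} π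
                  (gauss-divides n {A = A₁} {A′} {U} (<-≤-trans (ℕ.+-monoˡ-< b (summand-< ek)) l)
                    hk hβ (peel {π} {α} {β} {A} {A₁} {A′} {U} (Prime-nonzero P) eA (constantTerm {π} {α} {A} {A₁} eA eα) eq) ≋-refl eβ i)))
  gauss-divides (suc n) {suc a} {b} {α} {β} {A} {A′} {U} (s≤s l) hα hβ eq eα eβ
      | π , P , π∣α | inj₂ π∣A′ with ∣ᵇ-quotient A′ π∣A′
  ...     | A₁ , eA with cofactor-degree {d = π} {B.coeff A₁ 0} (constantTerm {π} {β} {A′} {A₁} eA eβ) (Prime.hasDegree P) hβ
  ...       | k , hk , ek = gauss-divides n {A = A} {A₁} {U} (<-≤-trans (ℕ.+-monoʳ-< (suc a) (summand-< ek)) l)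
                hα hk
                (B.≋-trans (B.⊛-comm A A₁) (B.≋-trans (peel {π} {β} {α} {A′} {A₁} {A} {U} (Prime-nonzero P) eA (constantTerm {π} {β} {A′} {A₁} eA eβ)
                    (B.≋-trans (B.⊛-comm A′ A) (B.≋-trans eq (B.·-cong (⊛-comm α β) B.≋-refl))))
                  (B.·-cong (⊛-comm (B.coeff A₁ 0) α) B.≋-refl)))
                eα ≋-refl

  Primitive : B.Poly → Set (c ⊔ ℓ)
  Primitive A = ∀ π → Prime π → ¬ (π ∣ᵇ A)

  -- A prime factor of α that did not divide κ would divide every coefficient of A. So it can be
  -- cancelled from both α and κ.
  primitive-divides : ∀ {A} → Primitive A → ∀ n {a α κ} → a < n → HasDeg a α → (∀ i → α ∣ κ ⊛ B.coeff A i) → α ∣ κ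
  primitive-divides {A} pA (suc n) {zero}  {α} {κ} l hα h = ∣one⇒∣ κ (HasDeg-0⇒∣one hα)
  primitive-divides {A} pA (suc n) {suc a} {α} {κ} (s≤s l) hα h with primeFactor hα
  ... | π , P , π∣α@(α′ , eα) with divides? (Prime-nonzero P) κ
  ...   | no n∣ = ⊥-elim (pA π P λ i → [ (λ k → ⊥-elim (n∣ k)) , (λ k → k) ]′ (Prime.euclid P κ _ (∣-trans π∣α (h i))))
  ...   | yes (κ′ , eκ) with cofactor-degree {d = π} {α′} (≋-trans (≋-sym eα) (⊛-comm α′ π)) (Prime.hasDegree P) hα
  ...     | k , hk , ek = ∣-respˡ-≈ eα (∣-respʳ-≈ eκ (∣-*-mono
                (primitive-divides {A} pA n {κ = κ′} (<-≤-trans (summand-< ek) l) hk reduced) ∣-refl))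
    where
    open SR ≋-setoid
    reduced : ∀ i → α′ ∣ κ′ ⊛ B.coeff A i
    reduced i with h i
    ... | w , ew = w , ⊛-cancelˡ (Prime-nonzero P) (begin
      π ⊛ (w ⊛ α′)                ≈⟨ PS.solve 3 (λ π w α → π PS.:* (w PS.:* α) PS.:= w PS.:* (α PS.:* π)) ≋-refl π w α′ ⟩
      w ⊛ (α′ ⊛ π)                ≈⟨ ⊛-congʳ w eα ⟩
      w ⊛ α                       ≈⟨ ew ⟩
      κ ⊛ B.coeff A i             ≈⟨ ⊛-congˡ (B.coeff A i) (≋-sym eκ) ⟩
      κ′ ⊛ π ⊛ B.coeff A i        ≈⟨ PS.solve 3 (λ π w α → w PS.:* π PS.:* α PS.:= π PS.:* (w PS.:* α)) ≋-refl π κ′ _ ⟩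
      π ⊛ (κ′ ⊛ B.coeff A i) ∎)

  -- Each prime factor of κ divides v or w by Gauss' lemma and is removed from it, which leaves the
  -- degrees in Z unchanged. What remains of κ is a unit, absorbed by v.
  factorisation-descends : ∀ n {e κ f v w a b} → e < n → HasDeg e κ → κ B.· f B.≋ v B.⊛ w →
    BD.HasDeg a v → BD.HasDeg b w →
    ∃ λ v′ → ∃ λ w′ → f B.≋ v′ B.⊛ w′ × BD.HasDeg a v′ × BD.HasDeg b w′
  factorisation-descends (suc n) {zero} {κ} {f} {v} {w} l hκ eq hv hw with HasDeg-0⇒∣one hκ
  ... | i , ei = i B.· v , w , (begin
      f                    ≈⟨ B.1·≋ f ⟨
      one B.· f            ≈⟨ B.·-cong ei B.≋-refl ⟨
      (i ⊛ κ) B.· f        ≈⟨ B.·-· i κ f ⟨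
      i B.· (κ B.· f)      ≈⟨ B.·-cong (≋-refl {i}) eq ⟩
      i B.· (v B.⊛ w)      ≈⟨ B.·-⊛ i v w ⟨
      (i B.· v) B.⊛ w ∎) ,
      HasDeg-·⁻ (i B.· v) (BD.HasDeg-cong (B.≋-trans (B.≋-sym (B.1·≋ v)) (B.≋-trans (B.·-cong (≋-trans (≋-sym ei) (⊛-comm i κ)) B.≋-refl) (B.≋-sym (B.·-· κ i v)))) hv)
        (HasDeg-nonzero {p = κ} hκ) , hw
    where open SR B.≋-setoid
  factorisation-descends (suc n) {suc e} {κ} {f} {v} {w} (s≤s l) hκ eq hv hw with primeFactor hκ
  ... | π , P , (κ′ , eκ) with cofactor-degree {d = π} {κ′} (≋-trans (≋-sym eκ) (⊛-comm κ′ π)) (Prime.hasDegree P) hκ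
  ...   | k , hk , ek with gaussLemma P v w (∣ᵇ-cong eq (∣ᵇ-mono {A = κ B.· f} (κ′ , eκ) (∣ᵇ-· κ f)))
  ...     | inj₁ π∣v with ∣ᵇ-quotient v π∣v
  ...       | v₁ , ev = factorisation-descends n (<-≤-trans (summand-< ek) l) hk
                (·-cancel (Prime-nonzero P) (B.≋-trans (B.·-· π κ′ f) (B.≋-trans (B.·-cong (≋-trans (⊛-comm π κ′) eκ) B.≋-refl)
                  (B.≋-trans eq (B.≋-trans (B.⊛-congˡ w ev) (B.·-⊛ π v₁ w))))))
                (HasDeg-·⁻ v₁ (BD.HasDeg-cong ev hv) (Prime-nonzero P)) hw
  factorisation-descends (suc n) {suc e} {κ} {f} {v} {w} (s≤s l) hκ eq hv hw
      | π , P , (κ′ , eκ) | k , hk , ek | inj₂ π∣w with ∣ᵇ-quotient w π∣w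
  ...       | w₁ , ew = factorisation-descends n (<-≤-trans (summand-< ek) l) hk
                (·-cancel (Prime-nonzero P) (B.≋-trans (B.·-· π κ′ f) (B.≋-trans (B.·-cong (≋-trans (⊛-comm π κ′) eκ) B.≋-refl)
                  (B.≋-trans eq (B.≋-trans (B.⊛-congʳ v ew)
                    (B.≋-trans (B.⊛-comm v (π B.· w₁)) (B.≋-trans (B.·-⊛ π w₁ v) (B.·-cong (≋-refl {π}) (B.⊛-comm w₁ v)))))))))
                hv (HasDeg-·⁻ w₁ (BD.HasDeg-cong ew hw) (Prime-nonzero P))

-- Sums of reciprocals and the substitution Z ↦ ΛZ - x.

-- A list of pairs (ε , s) stands for the sum of fractions Σ ε / s.
module Reciprocals {c ℓ} (S : CommutativeRing c ℓ) where
  open CommutativeRing S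
  open RingSolver S
  open Divisibility S

  denominator : List (Carrier × Carrier) → Carrier
  denominator []            = 1#
  denominator ((ε , s) ∷ l) = s * denominator l

  numerator : List (Carrier × Carrier) → Carrier
  numerator []            = 0#
  numerator ((ε , s) ∷ l) = ε * denominator l + s * numerator l

  denominator-split : ∀ pre ε s post → denominator (pre ++ (ε , s) ∷ post) ≈ s * denominator (pre ++ post)
  denominator-split [] ε s post = refl
  denominator-split ((_ , x) ∷ pre) ε s post = trans (*-congˡ (denominator-split pre ε s post))
    (solve 3 (λ x s d → x :* (s :* d) := s :* (x :* d)) refl _ _ _)

  numerator-split : ∀ pre ε s post →
    numerator (pre ++ (ε , s) ∷ post) ≈ ε * denominator (pre ++ post) + s * numerator (pre ++ post)
  numerator-split [] ε s post = refl
  numerator-split ((ε′ , x) ∷ pre) ε s post = trans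
    (+-cong (*-congˡ (denominator-split pre ε s post)) (*-congˡ (numerator-split pre ε s post)))
    (solve 6 (λ ε′ s d x ε n → ε′ :* (s :* d) :+ x :* (ε :* d :+ s :* n)
      := ε :* (x :* d) :+ s :* (ε′ :* d :+ x :* n)) refl ε′ s (denominator (pre ++ post)) x ε (numerator (pre ++ post)))

  signedSum : List (Carrier × Carrier × Carrier) → Carrier
  signedSum []                = 0#
  signedSum ((ε , s , t) ∷ l) = ε * t + signedSum l

  forgetInverse : Carrier × Carrier × Carrier → Carrier × Carrier
  forgetInverse (ε , s , t) = ε , s

  numerator≡denominator*sum : ∀ {ψ} l → All (λ (ε , s , t) → ψ ∣ s * t - 1#) l →
    ψ ∣ numerator (map forgetInverse l) - denominator (map forgetInverse l) * signedSum l
  numerator≡denominator*sum {ψ} [] [] = ∣-respʳ-≈ (sym (solve 1 (λ o → con (0 , 0) :- o :* con (0 , 0) := con (0 , 0)) refl 1#)) (ψ ∣0)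
  numerator≡denominator*sum {ψ} ((ε , s , t) ∷ l) (h ∷ hs) = ∣-respʳ-≈
    (solve 6 (λ ε d s t n τ → s :* (n :- d :* τ) :- ε :* d :* (s :* t :- con (1 , 0))
        := (ε :* d :+ s :* n) :- (s :* d) :* (ε :* t :+ τ)) refl
      ε (denominator (map forgetInverse l)) s t (numerator (map forgetInverse l)) (signedSum l))
    (∣-sub (∣-*ˡ s (numerator≡denominator*sum l hs)) (∣-*ˡ (ε * denominator (map forgetInverse l)) h))

module ReciprocalIdentity {c ℓ} (K : Field c ℓ) (primeFactor : Euclid.PrimeFactors K) where
  open Field K using (inverse) renaming (domain to D)
  open CommutativeRing (Domain.cring D)
  open Content K primeFactor public

  module NB = Reciprocals B.polyRing
  module NR = Reciprocals polyRing
  open Exp PR.semiring public using (_^_)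

  linear : Poly × Poly → B.Poly × B.Poly
  linear (ε , x) = B.const ε , x ∷ one ∷ []

  numeratorZ : List (Poly × Poly) → B.Poly
  numeratorZ l = NB.numerator (map linear l)

  module EvalNumerator {c′ ℓ′} (S : CommutativeRing c′ ℓ′) (φ : Poly → CommutativeRing.Carrier S)
    (φ-cong : ∀ {a b} → a ≋ b → CommutativeRing._≈_ S (φ a) (φ b))
    (φ-+ : ∀ a b → CommutativeRing._≈_ S (φ (a ⊕ b)) (CommutativeRing._+_ S (φ a) (φ b)))
    (φ-* : ∀ a b → CommutativeRing._≈_ S (φ (a ⊛ b)) (CommutativeRing._*_ S (φ a) (φ b)))
    (φ-0 : CommutativeRing._≈_ S (φ []) (CommutativeRing.0# S))
    (φ-1 : CommutativeRing._≈_ S (φ one) (CommutativeRing.1# S))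
    (s : CommutativeRing.Carrier S) where
    private
      module S = CommutativeRing S
      module ES = RingSolver S
      module NS = Reciprocals S
    open B.Eval S φ φ-cong φ-+ φ-* φ-0 s public

    at-s : Poly × Poly → S.Carrier × S.Carrier
    at-s (ε , x) = φ ε , φ x S.+ s

    ev-const : ∀ a → ev (B.const a) S.≈ φ a
    ev-const a = S.trans (S.+-congˡ (S.zeroʳ s)) (S.+-identityʳ _)

    ev-linear : ∀ x → ev (x ∷ one ∷ []) S.≈ φ x S.+ s
    ev-linear x = S.+-congˡ (S.trans (S.*-congˡ (S.trans (S.+-congˡ (S.zeroʳ s)) (S.trans (S.+-identityʳ _) φ-1))) (S.*-identityʳ s))

    ev-denominator : ∀ l → ev (NB.denominator (map linear l)) S.≈ NS.denominator (map at-s l)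
    ev-denominator [] = S.trans (ev-const one) φ-1
    ev-denominator ((ε , x) ∷ l) = S.trans (ev-⊛ (x ∷ one ∷ []) (NB.denominator (map linear l))) (S.*-cong (ev-linear x) (ev-denominator l))

    ev-numerator : ∀ l → ev (numeratorZ l) S.≈ NS.numerator (map at-s l)
    ev-numerator [] = S.refl
    ev-numerator ((ε , x) ∷ l) = S.trans (ev-⊕ (B.const ε B.⊛ NB.denominator (map linear l)) ((x ∷ one ∷ []) B.⊛ numeratorZ l)) (S.+-cong
      (S.trans (ev-⊛ (B.const ε) (NB.denominator (map linear l))) (S.*-cong (ev-const ε) (ev-denominator l)))
      (S.trans (ev-⊛ (x ∷ one ∷ []) (numeratorZ l)) (S.*-cong (ev-linear x) (ev-numerator l))))

  module At (s : Poly) = EvalNumerator polyRing (λ a → a) (λ e → e) (λ _ _ → ≋-refl) (λ _ _ → ≋-refl) ≋-refl ≋-refl s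
    renaming (ev to _at_)
  module Subst (s : B.Poly) = EvalNumerator B.polyRing B.const (λ e → B.∷-cong e B.≋-refl) (λ _ _ → B.≋-refl)
    (λ a b → B.≋-sym (B.≋-trans (B.const-⊛ a (B.const b)) (B.∷-cong ≋-refl B.≋-refl))) B.0∷[] B.≋-refl s

  infix 8 _⟨_⟩ _[_]
  _⟨_⟩ : B.Poly → Poly → Poly
  A ⟨ s ⟩ = At._at_ s A

  _[_] : B.Poly → B.Poly → B.Poly
  A [ s ] = Subst.ev s A

  subst-subst : ∀ s t A → A [ s ] [ t ] B.≋ A [ s [ t ] ]
  subst-subst s t []      = B.≋-refl
  subst-subst s t (a ∷ A) = begin
    (B.const a B.⊕ s B.⊛ A [ s ]) [ t ]              ≈⟨ Subst.ev-⊕ t (B.const a) (s B.⊛ A [ s ]) ⟩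
    B.const a [ t ] B.⊕ (s B.⊛ A [ s ]) [ t ]        ≈⟨ B.⊕-cong (Subst.ev-const t a) (Subst.ev-⊛ t s (A [ s ])) ⟩
    B.const a B.⊕ s [ t ] B.⊛ A [ s ] [ t ]          ≈⟨ B.⊕-cong (B.≋-refl {B.const a}) (B.⊛-congʳ (s [ t ]) (subst-subst s t A)) ⟩
    B.const a B.⊕ s [ t ] B.⊛ A [ s [ t ] ] ∎
    where open SR B.≋-setoid

  subst-congʳ : ∀ {s t} A → s B.≋ t → A [ s ] B.≋ A [ t ]
  subst-congʳ []      e = B.≋-refl
  subst-congʳ (a ∷ A) e = B.⊕-cong (B.≋-refl {B.const a}) (B.⊛-cong e (subst-congʳ A e))

  X⊛ᵇ : ∀ A → ([] ∷ one ∷ []) B.⊛ A B.≋ [] ∷ A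
  X⊛ᵇ A = B.≋-trans (B.shift-⊛ (B.const one) A) (B.∷-cong ≋-refl (B.⊛-identityˡ A))

  const-⊕-∷ : ∀ a A → B.const a B.⊕ ([] ∷ A) B.≋ a ∷ A
  const-⊕-∷ a A = B.∷-cong (⊕-identityʳ a) B.≋-refl

  subst-id : ∀ A → A [ [] ∷ one ∷ [] ] B.≋ A
  subst-id []      = B.≋-refl
  subst-id (a ∷ A) = B.≋-trans (B.⊕-cong (B.≋-refl {B.const a}) (B.≋-trans (B.⊛-congʳ ([] ∷ one ∷ []) (subst-id A)) (X⊛ᵇ A))) (const-⊕-∷ a A)

  coeff-subst-scale : ∀ Λ A i → B.coeff (A [ [] ∷ Λ ∷ [] ]) i ≋ Λ ^ i ⊛ B.coeff A i
  coeff-subst-scale Λ []      i = ≋-sym (⊛-zeroʳ (Λ ^ i))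
  coeff-subst-scale Λ (a ∷ A) i = ≋-trans (B.at (B.⊕-cong (B.≋-refl {B.const a})
      (B.≋-trans (B.shift-⊛ (B.const Λ) A′) (B.∷-cong ≋-refl (B.const-⊛ Λ A′)))) i)
    (≋-trans (B.at (const-⊕-∷ a (Λ B.· A′)) i) (go i))
    where
    A′ = A [ [] ∷ Λ ∷ [] ]
    go : ∀ i → B.coeff (a ∷ Λ B.· A′) i ≋ Λ ^ i ⊛ B.coeff (a ∷ A) i
    go zero    = ≋-sym (⊛-identityˡ a)
    go (suc i) = ≋-trans (B.coeff-· Λ A′ i) (≋-trans (⊛-congʳ Λ (coeff-subst-scale Λ A i)) (≋-sym (⊛-assoc Λ (Λ ^ i) _)))

  subst-Deg< : ∀ {d s} A → BD.Deg< 2 s → BD.Deg< d A → BD.Deg< d (A [ s ])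
  subst-Deg< {d} {s} [] ds dA i l = ≋-refl
  subst-Deg< {zero} {s} (a ∷ A) ds dA = BD.Deg<-[] {p = (a ∷ A) [ s ]} (Subst.ev-≋[] s (BD.Deg<-zero {p = a ∷ A} dA))
  subst-Deg< {suc d} {s} (a ∷ A) ds dA = BD.Deg<-⊕ (B.const a) (s B.⊛ A [ s ]) (λ { zero () ; (suc i) _ → ≋-refl })
    (≡.subst (λ n → BD.Deg< n (s B.⊛ A [ s ])) (ℕ.+-comm d 1)
      (BD.Deg<-cong (B.⊛-comm (A [ s ]) s) (BD.Deg<-⊛ (A [ s ]) s (subst-Deg< A ds (BD.Deg<-tail {a = a} {A} dA)) ds)))

  coeff-⊛-0 : ∀ A A′ → B.coeff (A B.⊛ A′) 0 ≋ B.coeff A 0 ⊛ B.coeff A′ 0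
  coeff-⊛-0 []      A′ = ≋-refl
  coeff-⊛-0 (a ∷ A) A′ = ≋-trans (B.coeff-⊕ (a B.· A′) ([] ∷ A B.⊛ A′) 0) (≋-trans (⊕-identityʳ _) (B.coeff-· a A′ 0))

  coeff-subst-0 : ∀ x Λ A → B.coeff (A [ x ∷ Λ ∷ [] ]) 0 ≋ A ⟨ x ⟩
  coeff-subst-0 x Λ []      = ≋-refl
  coeff-subst-0 x Λ (a ∷ A) = ≋-trans (B.coeff-⊕ (B.const a) ((x ∷ Λ ∷ []) B.⊛ A [ x ∷ Λ ∷ [] ]) 0)
    (⊕-cong (≋-refl {a}) (≋-trans (coeff-⊛-0 (x ∷ Λ ∷ []) (A [ x ∷ Λ ∷ [] ])) (⊛-congʳ x (coeff-subst-0 x Λ A))))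

  subst-· : ∀ s a A → (a B.· A) [ s ] B.≋ a B.· A [ s ]
  subst-· s a A = B.≋-trans (Subst.ev-· s a A) (B.const-⊛ a (A [ s ]))

  ^-∣ : ∀ {Λ i d} → i ≤ d → Λ ^ i ∣ Λ ^ d
  ^-∣ {Λ} {zero}  {d}     z≤n     = 1∣ (Λ ^ d)
  ^-∣ {Λ} {suc i} {suc d} (s≤s l) = ∣-*-monoʳ Λ (^-∣ l)

  -- The i-th coefficient of f(ΛZ - x) is Λ^i times that of f(Z - x). Raising the factor to Λ^d for
  -- all i ≤ d makes α divide Λ^d f(Z - x), and the shift Z ↦ Z + x preserves divisibility of all
  -- coefficients.
  unscale : ∀ {α Λ x d} f → BD.Deg< (suc d) f → α ∣ᵇ f [ (⊖ x) ∷ Λ ∷ [] ] → α ∣ᵇ (Λ ^ d) B.· f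
  unscale {α} {Λ} {x} {d} f df h = back
    where
    f̃ = f [ (⊖ x) ∷ one ∷ [] ]
    compose : f [ (⊖ x) ∷ Λ ∷ [] ] B.≋ f̃ [ [] ∷ Λ ∷ [] ]
    compose = B.≋-sym (B.≋-trans (subst-subst ((⊖ x) ∷ one ∷ []) ([] ∷ Λ ∷ []) f) (subst-congʳ f
      (B.≋-trans (Subst.ev-linear ([] ∷ Λ ∷ []) (⊖ x)) (B.∷-cong (⊕-identityʳ _) B.≋-refl))))
    invert : f̃ [ x ∷ one ∷ [] ] B.≋ f
    invert = B.≋-trans (subst-subst ((⊖ x) ∷ one ∷ []) (x ∷ one ∷ []) f) (B.≋-trans (subst-congʳ f
      (B.≋-trans (Subst.ev-linear (x ∷ one ∷ []) (⊖ x)) (B.∷-cong (⊖-inverseˡ x) B.≋-refl))) (subst-id f))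
    h₁ : ∀ i → α ∣ Λ ^ i ⊛ B.coeff f̃ i
    h₁ i = ∣-respʳ-≈ (≋-trans (B.at compose i) (coeff-subst-scale Λ f̃ i)) (h i)
    h₂ : α ∣ᵇ (Λ ^ d) B.· f̃
    h₂ i with i ℕ.≤? d
    ... | yes l = ∣-respʳ-≈ (≋-sym (B.coeff-· (Λ ^ d) f̃ i)) (∣-trans (h₁ i) (∣-*-mono (^-∣ {Λ} l) ∣-refl))
    ... | no nl = ∣-respʳ-≈ (≋-sym (≋-trans (B.coeff-· (Λ ^ d) f̃ i) (≋-trans (⊛-congʳ (Λ ^ d)
            (subst-Deg< f (λ { zero () ; (suc zero) (s≤s ()) ; (suc (suc i)) _ → ≋-refl }) df i (ℕ.≰⇒> nl))) (⊛-zeroʳ (Λ ^ d))))) (α ∣0)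
    back : α ∣ᵇ (Λ ^ d) B.· f
    back with ∣ᵇ-quotient ((Λ ^ d) B.· f̃) h₂
    ... | Q , eQ = ∣ᵇ-cong (B.≋-trans (B.≋-sym (B.≋-trans (Subst.ev-cong (x ∷ one ∷ []) eQ) (subst-· (x ∷ one ∷ []) α Q)))
            (B.≋-trans (subst-· (x ∷ one ∷ []) (Λ ^ d) f̃) (B.·-cong (≋-refl {Λ ^ d}) invert)))
            (∣ᵇ-· α (Q [ x ∷ one ∷ [] ]))

  -- Under Z ↦ ΛZ - x the factor x′ + Z becomes y (1 + λZ) with y = x′ - x and λ = Λ / y. So Y is
  -- the product of the y, and u that of the 1 + λZ. The reciprocal of such a factor is integral up
  -- to 1 + λZ only after multiplication by Λ, which explains the Λ before the numerator.
  record Scaled (Λ : Poly) (l : List (Poly × Poly)) (x : Poly) : Set (c ⊔ ℓ) where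
    field
      Y : Poly
      u w : B.Poly
      Y≉0 : ¬ (Y ≋ [])
      u₀  : B.coeff u 0 ≋ one
      denominator≋ : NB.denominator (map (Subst.at-s ((⊖ x) ∷ Λ ∷ [])) l) B.≋ Y B.· u
      numerator≋   : Λ B.· NB.numerator (map (Subst.at-s ((⊖ x) ∷ Λ ∷ [])) l) B.≋ Y B.· w

  scaled : ∀ {Λ x} l → All (λ (ε , x′) → ¬ (x′ PR.- x ≋ []) × (x′ PR.- x) ∣ Λ) l → Scaled Λ l x
  scaled {Λ} {x} [] [] = record
    { Y = one ; u = B.const one ; w = [] ; Y≉0 = λ e → 1≉0′ (at e 0) ; u₀ = ≋-refl
    ; denominator≋ = B.≋-sym (B.1·≋ _) ; numerator≋ = B.≋-refl }
    where 1≉0′ = Domain.1≉0 D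
  scaled {Λ} {x} ((ε , x′) ∷ l) ((ny , (λ′ , eλ)) ∷ hs) = record
    { Y = y ⊛ Y ; u = v B.⊛ u ; w = λ′ B.· (B.const ε B.⊛ u) B.⊕ v B.⊛ w
    ; Y≉0 = ⊛-nonzero ny Y≉0
    ; u₀ = ≋-trans (coeff-⊛-0 v u) (≋-trans (⊛-identityˡ _) u₀)
    ; denominator≋ = begin
        s B.⊛ Dl                        ≈⟨ B.⊛-cong s≋ denominator≋ ⟩
        (y B.· v) B.⊛ (Y B.· u)         ≈⟨ merge v u ⟩
        (y ⊛ Y) B.· (v B.⊛ u) ∎
    ; numerator≋ = begin
        Λ B.· (B.const ε B.⊛ Dl B.⊕ s B.⊛ Nl)
          ≈⟨ B.·-distrib-⊕ Λ (B.const ε B.⊛ Dl) (s B.⊛ Nl) ⟩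
        Λ B.· (B.const ε B.⊛ Dl) B.⊕ Λ B.· (s B.⊛ Nl)
          ≈⟨ B.⊕-cong first second ⟩
        (y ⊛ Y) B.· (λ′ B.· (B.const ε B.⊛ u)) B.⊕ (y ⊛ Y) B.· (v B.⊛ w)
          ≈⟨ B.·-distrib-⊕ (y ⊛ Y) (λ′ B.· (B.const ε B.⊛ u)) (v B.⊛ w) ⟨
        (y ⊛ Y) B.· (λ′ B.· (B.const ε B.⊛ u) B.⊕ v B.⊛ w) ∎ }
    where
    open SR B.≋-setoid
    open Scaled (scaled {Λ} {x} l hs)
    y = x′ PR.- x
    v : B.Poly
    v = one ∷ λ′ ∷ []
    s : B.Poly
    s = y ∷ Λ ∷ []
    Dl = NB.denominator (map (Subst.at-s ((⊖ x) ∷ Λ ∷ [])) l)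
    Nl = NB.numerator (map (Subst.at-s ((⊖ x) ∷ Λ ∷ [])) l)
    s≋ : s B.≋ y B.· v
    s≋ = B.∷-cong (≋-sym (PR.*-identityʳ y)) (B.∷-cong (≋-trans (≋-sym eλ) (⊛-comm λ′ y)) B.≋-refl)
    merge : ∀ A A′ → (y B.· A) B.⊛ (Y B.· A′) B.≋ (y ⊛ Y) B.· (A B.⊛ A′)
    merge A A′ = begin
      (y B.· A) B.⊛ (Y B.· A′)    ≈⟨ B.·-⊛ y A (Y B.· A′) ⟩
      y B.· (A B.⊛ (Y B.· A′))    ≈⟨ B.·-cong (≋-refl {y}) (B.≋-trans (B.⊛-comm A (Y B.· A′)) (B.≋-trans (B.·-⊛ Y A′ A) (B.·-cong (≋-refl {Y}) (B.⊛-comm A′ A)))) ⟩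
      y B.· (Y B.· (A B.⊛ A′))    ≈⟨ B.·-· y Y _ ⟩
      (y ⊛ Y) B.· (A B.⊛ A′) ∎
    swap : ∀ a A A′ → a B.· (A B.⊛ A′) B.≋ A B.⊛ (a B.· A′)
    swap a A A′ = B.≋-trans (B.·-cong (≋-refl {a}) (B.⊛-comm A A′)) (B.≋-trans (B.≋-sym (B.·-⊛ a A′ A)) (B.⊛-comm (a B.· A′) A))
    first : Λ B.· (B.const ε B.⊛ Dl) B.≋ (y ⊛ Y) B.· (λ′ B.· (B.const ε B.⊛ u))
    first = begin
      Λ B.· (B.const ε B.⊛ Dl)              ≈⟨ B.·-cong (≋-refl {Λ}) (B.≋-trans (B.⊛-congʳ (B.const ε) denominator≋) (B.≋-sym (swap Y (B.const ε) u))) ⟩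
      Λ B.· (Y B.· (B.const ε B.⊛ u))       ≈⟨ B.·-· Λ Y _ ⟩
      (Λ ⊛ Y) B.· (B.const ε B.⊛ u)
        ≈⟨ B.·-cong (≋-trans (⊛-congˡ Y (≋-sym eλ)) (PS.solve 3 (λ l y Y → l PS.:* y PS.:* Y PS.:= y PS.:* Y PS.:* l) ≋-refl λ′ y Y)) B.≋-refl ⟩
      (y ⊛ Y ⊛ λ′) B.· (B.const ε B.⊛ u)    ≈⟨ B.·-· (y ⊛ Y) λ′ _ ⟨
      (y ⊛ Y) B.· (λ′ B.· (B.const ε B.⊛ u)) ∎
    second : Λ B.· (s B.⊛ Nl) B.≋ (y ⊛ Y) B.· (v B.⊛ w)
    second = begin
      Λ B.· (s B.⊛ Nl)           ≈⟨ swap Λ s Nl ⟩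
      s B.⊛ (Λ B.· Nl)           ≈⟨ B.⊛-cong s≋ numerator≋ ⟩
      (y B.· v) B.⊛ (Y B.· w)    ≈⟨ merge v w ⟩
      (y ⊛ Y) B.· (v B.⊛ w) ∎

  -- The substitution Z ↦ Λ Z − x turns every factor x′ + Z of the numerator into
  -- (x′ − x)(1 + λ Z), so the numerator becomes a constant times a polynomial with unit
  -- constant term, and Gauss' lemma splits that constant between f and its cofactor.
  value-divides-power : ∀ {f h κ d} pre ε x post {Λ} →
    Primitive f → BD.Deg< (suc d) f → ¬ (κ ≋ []) →
    h B.⊛ f B.≋ κ B.· numeratorZ (pre ++ (ε , x) ∷ post) → ε ⊛ ε ≋ one →
    All (λ (ε′ , x′) → ¬ (x′ PR.- x ≋ []) × (x′ PR.- x) ∣ Λ) (pre ++ post) →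
    ¬ (f ⟨ ⊖ x ⟩ ≋ []) → f ⟨ ⊖ x ⟩ ∣ Λ ^ d
  value-divides-power {f} {h} {κ} {d} pre ε x post {Λ} pf df nκ eq ε² hs nα =
    primitive-divides {f} pf _ ≤-refl hα (λ i → ∣-respʳ-≈ (B.coeff-· (Λ ^ d) f i) (unscale {x = x} f df α∣f̂ i))
    where
    open SR B.≋-setoid
    open Scaled (scaled {Λ} {x} (pre ++ post) hs)
    σ : B.Poly
    σ = (⊖ x) ∷ Λ ∷ []
    f̂ ĥ V : B.Poly
    f̂ = f [ σ ]
    ĥ = h [ σ ]
    V = B.const ε B.⊛ u B.⊕ ([] ∷ one ∷ []) B.⊛ w
    rest : List (B.Poly × B.Poly)
    rest = map (Subst.at-s σ) (pre ++ post)
    α β : Poly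
    α = f ⟨ ⊖ x ⟩
    β = B.coeff ĥ 0
    num : numeratorZ (pre ++ (ε , x) ∷ post) [ σ ] B.≋ Y B.· V
    num = begin
      numeratorZ (pre ++ (ε , x) ∷ post) [ σ ]
        ≈⟨ Subst.ev-numerator σ (pre ++ (ε , x) ∷ post) ⟩
      NB.numerator (map (Subst.at-s σ) (pre ++ (ε , x) ∷ post))
        ≡⟨ ≡.cong NB.numerator (List.map-++ (Subst.at-s σ) pre ((ε , x) ∷ post)) ⟩
      NB.numerator (map (Subst.at-s σ) pre ++ Subst.at-s σ (ε , x) ∷ map (Subst.at-s σ) post)
        ≈⟨ NB.numerator-split (map (Subst.at-s σ) pre) (B.const ε) (B.const x B.⊕ σ) (map (Subst.at-s σ) post) ⟩
      B.const ε B.⊛ NB.denominator (map (Subst.at-s σ) pre ++ map (Subst.at-s σ) post)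
        B.⊕ (B.const x B.⊕ σ) B.⊛ NB.numerator (map (Subst.at-s σ) pre ++ map (Subst.at-s σ) post)
        ≡⟨ ≡.cong (λ l → B.const ε B.⊛ NB.denominator l B.⊕ (B.const x B.⊕ σ) B.⊛ NB.numerator l) (List.map-++ (Subst.at-s σ) pre post) ⟨
      B.const ε B.⊛ NB.denominator rest B.⊕ (B.const x B.⊕ σ) B.⊛ NB.numerator rest
        ≈⟨ B.⊕-cong (B.≋-trans (B.⊛-congʳ (B.const ε) denominator≋) (pull Y (B.const ε) u))
             (B.≋-trans (B.⊛-congˡ (NB.numerator rest) ΛX) (B.≋-trans (B.·-⊛ Λ X (NB.numerator rest))
               (B.≋-trans (B.≋-sym (pull Λ X (NB.numerator rest))) (B.≋-trans (B.⊛-congʳ X numerator≋) (pull Y X w))))) ⟩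
      Y B.· (B.const ε B.⊛ u) B.⊕ Y B.· (X B.⊛ w)
        ≈⟨ B.·-distrib-⊕ Y (B.const ε B.⊛ u) (X B.⊛ w) ⟨
      Y B.· V ∎
      where
      X : B.Poly
      X = [] ∷ one ∷ []
      pull : ∀ a A A′ → A B.⊛ (a B.· A′) B.≋ a B.· (A B.⊛ A′)
      pull a A A′ = B.≋-trans (B.⊛-comm A (a B.· A′)) (B.≋-trans (B.·-⊛ a A′ A) (B.·-cong (≋-refl {a}) (B.⊛-comm A′ A)))
      -- The distinguished factor becomes x + (ΛZ - x) = ΛZ, and its Λ is the one that `numerator≋`
      -- asks for.
      ΛX : B.const x B.⊕ σ B.≋ Λ B.· X
      ΛX = B.∷-cong (≋-trans (⊖-inverseʳ x) (≋-sym (⊛-zeroʳ Λ))) (B.∷-cong (≋-sym (PR.*-identityʳ Λ)) B.≋-refl)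
    prod : f̂ B.⊛ ĥ B.≋ (κ ⊛ Y) B.· V
    prod = begin
      f̂ B.⊛ ĥ                        ≈⟨ B.⊛-comm f̂ ĥ ⟩
      ĥ B.⊛ f̂                        ≈⟨ Subst.ev-⊛ σ h f ⟨
      (h B.⊛ f) [ σ ]                ≈⟨ Subst.ev-cong σ eq ⟩
      (κ B.· numeratorZ (pre ++ (ε , x) ∷ post)) [ σ ]  ≈⟨ subst-· σ κ (numeratorZ (pre ++ (ε , x) ∷ post)) ⟩
      κ B.· numeratorZ (pre ++ (ε , x) ∷ post) [ σ ]    ≈⟨ B.·-cong (≋-refl {κ}) num ⟩
      κ B.· (Y B.· V)                ≈⟨ B.·-· κ Y V ⟩
      (κ ⊛ Y) B.· V ∎
    V₀ : B.coeff V 0 ≋ ε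
    V₀ = ≋-trans (B.coeff-⊕ (B.const ε B.⊛ u) _ 0) (≋-trans (⊕-cong (≋-trans (coeff-⊛-0 (B.const ε) u) (≋-trans (⊛-congʳ ε u₀) (PR.*-identityʳ ε)))
           (coeff-⊛-0 ([] ∷ one ∷ []) w)) (⊕-identityʳ ε))
    αβ : α ⊛ β ≋ κ ⊛ Y ⊛ ε
    αβ = ≋-trans (⊛-congˡ β (≋-sym (coeff-subst-0 (⊖ x) Λ f))) (≋-trans (≋-sym (coeff-⊛-0 f̂ ĥ))
           (≋-trans (B.at prod 0) (≋-trans (B.coeff-· (κ ⊛ Y) V 0) (⊛-congʳ (κ ⊛ Y) V₀))))
    -- Since ε is its own inverse, κ Y is α β up to a unit, as `gauss-divides` requires.
    κY : κ ⊛ Y ≋ (α ⊛ β) ⊛ ε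
    κY = ≋-sym (≋-trans (⊛-congˡ ε αβ) (≋-trans (⊛-assoc (κ ⊛ Y) ε ε) (≋-trans (⊛-congʳ (κ ⊛ Y) ε²) (PR.*-identityʳ (κ ⊛ Y)))))
    nβ : ¬ (β ≋ [])
    nβ z = ⊛-nonzero nκ Y≉0 (≋-trans κY (≋-trans (⊛-congˡ ε (≋-trans (⊛-congʳ α z) (⊛-zeroʳ α))) ≋-refl))
    hα = proj₂ (nonzero-HasDeg nα)
    hβ = proj₂ (nonzero-HasDeg nβ)
    α∣f̂ : α ∣ᵇ f̂
    α∣f̂ = gauss-divides _ {A = f̂} {ĥ} {ε B.· V} ≤-refl hα hβ
      (B.≋-trans prod (B.≋-trans (B.·-cong κY (B.≋-refl {V})) (B.≋-sym (B.·-· (α ⊛ β) ε V))))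
      (coeff-subst-0 (⊖ x) Λ f) ≋-refl

-- Counting list entries up to an equivalence.

AllPairs-lookup : ∀ {a r} {A : Set a} {R : A → A → Set r} {xs} → AllPairs R xs →
  ∀ {i j} → i Fin.< j → R (lookup xs i) (lookup xs j)
AllPairs-lookup (px ∷ pxs) {Fin.zero}  {Fin.suc j} _       = All.lookup px (∈.∈-lookup j)
AllPairs-lookup (px ∷ pxs) {Fin.suc i} {Fin.suc j} (s≤s l) = AllPairs-lookup pxs l

-- By pigeonhole, a longer `xs` would send two entries to the same position of `ys`. Apartness
-- replaces distinctness because polynomials are counted up to `_≋_`.
length≤cover : ∀ {a b r} {A : Set a} {B : Set b} (R : A → B → Set r) (xs : List A) (ys : List B) →
  All (λ x → Any (R x) ys) xs → AllPairs (λ x x′ → ∀ y → R x y → R x′ y → ⊥) xs → length xs ≤ length ys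
length≤cover R xs ys cover apart with length xs ℕ.≤? length ys
... | yes l = l
... | no nl with Fin.pigeonhole (ℕ.≰⇒> nl) (λ i → Any.index (All.lookup cover (∈.∈-lookup i)))
...   | i , j , i<j , same = ⊥-elim (AllPairs-lookup apart i<j (lookup ys (Any.index (hit i))) (Any.lookup-index (hit i))
          (≡.subst (λ k → R (lookup xs j) (lookup ys k)) (≡.sym same) (Any.lookup-index (hit j))))
  where
  hit : ∀ i → Any (R (lookup xs i)) ys
  hit i = All.lookup cover (∈.∈-lookup i)

length≤codes : ∀ {a} {A : Set a} {n} (code : A → Fin n) xs → AllPairs (λ x x′ → code x ≢ code x′) xs → length xs ≤ n
length≤codes {n = n} code xs apart = ≡.subst (length xs ≤_) (List.length-tabulate {n = n} (λ i → i))
  (length≤cover (λ x c → code x ≡ c) xs (allFin n) (All.tabulate (λ {x} _ → ∈.∈-allFin (code x)))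
    (AllPairs.map (λ ne _ e e′ → ne (≡.trans e (≡.sym e′))) apart))

concatMap-AllPairs : ∀ {a b r s} {A : Set a} {B : Set b} {R : A → A → Set r} {S : B → B → Set s} (f : A → List B) {xs} →
  AllPairs R xs → (∀ x → AllPairs S (f x)) → (∀ {x y u v} → R x y → u ∈ f x → v ∈ f y → S u v) → AllPairs S (concatMap f xs)
concatMap-AllPairs f ap inner outer = AllPairs.concat⁺ (All.map⁺ (All.tabulate (λ {x} _ → inner x)))
  (AllPairs.map⁺ (AllPairs.map (λ r → All.tabulate (λ u∈ → All.tabulate (λ v∈ → outer r u∈ v∈))) ap))

allVecs-AllPairs : ∀ {a e} {A : Set a} {E : A → A → Set e} {xs : List A} → AllPairs (λ x y → ¬ E x y) xs →
  ∀ n → AllPairs (λ v w → ¬ Pointwise E v w) (allVecs xs n)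
allVecs-AllPairs ap zero = [] ∷ []
allVecs-AllPairs {E = E} {xs} ap (suc n) = concatMap-AllPairs _ ap
  (λ x → AllPairs.map⁺ (AllPairs.map (λ { ne (_ ∷ es) → ne es }) (allVecs-AllPairs ap n)))
  (λ ne u∈ v∈ → differ ne (∈.∈-map⁻ _ u∈) (∈.∈-map⁻ _ v∈))
  where
  differ : ∀ {x y u v} → ¬ E x y → (∃ λ u′ → u′ ∈ allVecs xs n × u ≡ x ∷ u′) → (∃ λ v′ → v′ ∈ allVecs xs n × v ≡ y ∷ v′) →
    ¬ Pointwise E u v
  differ ne (_ , _ , ≡.refl) (_ , _ , ≡.refl) (e ∷ _) = ne e

∈-allVecs : ∀ {a} {A : Set a} {xs : List A} → (∀ x → x ∈ xs) → ∀ {n} (v : Vec A n) → v ∈ allVecs xs n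
∈-allVecs full []      = here ≡.refl
∈-allVecs full (x ∷ v) = ∈.∈-concatMap⁺ _ (Any.map (λ { ≡.refl → ∈.∈-map⁺ (x ∷_) (∈-allVecs full v) }) (full x))

All-allVecs : ∀ {a p} {A : Set a} {P : A → Set p} {xs : List A} → All P xs → ∀ n {v} → v ∈ allVecs xs n → All P (Vec.toList v)
All-allVecs px zero (here ≡.refl) = []
All-allVecs {A = A} {P} {xs} px (suc n) v∈ = go px (∈.∈-concatMap⁻ (λ x → map (x ∷_) (allVecs xs n)) {xs = xs} v∈)
  where
  go : ∀ {ys v} → All P ys → Any (λ x → v ∈ map (x ∷_) (allVecs xs n)) ys → All P (Vec.toList v)
  go (p ∷ _) (here {x} h) with ∈.∈-map⁻ (x ∷_) h
  ... | w , w∈ , ≡.refl = p ∷ All-allVecs px n w∈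
  go (_ ∷ ps) (there h) = go ps h

All-middle : ∀ {a p} {A : Set a} {P : A → Set p} pre {x post} → All P (pre ++ x ∷ post) → P x
All-middle []        (p ∷ _)  = p
All-middle (_ ∷ pre) (_ ∷ ps) = All-middle pre ps

-- Enumeration and factorisation over a finite field.

module FinitePolynomials {q c ℓ} (F : FiniteField q c ℓ) where
  open FiniteField F using (enum; enum-inj; enum-surj)

  private
    module F = FiniteField F
  open F using (_≈_; 0#; 1#; Carrier; refl; sym; trans)

  domain : Domain c ℓ
  domain = record
    { cring = F.commRing
    ; _≟0 = λ x → x F.≟ 0#
    ; noZeroDivisors = nzd
    ; 1≉0 = λ e → F.0≉1 (sym e) }
    where
    nzd : ∀ x y → x F.* y ≈ 0# → x ≈ 0# ⊎ y ≈ 0#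
    nzd x y e with x F.≟ 0#
    ... | yes z = inj₁ z
    ... | no nz with F.inverse x nz
    ...   | i , xi = inj₂ (trans (sym (F.*-identityˡ y)) (trans (F.*-congʳ (trans (sym xi) (F.*-comm x i)))
              (trans (F.*-assoc i x y) (trans (F.*-congˡ e) (F.zeroʳ i)))))

  baseField : Field c ℓ
  baseField = record { domain = domain ; inverse = F.inverse }

  open Euclid baseField

  index : Carrier → Fin q
  index x = proj₁ (enum-surj x)

  index-injective : ∀ {x y} → index x ≡ index y → x ≈ y
  index-injective {x} {y} e = trans (sym (proj₂ (enum-surj x)))
    (trans (≡.subst (λ i → enum (index x) ≈ enum i) e refl) (proj₂ (enum-surj y)))

  2≤q : 2 ≤ q
  2≤q = size q enum enum-surj
    where
    size : ∀ n (e : Fin n → Carrier) → (∀ x → ∃ λ i → e i ≈ x) → 2 ≤ n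
    size zero e s with s 0#
    ... | () , _
    size (suc zero) e s with s 0# | s 1#
    ... | Fin.zero , e0 | Fin.zero , e1 = ⊥-elim (F.0≉1 (trans (sym e0) e1))
    size (suc (suc n)) e s = s≤s (s≤s z≤n)

  fromIndices : ∀ {n} → Vec (Fin q) n → Poly
  fromIndices = Vec.toList ∘ Vec.map enum

  polynomials : ℕ → List Poly
  polynomials n = map fromIndices (allVecs (allFin q) n)

  fromIndices-Deg< : ∀ {n} (v : Vec (Fin q) n) → Deg< n (fromIndices v)
  fromIndices-Deg< []      i l       = refl
  fromIndices-Deg< (x ∷ v) (suc i) (s≤s l) = fromIndices-Deg< v i l

  fromIndices-injective : ∀ {n} (v w : Vec (Fin q) n) → fromIndices v ≋ fromIndices w → Pointwise _≡_ v w
  fromIndices-injective []      []      e = []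
  fromIndices-injective (x ∷ v) (y ∷ w) e = enum-inj x y (at e 0) ∷ fromIndices-injective v w (≋-tail e)

  indices : ∀ n → Poly → Vec (Fin q) n
  indices n p = Vec.tabulate (λ i → index (coeff p (toℕ i)))

  fromIndices-indices : ∀ n p → Deg< n p → fromIndices (indices n p) ≋ p
  fromIndices-indices zero    p       d = ≋-sym (Deg<-zero {p} d)
  fromIndices-indices (suc n) []      d = ∷-≋[] (proj₂ (enum-surj 0#)) (fromIndices-indices n [] (λ _ _ → refl))
  fromIndices-indices (suc n) (a ∷ p) d = ∷-cong (proj₂ (enum-surj a)) (fromIndices-indices n p (Deg<-tail {a = a} {p} d))

  polynomials-complete : ∀ {n} p → Deg< n p → Any (_≋ p) (polynomials n)
  polynomials-complete {n} p d = Any.map⁺ (Any.map (λ { ≡.refl → fromIndices-indices n p d })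
    (∈-allVecs ∈.∈-allFin (indices n p)))

  polynomials-distinct : ∀ n → AllPairs (λ p p′ → ¬ p ≋ p′) (polynomials n)
  polynomials-distinct n = AllPairs.map⁺ (AllPairs.map (λ {v} {w} ne e → ne (fromIndices-injective v w e))
    (allVecs-AllPairs (AllPairs.tabulate⁺ (λ ne → ne)) n))

  polynomials-Deg< : ∀ n → All (Deg< n) (polynomials n)
  polynomials-Deg< n = All.map⁺ (All.tabulate (λ {v} _ → fromIndices-Deg< v))

  -- Packs a block of coefficients into one number, so that polynomials determined by that block can
  -- be counted by `length≤codes`.
  window : ℕ → ∀ k → Poly → Fin (q ℕ.^ k)
  window o k p = funToFin (λ (i : Fin k) → index (coeff p (o ℕ.+ toℕ i)))

  window-injective : ∀ {o k p p′} → window o k p ≡ window o k p′ → ∀ i → o ≤ i → i < o ℕ.+ k → coeff p i ≈ coeff p′ i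
  window-injective {o} {k} {p} {p′} e i l h = ≡.subst (λ i → coeff p i ≈ coeff p′ i)
    (≡.trans (≡.cong (o ℕ.+_) (Fin.toℕ-fromℕ< j<k)) (ℕ.m+[n∸m]≡n l))
    (index-injective (≡.trans (≡.sym (Fin.finToFun-funToFin (λ (i : Fin k) → index (coeff p (o ℕ.+ toℕ i))) j))
      (≡.trans (≡.cong (λ z → finToFun z j) e) (Fin.finToFun-funToFin (λ (i : Fin k) → index (coeff p′ (o ℕ.+ toℕ i))) j))))
    where
    j<k : i ℕ.∸ o < k
    j<k = ℕ.+-cancelˡ-< o _ _ (≡.subst (_< o ℕ.+ k) (≡.sym (ℕ.m+[n∸m]≡n l)) h)
    j = fromℕ< j<k

  -- A proper factor has degree below n and thus occurs, up to `_≋_`, in the finite list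
  -- `polynomials n`; this makes factorisation a search.
  properFactor? : ∀ {n p} → HasDeg n p → Dec (∃ λ d → ∃ λ g → HasDeg (suc d) g × suc d < n × g ∣ p)
  properFactor? {n} {p} hp = map′ sound complete (Any.any? test (polynomials n))
    where
    Good : Poly → Set _
    Good g = ∃ λ d → HasDeg (suc d) g × suc d < n × g ∣ p
    test : ∀ g → Dec (Good g)
    test g with degree? g
    ... | inj₁ z = no λ { (d , hd , _) → HasDeg-nonzero {p = g} hd z }
    ... | inj₂ (zero , h) = no λ { (d , hd , _) → ℕ.0≢1+n (HasDeg-unique {p = g} h hd) }
    ... | inj₂ (suc d , h) with suc d ℕ.<? n | divides? (HasDeg-nonzero {p = g} h) p
    ...   | yes l | yes k = yes (d , h , l , k)
    ...   | no nl | _ = no λ { (d′ , hd , l , _) → nl (≡.subst (_< n) (HasDeg-unique {p = g} hd h) l) }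
    ...   | yes _ | no nk = no λ { (_ , _ , _ , k) → nk k }
    sound : Any Good (polynomials n) → ∃ λ d → ∃ λ g → HasDeg (suc d) g × suc d < n × g ∣ p
    sound a with Any.satisfied a
    ... | g , d , r = d , g , r
    complete : (∃ λ d → ∃ λ g → HasDeg (suc d) g × suc d < n × g ∣ p) → Any Good (polynomials n)
    complete (d , g , hg , l , k) = Any.map
      (λ e → d , HasDeg-cong {p = g} (≋-sym e) hg , l , ∣-respˡ-≈ (≋-sym e) k)
      (polynomials-complete g (Deg<-mono g l (bounded hg)))

  primeFactor : PrimeFactors
  primeFactor {e} {p} hp = go (suc e) hp ≤-refl
    where
    go : ∀ n {e p} → HasDeg (suc e) p → e < n → ∃ λ π → Prime π × π ∣ p
    go (suc n) {e} {p} hp (s≤s l) with properFactor? hp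
    ... | yes (d , g , hg , s≤s k , g∣p) with go n hg (<-≤-trans k l)
    ...   | π , P , π∣g = π , P , ∣-trans π∣g g∣p
    go (suc n) {e} {p} hp (s≤s l) | no none = p , irreducible⇒prime hp irr , ∣-refl
      where
      irr : ∀ {d} g → g ∣ p → HasDeg d g → d ≡ 0 ⊎ d ≡ suc e
      irr {zero}  g h hg = inj₁ ≡.refl
      irr {suc d} g h hg with ℕ.m≤n⇒m<n∨m≡n (∣-HasDeg {d = g} {p} hg hp h)
      ... | inj₁ k = ⊥-elim (none (d , g , hg , k , h))
      ... | inj₂ e = inj₂ e

  open ReciprocalIdentity baseField primeFactor public

-- Siegel's lemma by pigeonhole.

open import Data.Nat using (_+_; _*_; _∸_)

∑ : ℕ → (ℕ → ℕ) → ℕ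
∑ zero    ℓ = 0
∑ (suc n) ℓ = ℓ 0 + ∑ n (ℓ ∘ suc)

∑-last : ∀ n ℓ → ∑ (suc n) ℓ ≡ ∑ n ℓ + ℓ n
∑-last zero    ℓ = ℕ.+-comm (ℓ 0) 0
∑-last (suc n) ℓ = ≡.trans (≡.cong (ℓ 0 ℕ.+_) (∑-last n (ℓ ∘ suc))) (≡.sym (ℕ.+-assoc (ℓ 0) _ _))

∑-cong : ∀ n {ℓ ℓ′} → (∀ i → i < n → ℓ i ≡ ℓ′ i) → ∑ n ℓ ≡ ∑ n ℓ′
∑-cong zero    e = ≡.refl
∑-cong (suc n) e = ≡.cong₂ ℕ._+_ (e 0 (s≤s z≤n)) (∑-cong n (λ i l → e (suc i) (s≤s l)))

∑-shift : ∀ n c ℓ → ∑ n (λ i → c + ℓ i) ≡ n * c + ∑ n ℓ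
∑-shift zero    c ℓ = ≡.refl
∑-shift (suc n) c ℓ = ≡.trans (≡.cong (c + ℓ 0 ℕ.+_) (∑-shift n c (ℓ ∘ suc)))
  (solve 4 (λ c l nc s → (c :+ l) :+ (nc :+ s) := (c :+ nc) :+ (l :+ s)) ≡.refl c (ℓ 0) (n * c) (∑ n (ℓ ∘ suc)))
  where open NatSolver.+-*-Solver

module SiegelLemma {q c ℓ} (F : FiniteField q c ℓ) where
  open FinitePolynomials F
  open FiniteField F using (_≈_; 0#; Carrier; refl; sym; trans; enum; enum-inj; enum-surj)
  private module FR = DomainProperties domain

  -- The block i of a filling of length ∑ n ℓ holds the first ℓ i coefficients of the
  -- coefficient of Z^i.
  decode : ∀ n (ℓ : ℕ → ℕ) → (Fin (∑ n ℓ) → Fin q) → B.Poly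
  decode zero    ℓ φ = []
  decode (suc n) ℓ φ = List.tabulate (λ t → enum (φ (t ↑ˡ ∑ n (ℓ ∘ suc)))) ∷ decode n (ℓ ∘ suc) (λ j → φ (ℓ 0 ↑ʳ j))

  encode : ∀ n (ℓ : ℕ → ℕ) → (ℕ → Poly) → Fin (∑ n ℓ) → Fin q
  encode (suc n) ℓ f j = [ (λ t → index (coeff (f 0) (toℕ t))) , encode n (ℓ ∘ suc) (f ∘ suc) ]′ (splitAt (ℓ 0) j)

  encode-injective : ∀ n ℓ {f g} → (∀ j → encode n ℓ f j ≡ encode n ℓ g j) →
    ∀ i t → i < n → t < ℓ i → coeff (f i) t ≈ coeff (g i) t
  encode-injective (suc n) ℓ {f} {g} e zero t l h = ≡.subst (λ t → coeff (f 0) t ≈ coeff (g 0) t) (Fin.toℕ-fromℕ< h)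
    (index-injective (≡.trans (≡.sym (part f)) (≡.trans (e (fromℕ< h ↑ˡ _)) (part g))))
    where
    part : ∀ f → encode (suc n) ℓ f (fromℕ< h ↑ˡ _) ≡ index (coeff (f 0) (toℕ (fromℕ< h)))
    part f = ≡.cong [ _ , encode n (ℓ ∘ suc) (f ∘ suc) ]′ (Fin.splitAt-↑ˡ (ℓ 0) (fromℕ< h) (∑ n (ℓ ∘ suc)))
  encode-injective (suc n) ℓ {f} {g} e (suc i) t (s≤s l) h = encode-injective n (ℓ ∘ suc)
    (λ j → ≡.trans (≡.sym (part f j)) (≡.trans (e (ℓ 0 ↑ʳ j)) (part g j))) i t l h
    where
    part : ∀ f j → encode (suc n) ℓ f (ℓ 0 ↑ʳ j) ≡ encode n (ℓ ∘ suc) (f ∘ suc) j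
    part f j = ≡.cong [ _ , encode n (ℓ ∘ suc) (f ∘ suc) ]′ (Fin.splitAt-↑ʳ (ℓ 0) (∑ n (ℓ ∘ suc)) j)

  coeff-tabulate : ∀ {n} (f : Fin n → Carrier) j → coeff (List.tabulate f) (toℕ j) ≡ f j
  coeff-tabulate f Fin.zero    = ≡.refl
  coeff-tabulate f (Fin.suc j) = coeff-tabulate (f ∘ Fin.suc) j

  tabulate-Deg< : ∀ {n} (f : Fin n → Carrier) → Deg< n (List.tabulate f)
  tabulate-Deg< {zero}  f i       l       = refl
  tabulate-Deg< {suc n} f (suc i) (s≤s l) = tabulate-Deg< (f ∘ Fin.suc) i l

  decode-high : ∀ n ℓ φ i → n ≤ i → B.coeff (decode n ℓ φ) i ≡ []
  decode-high zero    ℓ φ i       l       = ≡.refl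
  decode-high (suc n) ℓ φ (suc i) (s≤s l) = decode-high n (ℓ ∘ suc) _ i l

  decode-Deg< : ∀ n ℓ φ i → Deg< (ℓ i) (B.coeff (decode n ℓ φ) i)
  decode-Deg< zero    ℓ φ i       = λ _ _ → refl
  decode-Deg< (suc n) ℓ φ zero    = tabulate-Deg< _
  decode-Deg< (suc n) ℓ φ (suc i) = decode-Deg< n (ℓ ∘ suc) _ i

  decode-injective : ∀ n ℓ {φ φ′} → decode n ℓ φ B.≋ decode n ℓ φ′ → ∀ j → φ j ≡ φ′ j
  decode-injective (suc n) ℓ {φ} {φ′} e j with splitAt (ℓ 0) j in eq
  ... | inj₁ t = ≡.subst (λ j → φ j ≡ φ′ j) (Fin.splitAt⁻¹-↑ˡ eq) (enum-inj _ _
        (≡.subst₂ _≈_ (coeff-tabulate (λ t → enum (φ (t ↑ˡ ∑ n (ℓ ∘ suc)))) t) (coeff-tabulate (λ t → enum (φ′ (t ↑ˡ ∑ n (ℓ ∘ suc)))) t)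
          (at (B.at e 0) (toℕ t))))
  ... | inj₂ k = ≡.subst (λ j → φ j ≡ φ′ j) (Fin.splitAt⁻¹-↑ʳ eq) (decode-injective n (ℓ ∘ suc) (B.≋-tail e) k)

  Shape : ℕ → (ℕ → ℕ) → B.Poly → Set ℓ
  Shape n ℓ A = BD.Deg< n A × (∀ i → Deg< (ℓ i) (B.coeff A i))

  decode-Shape : ∀ n ℓ φ → Shape n ℓ (decode n ℓ φ)
  decode-Shape n ℓ φ = (λ i l → PR.reflexive (decode-high n ℓ φ i l)) , decode-Deg< n ℓ φ

  module Bᵣ = CommutativeRing B.polyRing

  Shape-sub : ∀ {n ℓ} A A′ → Shape n ℓ A → Shape n ℓ A′ → Shape n ℓ (A Bᵣ.- A′)
  Shape-sub A A′ (d , e) (d′ , e′) = BD.Deg<-⊕ A (B.⊖ A′) d (BD.Deg<-⊖ A′ d′) ,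
    λ i → Deg<-cong (≋-sym (BD.coeff-sub A A′ i)) (Deg<-⊕ (B.coeff A i) (⊖ B.coeff A′ i) (e i) (Deg<-⊖ (B.coeff A′ i) (e′ i)))

  abstract
    -- Homogeneous linear algebra by counting: there are more pairs (u , v) than values of the
    -- prescribed coefficient blocks, so two pairs collide, and their difference is the solution.
    -- The constant term in Z is left free.
    siegel : ∀ a b k (ℓ ℓ′ : ℕ → ℕ) f P → ∑ k ℓ′ < ∑ a ℓ + ∑ b ℓ →
      ∃ λ u → ∃ λ v → Shape a ℓ u × Shape b ℓ v × ¬ (u B.≋ [] × v B.≋ []) ×
        (∀ i t → i < k → t < ℓ′ i → coeff (B.coeff (u B.⊛ f B.⊕ v B.⊛ P) (suc i)) t ≈ 0#)
    siegel a b k ℓ ℓ′ f P lt with Fin.pigeonhole (ℕ.^-monoʳ-< q 2≤q lt)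
        (λ z → funToFin (encode k ℓ′ (λ i → B.coeff (U z B.⊛ f B.⊕ V z B.⊛ P) (suc i))))
      where
      U V : Fin (q ℕ.^ (∑ a ℓ + ∑ b ℓ)) → B.Poly
      U z = decode a ℓ (λ j → finToFun z (j ↑ˡ ∑ b ℓ))
      V z = decode b ℓ (λ j → finToFun z (∑ a ℓ ↑ʳ j))
    ... | z , z′ , z<z′ , same = u z Bᵣ.- u z′ , v z Bᵣ.- v z′ ,
          Shape-sub (u z) (u z′) (decode-Shape a ℓ _) (decode-Shape a ℓ _) ,
          Shape-sub (v z) (v z′) (decode-Shape b ℓ _) (decode-Shape b ℓ _) ,
          (λ { (eu , ev) → ℕ.<-irrefl (≡.cong toℕ (recover (BDom.x-y≈0⇒x≈y eu) (BDom.x-y≈0⇒x≈y ev))) z<z′ }) ,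
          vanish
      where
      u v : Fin (q ℕ.^ (∑ a ℓ + ∑ b ℓ)) → B.Poly
      u z = decode a ℓ (λ j → finToFun z (j ↑ˡ ∑ b ℓ))
      v z = decode b ℓ (λ j → finToFun z (∑ a ℓ ↑ʳ j))
      G : Fin (q ℕ.^ (∑ a ℓ + ∑ b ℓ)) → B.Poly
      G z = u z B.⊛ f B.⊕ v z B.⊛ P
      agree : u z B.≋ u z′ → v z B.≋ v z′ → ∀ (j : Fin (∑ a ℓ + ∑ b ℓ)) → finToFun {q} z j ≡ finToFun {q} z′ j
      agree eu ev j with splitAt (∑ a ℓ) j in eq
      ... | inj₁ i = ≡.subst (λ j → finToFun z j ≡ finToFun z′ j) (Fin.splitAt⁻¹-↑ˡ eq) (decode-injective a ℓ eu i)
      ... | inj₂ i = ≡.subst (λ j → finToFun z j ≡ finToFun z′ j) (Fin.splitAt⁻¹-↑ʳ eq) (decode-injective b ℓ ev i)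
      funToFin-cong : ∀ {m n} {g h : Fin m → Fin n} → (∀ i → g i ≡ h i) → funToFin g ≡ funToFin h
      funToFin-cong {zero}  e = ≡.refl
      funToFin-cong {suc m} e = ≡.cong₂ Fin.combine (e Fin.zero) (funToFin-cong (e ∘ Fin.suc))
      recover : u z B.≋ u z′ → v z B.≋ v z′ → z ≡ z′
      recover eu ev = ≡.trans (≡.sym (Fin.funToFin-finToFin {∑ a ℓ + ∑ b ℓ} {q} z))
        (≡.trans (funToFin-cong (agree eu ev)) (Fin.funToFin-finToFin {∑ a ℓ + ∑ b ℓ} {q} z′))
      difference : (u z Bᵣ.- u z′) B.⊛ f B.⊕ (v z Bᵣ.- v z′) B.⊛ P B.≋ G z Bᵣ.- G z′
      difference = BS.solve 6 (λ u u′ v v′ f P → (u BS.:- u′) BS.:* f BS.:+ (v BS.:- v′) BS.:* P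
        BS.:= (u BS.:* f BS.:+ v BS.:* P) BS.:- (u′ BS.:* f BS.:+ v′ BS.:* P)) B.≋-refl (u z) (u z′) (v z) (v z′) f P
      codes : ∀ j → encode k ℓ′ (λ i → B.coeff (G z) (suc i)) j ≡ encode k ℓ′ (λ i → B.coeff (G z′) (suc i)) j
      codes j = ≡.trans (≡.sym (Fin.finToFun-funToFin (encode k ℓ′ (λ i → B.coeff (G z) (suc i))) j))
        (≡.trans (≡.cong (λ w → finToFun w j) same) (Fin.finToFun-funToFin (encode k ℓ′ (λ i → B.coeff (G z′) (suc i))) j))
      vanish : ∀ i t → i < k → t < ℓ′ i → coeff (B.coeff ((u z Bᵣ.- u z′) B.⊛ f B.⊕ (v z Bᵣ.- v z′) B.⊛ P) (suc i)) t ≈ 0#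
      vanish i t i<k t<ℓ = trans (at (≋-trans (B.at difference (suc i)) (BD.coeff-sub (G z) (G z′) (suc i))) t)
        (trans (coeff-sub (B.coeff (G z) (suc i)) (B.coeff (G z′) (suc i)) t)
          (FR.x≈y⇒x-y≈0 (encode-injective k ℓ′ codes i t i<k t<ℓ)))

-- The first D equation blocks exceed the blocks of u by D′ m each, in total by D D′ m, which is one
-- less than the first block of v. Each later equation block matches a further block of v, so one
-- unknown is left over.
remaining-equations : ∀ D′ m d → 1 ≤ d → d ≤ suc D′ →
  ∑ (suc D′) (λ i → suc ((suc D′ * D′ ∸ i) * m)) + ∑ d (λ i → suc ((suc D′ * D′ ∸ i) * m))
    ≡ suc (∑ (D′ + d) (λ i → suc ((suc D′ * suc D′ ∸ suc i) * m)))
remaining-equations D′ m = go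
  where
  D = suc D′
  ℓ ℓ′ : ℕ → ℕ
  ℓ i = suc ((D * D′ ∸ i) * m)
  ℓ′ i = suc ((D * D ∸ suc i) * m)
  open NatSolver.+-*-Solver
  D² : D * D ≡ suc (D′ + D * D′)
  D² = ℕ.*-suc D D′
  low : ∀ i → i < D → ℓ′ i ≡ D′ * m + ℓ i
  low i (s≤s i≤D′) = ≡.trans (≡.cong (λ z → suc (z * m)) (≡.trans (≡.cong (ℕ._∸ suc i) D²)
      (ℕ.+-∸-assoc D′ (≤-trans i≤D′ (ℕ.m≤m+n D′ (D′ * D′))))))
    (solve 3 (λ D′ x m → con 1 :+ (D′ :+ x) :* m := D′ :* m :+ (con 1 :+ x :* m)) ≡.refl D′ (D * D′ ∸ i) m)
  high : ∀ d → ℓ′ (D′ + suc d) ≡ ℓ (suc d)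
  high d = ≡.cong (λ z → suc (z * m)) (≡.trans (≡.cong (ℕ._∸ (suc (D′ + suc d))) D²) (ℕ.[m+n]∸[m+o]≡n∸o D′ (D * D′) (suc d)))
  go : ∀ d → 1 ≤ d → d ≤ D → ∑ D ℓ + ∑ d ℓ ≡ suc (∑ (D′ + d) ℓ′)
  go (suc zero) _ _ = begin
      ∑ D ℓ + (ℓ 0 + 0)            ≡⟨ solve 4 (λ s D D′ m → s :+ ((con 1 :+ (D :* D′) :* m) :+ con 0) := con 1 :+ (D :* (D′ :* m) :+ s)) ≡.refl (∑ D ℓ) D D′ m ⟩
      suc (D * (D′ * m) + ∑ D ℓ) ≡⟨ ≡.cong suc (≡.sym (∑-shift D (D′ * m) ℓ)) ⟩
      suc (∑ D (λ i → D′ * m + ℓ i)) ≡⟨ ≡.cong suc (≡.sym (∑-cong D low)) ⟩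
      suc (∑ D ℓ′)                     ≡⟨ ≡.cong (λ z → suc (∑ z ℓ′)) (ℕ.+-comm 1 D′) ⟩
      suc (∑ (D′ + 1) ℓ′) ∎
    where open ≡.≡-Reasoning
  go (suc (suc d)) _ l = begin
      ∑ D ℓ + ∑ (suc (suc d)) ℓ          ≡⟨ ≡.cong (∑ D ℓ ℕ.+_) (∑-last (suc d) ℓ) ⟩
      ∑ D ℓ + (∑ (suc d) ℓ + ℓ (suc d)) ≡⟨ ≡.sym (ℕ.+-assoc (∑ D ℓ) _ _) ⟩
      ∑ D ℓ + ∑ (suc d) ℓ + ℓ (suc d)  ≡⟨ ≡.cong₂ ℕ._+_ (go (suc d) (s≤s z≤n) (≤-trans (ℕ.n≤1+n _) l)) (≡.sym (high d)) ⟩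
      suc (∑ (D′ + suc d) ℓ′ + ℓ′ (D′ + suc d)) ≡⟨ ≡.cong suc (≡.sym (∑-last (D′ + suc d) ℓ′)) ⟩
      suc (∑ (suc (D′ + suc d)) ℓ′)      ≡⟨ ≡.cong (λ z → suc (∑ z ℓ′)) (≡.sym (ℕ.+-suc D′ (suc d))) ⟩
      suc (∑ (D′ + suc (suc d)) ℓ′) ∎
    where open ≡.≡-Reasoning

-- The minimal polynomial of γ and the multiples of it.

module MinimalPolynomial {q c ℓ} (F : FiniteField q c ℓ)
  (ψ γ : Polynomial.Poly (FiniteField.commRing F)) {n : ℕ}
  (hψ : Degree.HasDeg (FinitePolynomials.domain F) n ψ)
  (ψ-prime : Euclid.Prime (FinitePolynomials.baseField F) ψ)
  (D′ m : ℕ) (D²m<n : suc D′ * suc D′ * m < n) where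
  open FinitePolynomials F
  open SiegelLemma F
  open Weight m
  open FiniteField F using (_≈_; 0#; Carrier; refl; sym; trans; reflexive)
  D = suc D′

  Vanishing : B.Poly → Set (c ⊔ ℓ)
  Vanishing A = ψ ∣ A ⟨ γ ⟩

  record Class (d : ℕ) (A : B.Poly) : Set (c ⊔ ℓ) where
    field
      hasDegree : BD.HasDeg d A
      weight    : W≤ (D * m) A
      vanishing : Vanishing A
  open Class

  -- The condition on m enters here: ψ has degree n > D² m.
  small⇒zero : ∀ {p} → Deg< (suc (D * D * m)) p → ψ ∣ p → p ≋ []
  small⇒zero {p} d h = ∣-degree hψ h (Deg<-mono p D²m<n d)

  Dm≤D²m : D * m ≤ D * D * m
  Dm≤D²m = ℕ.*-monoˡ-≤ m (ℕ.m≤m*n D D)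

  W≤-coeff : ∀ {w} A i → W≤ w A → Deg< (suc w) (B.coeff A i)
  W≤-coeff A i h t l = h i t (<-≤-trans l (ℕ.m≤n+m t (i * m)))

  constant⇒zero : ∀ A → BD.Deg< 1 A → W≤ (D * D * m) A → Vanishing A → A B.≋ []
  constant⇒zero A d w v .B.at zero    = small⇒zero (W≤-coeff A 0 w) (∣-respʳ-≈ value v)
    where
    value : A ⟨ γ ⟩ ≋ B.coeff A 0
    value = ≋-trans (At.ev-cong γ {A} {B.const (B.coeff A 0)} (record { at = λ { zero → ≋-refl ; (suc i) → d (suc i) (s≤s z≤n) } }))
      (At.ev-const γ (B.coeff A 0))
  constant⇒zero A d w v .B.at (suc i) = d (suc i) (s≤s z≤n)

  Vanishing-⊕ : ∀ A A′ → Vanishing A → Vanishing A′ → Vanishing (A B.⊕ A′)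
  Vanishing-⊕ A A′ h k = ∣-respʳ-≈ (≋-sym (At.ev-⊕ γ A A′)) (∣-+ h k)

  Vanishing-⊛ : ∀ A A′ → Vanishing A′ → Vanishing (A B.⊛ A′)
  Vanishing-⊛ A A′ h = ∣-respʳ-≈ (≋-sym (At.ev-⊛ γ A A′)) (∣-*ˡ (A ⟨ γ ⟩) h)

  Vanishing-split : ∀ A A′ → Vanishing (A B.⊛ A′) → Vanishing A ⊎ Vanishing A′
  Vanishing-split A A′ h = Prime.euclid ψ-prime (A ⟨ γ ⟩) (A′ ⟨ γ ⟩) (∣-respʳ-≈ (At.ev-⊛ γ A A′) h)

  ¬Class-0 : ∀ A → ¬ Class 0 A
  ¬Class-0 A C = BD.HasDeg-nonzero {p = A} (hasDegree C)
    (constant⇒zero A (BD.bounded (hasDegree C)) (W≤-mono A Dm≤D²m (weight C)) (vanishing C))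

  shape⇒W≤ : ∀ {k w} {ℓ : ℕ → ℕ} A → Shape k ℓ A → (∀ i → i < k → i * m + ℓ i ≤ suc w) → W≤ w A
  shape⇒W≤ {k} {w} {ℓ} A (d , e) bound i t l with i ℕ.<? k
  ... | no nk  = at (d i (ℕ.≮⇒≥ nk)) t
  ... | yes ik with t ℕ.<? ℓ i
  ...   | no nt  = e i t (ℕ.≮⇒≥ nt)
  ...   | yes tl = ⊥-elim (ℕ.<-irrefl ≡.refl (<-≤-trans l (ℕ.≤-pred (≤-trans
            (≤-reflexive (≡.sym (ℕ.+-suc (i * m) t))) (≤-trans (ℕ.+-monoʳ-≤ (i * m) tl) (bound i ik))))))

  -- Siegel's lemma kills the coefficients of u f + v P in positive Z-degree. The remaining constant
  -- is a multiple of ψ of degree at most D² m, so it vanishes too. If v were zero, u f = 0 would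
  -- make u zero as well.
  relation : ∀ {d f P} → Class d f → d ≤ D → BD.Deg< (suc D) P → W≤ (D * m) P → Vanishing P →
    ∃ λ u → ∃ λ v → BD.Deg< d v × ¬ (v B.≋ []) × v B.⊛ P B.≋ u B.⊛ f
  relation {zero} {f} C _ _ _ _ = ⊥-elim (¬Class-0 f C)
  relation {suc d′} {f} {P} C d≤D dP wP vP = (B.⊖ u) , v , proj₁ sv , nv , rel
    where
    d = suc d′
    -- Within weight D D′ m there is room for (D D′ - i) m + 1 coefficients at Z^i, and within
    -- weight D² m for (D² - i) m + 1; the equations start at Z^1.
    solution = siegel D d (D′ + d) (λ i → suc ((D * D′ ∸ i) * m)) (λ i → suc ((D * D ∸ suc i) * m)) f P
      (≤-reflexive (≡.sym (remaining-equations D′ m d (s≤s z≤n) d≤D)))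
    u v R : B.Poly
    u = proj₁ solution
    v = proj₁ (proj₂ solution)
    R = u B.⊛ f B.⊕ v B.⊛ P
    su = proj₁ (proj₂ (proj₂ solution))
    sv = proj₁ (proj₂ (proj₂ (proj₂ solution)))
    nz = proj₁ (proj₂ (proj₂ (proj₂ (proj₂ solution))))
    van = proj₂ (proj₂ (proj₂ (proj₂ (proj₂ solution))))
    block : ∀ i → i < D → i * m + suc ((D * D′ ∸ i) * m) ≤ suc (D * D′ * m)
    block i (s≤s l) = ≤-reflexive (≡.trans (ℕ.+-suc (i * m) _) (≡.cong suc (≡.trans (≡.sym (ℕ.*-distribʳ-+ m i (D * D′ ∸ i)))
      (≡.cong (ℕ._* m) (ℕ.m+[n∸m]≡n (≤-trans l (ℕ.m≤m+n D′ (D′ * D′))))))))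
    wu : W≤ (D * D′ * m) u
    wu = shape⇒W≤ u su block
    wv : W≤ (D * D′ * m) v
    wv = shape⇒W≤ v sv (λ i l → block i (<-≤-trans l d≤D))
    total : D * D′ * m + D * m ≡ D * D * m
    total = ≡.trans (≡.sym (ℕ.*-distribʳ-+ m (D * D′) D)) (≡.cong (ℕ._* m) (≡.trans (ℕ.+-comm (D * D′) D) (≡.sym (ℕ.*-suc D D′))))
    wR : W≤ (D * D * m) R
    wR = W≤-⊕ (u B.⊛ f) (v B.⊛ P) (≡.subst (λ w → W≤ w (u B.⊛ f)) total (W≤-⊛ u f wu (weight C)))
      (≡.subst (λ w → W≤ w (v B.⊛ P)) total (W≤-⊛ v P wv wP))
    dR : BD.Deg< (D + d) R
    dR = BD.Deg<-⊕ (u B.⊛ f) (v B.⊛ P) (BD.Deg<-⊛ u f (proj₁ su) (BD.bounded (hasDegree C)))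
      (≡.subst (λ k → BD.Deg< k (v B.⊛ P)) (ℕ.+-comm d D) (BD.Deg<-⊛ v P (proj₁ sv) dP))
    R≋[] : R B.≋ []
    R≋[] = constant⇒zero R constant wR (Vanishing-⊕ (u B.⊛ f) (v B.⊛ P) (Vanishing-⊛ u f (vanishing C)) (Vanishing-⊛ v P vP))
      where
      constant : BD.Deg< 1 R
      -- Outside the blocks treated by `siegel`, the bound on the Z-degree or on the weight already
      -- gives zero.
      constant (suc i) _ .at t with i ℕ.<? D′ + d
      ... | no ni = at (dR (suc i) (s≤s (ℕ.≮⇒≥ ni))) t
      ... | yes il with t ℕ.<? suc ((D * D ∸ suc i) * m)
      ...   | yes tl = van i t il tl
      ...   | no nt = wR (suc i) t (≤-<-trans
                (≤-trans (ℕ.*-monoˡ-≤ m (ℕ.m≤n+m∸n (D * D) (suc i))) (≤-reflexive (ℕ.*-distribʳ-+ m (suc i) (D * D ∸ suc i))))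
                (ℕ.+-monoʳ-< (suc i * m) (ℕ.≮⇒≥ nt)))
    nv : ¬ (v B.≋ [])
    nv z = nz (u≋[] , z)
      where
      uf≋[] : u B.⊛ f B.≋ []
      uf≋[] = B.≋-trans (B.≋-sym (B.≋-trans (B.⊕-cong (B.≋-refl {u B.⊛ f}) (B.⊛-zeroˡ P z)) (B.⊕-identityʳ _))) R≋[]
      u≋[] : u B.≋ []
      u≋[] = [ (λ e → e) , (λ e → ⊥-elim (BD.HasDeg-nonzero {p = f} (hasDegree C) e)) ]′ (Domain.noZeroDivisors BD.polyDomain u f uf≋[])
    rel : v B.⊛ P B.≋ (B.⊖ u) B.⊛ f
    rel = B.≋-trans (BS.solve 4 (λ u f v P → v BS.:* P BS.:= (u BS.:* f BS.:+ v BS.:* P) BS.:+ (BS.:- u) BS.:* f) B.≋-refl u f v P)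
      (B.⊕-cong R≋[] (B.≋-refl {(B.⊖ u) B.⊛ f}))

  Minimal : ℕ → Set (c ⊔ ℓ)
  Minimal d = ∀ {e} A → e < d → ¬ Class e A

  factor-Class : ∀ {d e f A A′} → Class d f → f B.≋ A B.⊛ A′ → BD.HasDeg e A → Vanishing A → Class e A
  factor-Class {f = f} {A} {A′} C eq hA vA = record { hasDegree = hA ; vanishing = vA
    ; weight = W≤-factor A A′ (λ z → BD.HasDeg-nonzero {p = f} (hasDegree C)
        (B.≋-trans eq (B.≋-trans (B.⊛-congʳ A z) (B.⊛-zeroʳ A)))) (W≤-cong eq (weight C)) }

  -- As ψ is prime it divides the value at γ of one of the factors, which is then a member of the
  -- class of degree below d.
  irreducible : ∀ {d f a b A A′} → Class d f → Minimal d → f B.≋ A B.⊛ A′ → BD.HasDeg a A → BD.HasDeg b A′ → a < d → ¬ (b < d)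
  irreducible {f = f} {A = A} {A′} C min eq hA hA′ a<d b<d with Vanishing-split A A′ (∣-respʳ-≈ (At.ev-cong γ eq) (vanishing C))
  ... | inj₁ v = min A a<d (factor-Class C eq hA v)
  ... | inj₂ v = min A′ b<d (factor-Class C (B.≋-trans eq (B.⊛-comm A A′)) hA′ v)

  -- Euclidean descent on v: the pseudo-division κ f = v w + r gives r P = (κ P - w u) f, so r takes
  -- the place of v until a nonzero constant is reached. The remainder never vanishes, as κ f = v w
  -- would yield a factorisation of f.
  divides-multiple : ∀ N {d f P u v e} → e < N → Class d f → Minimal d → BD.HasDeg e v → e < d →
    v B.⊛ P B.≋ u B.⊛ f → ∃ λ κ → ∃ λ h → ¬ (κ ≋ []) × h B.⊛ f B.≋ κ B.· P
  divides-multiple (suc N) {P = P} {u} {v} {zero} _ C min hv _ eq = B.coeff v 0 , u , BD.leading hv ,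
    B.≋-trans (B.≋-sym eq) (B.≋-trans (B.⊛-congˡ {v} {B.const (B.coeff v 0)} P (record { at = λ { zero → ≋-refl ; (suc i) → BD.bounded hv (suc i) (s≤s z≤n) } })) (B.const-⊛ (B.coeff v 0) P))
  divides-multiple (suc N) {d} {f} {P} {u} {v} {suc e} (s≤s l) C min hv e<d eq = go (BD.degree? r)
    where
    open SR B.≋-setoid
    open BD.PseudoDivision (BD.pseudoDivide hv _ f (BD.bounded (hasDegree C)))
      renaming (multiplier to κ; quotient to w; remainder to r)
    go : (r B.≋ []) ⊎ (∃ λ k → BD.HasDeg k r) → ∃ λ κ → ∃ λ h → ¬ (κ ≋ []) × h B.⊛ f B.≋ κ B.· P
    go (inj₂ (k , hk)) = divides-multiple N {u = κ B.· P Bᵣ.- w B.⊛ u} (<-≤-trans k<e l) C min hk (ℕ.<-trans k<e e<d) (begin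
        r B.⊛ P
          ≈⟨ BS.solve 4 (λ r P v w → r BS.:* P BS.:= (v BS.:* w BS.:+ r) BS.:* P BS.:- w BS.:* (v BS.:* P)) B.≋-refl r P v w ⟩
        (v B.⊛ w B.⊕ r) B.⊛ P Bᵣ.- w B.⊛ (v B.⊛ P)
          ≈⟨ B.⊕-cong (B.⊛-congˡ P (B.≋-trans (B.≋-sym equation) (B.≋-sym (B.const-⊛ κ f)))) (B.⊖-cong (B.⊛-congʳ w eq)) ⟩
        (B.const κ B.⊛ f) B.⊛ P Bᵣ.- w B.⊛ (u B.⊛ f)
          ≈⟨ BS.solve 5 (λ κ f P w u → (κ BS.:* f) BS.:* P BS.:- w BS.:* (u BS.:* f) BS.:= (κ BS.:* P BS.:- w BS.:* u) BS.:* f) B.≋-refl (B.const κ) f P w u ⟩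
        (B.const κ B.⊛ P Bᵣ.- w B.⊛ u) B.⊛ f
          ≈⟨ B.⊛-congˡ f (B.⊕-cong (B.const-⊛ κ P) (B.≋-refl {B.⊖ (w B.⊛ u)})) ⟩
        (κ B.· P Bᵣ.- w B.⊛ u) B.⊛ f ∎)
      where
      k<e = BD.HasDeg-Deg< {p = r} hk small
    go (inj₁ z) = ⊥-elim (contradict (BD.degree? w))
      where
      κf : κ B.· f B.≋ v B.⊛ w
      κf = B.≋-trans equation (B.≋-trans (B.⊕-cong (B.≋-refl {v B.⊛ w}) z) (B.⊕-identityʳ _))
      hκf : BD.HasDeg d (κ B.· f)
      hκf = BD.HasDeg-cong (B.const-⊛ κ f) (BD.HasDeg-⊛ {0} (B.const κ) f
        (BD.hasDeg (λ { (suc i) _ → ≋-refl }) multiplier≉0) (hasDegree C))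
      contradict : (w B.≋ []) ⊎ (∃ λ k → BD.HasDeg k w) → ⊥
      contradict (inj₁ wz) = BD.HasDeg-nonzero {p = κ B.· f} hκf (B.≋-trans κf (B.≋-trans (B.⊛-congʳ v wz) (B.⊛-zeroʳ v)))
      contradict (inj₂ (b , hw)) with nonzero-HasDeg multiplier≉0
      ... | a , hκ with factorisation-descends _ {κ = κ} {f} {v} {w} ≤-refl hκ κf hv hw
      ...   | v′ , w′ , ef , hv′ , hw′ = irreducible C min ef hv′ hw′ e<d
              (≡.subst (b <_) (BD.HasDeg-unique {p = κ B.· f} (BD.HasDeg-cong (B.≋-sym κf) (BD.HasDeg-⊛ v w hv hw)) hκf) (s≤s (ℕ.m≤n+m b e)))

  minimal-divides : ∀ {d f P} → Class d f → Minimal d → d ≤ D → BD.Deg< (suc D) P → W≤ (D * m) P → Vanishing P →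
    ∃ λ κ → ∃ λ h → ¬ (κ ≋ []) × h B.⊛ f B.≋ κ B.· P
  minimal-divides C min d≤D dP wP vP with relation C d≤D dP wP vP
  ... | u , v , dv , nv , eq with BD.nonzero-HasDeg nv
  ...   | e , he = divides-multiple _ {u = u} {v} ≤-refl C min he (BD.HasDeg-Deg< {p = v} he dv) eq

  -- Choosing a minimal polynomial is classical, which is harmless for a stable goal.
  minimal-or-none : ∀ {g} {G : Set g} → (¬ ¬ G → G) →
    (∀ {d} f → d ≤ D → Class d f → Minimal d → Primitive f → G) →
    ((∀ {d} f → d ≤ D → ¬ Class d f) → G) → G
  minimal-or-none {G = G} stable some none = stable λ ¬g → ¬g (none (λ {d} f d≤D → refute ¬g (suc d) (ℕ.n<1+n d) f d≤D))
    where
    -- The induction is on the degree of the leading coefficient, which drops when a prime of the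
    -- content is divided out.
    refutePrimitive : ¬ G → ∀ N {d e} f → e < N → d ≤ D → Minimal d → HasDeg e (B.coeff f d) → ¬ Class d f
    refutePrimitive ¬g (suc N) {d} {e} f (s≤s l) d≤D min he C = ¬g (some f d≤D C min isPrimitive)
      where
      isPrimitive : Primitive f
      isPrimitive π P π∣f with ∣ᵇ-quotient f π∣f
      ... | f′ , ef with cofactor-degree {d = π} {B.coeff f′ d} (≋-trans (B.at ef d) (B.coeff-· π f′ d)) (Prime.hasDegree P) he
      ...   | k , hk , ek = refutePrimitive ¬g N f′ (<-≤-trans (summand-< ek) l)
                d≤D min hk (factor-Class {A = f′} {B.const π} C (B.≋-trans ef (B.≋-trans (B.≋-sym (B.const-⊛ π f′)) (B.⊛-comm (B.const π) f′)))
                  (HasDeg-·⁻ f′ (BD.HasDeg-cong ef (hasDegree C)) (Prime-nonzero P)) vanishes)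
        where
        vanishes : Vanishing f′
        vanishes with Prime.euclid ψ-prime π (f′ ⟨ γ ⟩) (∣-respʳ-≈ (≋-trans (At.ev-cong γ ef) (At.ev-· γ π f′)) (vanishing C))
        ... | inj₂ v = v
        -- π divides the leading coefficient of f, so its degree is at most D m, too small for a
        -- multiple of ψ.
        ... | inj₁ ψ∣π = ⊥-elim (Prime-nonzero P (small⇒zero (Deg<-mono π (s≤s (≤-trans (≤-trans (ℕ.m≤m+n _ k) (≤-reflexive ek))
                (≤-trans (ℕ.≤-pred (HasDeg-Deg< {p = B.coeff f d} he (W≤-coeff f d (weight C)))) Dm≤D²m))) (bounded (Prime.hasDegree P))) ψ∣π))
    refute : ¬ G → ∀ N {d} → d < N → ∀ f → d ≤ D → ¬ Class d f
    refute ¬g (suc N) {d} (s≤s l) f d≤D C = refutePrimitive ¬g _ f ≤-refl d≤D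
      (λ {e} A e<d → refute ¬g N (<-≤-trans e<d l) A (≤-trans (ℕ.<⇒≤ e<d) d≤D)) (proj₂ (nonzero-HasDeg (BD.leading (hasDegree C)))) C

-- Gauges: the properties of f on which the counting rests.

module Gauges {q c ℓ} (F : FiniteField q c ℓ) (D m : ℕ) where
  open FinitePolynomials F
  open SiegelLemma F using (module Bᵣ)
  open FiniteField F using (_≈_; 0#; Carrier; refl; sym; trans; reflexive)
  private module FR = DomainProperties domain

  All≢ : Poly → List (Poly × Poly) → Set (c ⊔ ℓ)
  All≢ x = All (λ (ε , x′) → ¬ (x′ PR.- x ≋ []))

  AllDivide : Poly → Poly → List (Poly × Poly) → Set (c ⊔ ℓ)
  AllDivide Λ x = All (λ (ε , x′) → (x′ PR.- x) ∣ Λ)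

  -- The role of value is played by x ↦ f(− x) for the minimal polynomial f of γ, and by the
  -- constant T^m if there is no f; degree is the degree of f in Z.
  record Gauge : Set (Level.suc (c ⊔ ℓ)) where
    field
      value      : Poly → Poly
      degree     : ℕ
      1≤degree   : 1 ≤ degree
      degree≤D   : degree ≤ D
      value-Deg< : ∀ x → Deg< (suc m) x → Deg< (suc (D * m)) (value x)
      compatible : ∀ x x′ → (x PR.- x′) ∣ value x PR.- value x′
      packing    : ∀ h b {R : Poly → Poly → Set (c ⊔ ℓ)} → h ≤ m →
        (∀ x ys → AllPairs R ys → All (λ y → Deg< h (y PR.- x)) ys → length ys ≤ b) →
        ∀ xs → AllPairs R xs → All (λ x → Deg< (degree * h) (value x)) xs → length xs ≤ degree * b

  -- Λ may be any common multiple of the differences x′ - x. Terms that coincide with x are excluded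
  -- here and treated in `value∣power`.
  record Admissible (G : Gauge) (l : List (Poly × Poly)) : Set (c ⊔ ℓ) where
    open Gauge G
    field
      bounded-terms : All (λ (ε , x) → Deg< m x) l
      nonzero       : All (λ (ε , x) → ¬ (value x ≋ [])) l
      divides-power : ∀ pre ε x post → l ≡ pre ++ (ε , x) ∷ post → All≢ x (pre ++ post) →
        ∀ Λ → AllDivide Λ x (pre ++ post) → value x ∣ Λ ^ degree

  remainder-theorem : ∀ s A → ∃ λ Q → A B.≋ ((⊖ s) ∷ one ∷ []) B.⊛ Q B.⊕ B.const (A ⟨ s ⟩)
  remainder-theorem s [] = [] , B.≋-sym (B.≋-trans (B.⊕-cong (B.⊛-zeroʳ ((⊖ s) ∷ one ∷ [])) B.0∷[]) B.≋-refl)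
  remainder-theorem s (a ∷ A) with remainder-theorem s A
  ... | Q , eq = (A ⟨ s ⟩ ∷ Q) , (begin
      a ∷ A                                ≈⟨ B.∷-cong ≋-refl eq ⟩
      a ∷ (L B.⊛ Q B.⊕ B.const v)          ≈⟨ const-⊕-∷ a _ ⟨
      B.const a B.⊕ ([] ∷ (L B.⊛ Q B.⊕ B.const v)) ≈⟨ B.⊕-cong (B.≋-refl {B.const a}) (X⊛ᵇ _) ⟨
      B.const a B.⊕ X B.⊛ (L B.⊛ Q B.⊕ B.const v)
        ≈⟨ BS.solve 6 (λ a X L Q v s → a BS.:+ X BS.:* (L BS.:* Q BS.:+ v)
             BS.:= (L BS.:* (v BS.:+ X BS.:* Q)) BS.:+ (a BS.:+ (X BS.:- L) BS.:* v)) B.≋-refl (B.const a) X L Q (B.const v) (B.const s) ⟩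
      L B.⊛ (B.const v B.⊕ X B.⊛ Q) B.⊕ (B.const a B.⊕ (X Bᵣ.- L) B.⊛ B.const v)
        ≈⟨ B.⊕-cong (B.⊛-congʳ L (B.≋-trans (B.⊕-cong (B.≋-refl {B.const v}) (X⊛ᵇ Q)) (const-⊕-∷ v Q)))
             (B.⊕-cong (B.≋-refl {B.const a}) (B.≋-trans (B.⊛-congˡ (B.const v) X-L) (B.≋-trans (B.const-⊛ s (B.const v)) B.≋-refl))) ⟩
      L B.⊛ (v ∷ Q) B.⊕ B.const (a ⊕ s ⊛ v) ∎)
    where
    open SR B.≋-setoid
    v = A ⟨ s ⟩
    L X : B.Poly
    L = (⊖ s) ∷ one ∷ []
    X = [] ∷ one ∷ []
    X-L : X Bᵣ.- L B.≋ B.const s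
    X-L .B.at zero = PS.solve 1 (λ s → PS.:- (PS.:- s) PS.:= s) ≋-refl s
    X-L .B.at (suc zero) = ⊖-inverseʳ one
    X-L .B.at (suc (suc i)) = ≋-refl

  abstract
    difference-factors : ∀ {d} s A → BD.HasDeg (suc d) A → ∃ λ Q → BD.HasDeg d Q ×
      (∀ t → A ⟨ t ⟩ PR.- A ⟨ s ⟩ ≋ (t PR.- s) ⊛ Q ⟨ t ⟩)
    difference-factors {d} s A hA with remainder-theorem s A
    ... | Q , eq = Q , degreeQ (BD.degree? Q) , λ t → begin
        A ⟨ t ⟩ PR.- A ⟨ s ⟩
          ≈⟨ ⊕-cong (≋-trans (At.ev-cong t eq) (≋-trans (At.ev-⊕ t (L B.⊛ Q) (B.const (A ⟨ s ⟩)))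
               (⊕-cong (≋-trans (At.ev-⊛ t L Q) (⊛-congˡ (Q ⟨ t ⟩) (At.ev-linear t (⊖ s)))) (At.ev-const t (A ⟨ s ⟩))))) ≋-refl ⟩
        (((⊖ s) ⊕ t) ⊛ Q ⟨ t ⟩ ⊕ A ⟨ s ⟩) PR.- A ⟨ s ⟩
          ≈⟨ PS.solve 4 (λ s t q a → ((PS.:- s PS.:+ t) PS.:* q PS.:+ a) PS.:- a PS.:= (t PS.:- s) PS.:* q) ≋-refl s t (Q ⟨ t ⟩) (A ⟨ s ⟩) ⟩
        (t PR.- s) ⊛ Q ⟨ t ⟩ ∎
      where
      open SR ≋-setoid
      L : B.Poly
      L = (⊖ s) ∷ one ∷ []
      hL : BD.HasDeg 1 L
      hL = BD.hasDeg (λ { zero () ; (suc zero) (s≤s ()) ; (suc (suc i)) _ → ≋-refl }) (HasDeg-nonzero {p = one} HasDeg-one)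
      LQ : L B.⊛ Q B.≋ A Bᵣ.- B.const (A ⟨ s ⟩)
      LQ = B.≋-trans (BS.solve 2 (λ x y → x BS.:= (x BS.:+ y) BS.:- y) B.≋-refl (L B.⊛ Q) (B.const (A ⟨ s ⟩)))
        (B.⊕-cong (B.≋-sym eq) (B.≋-refl {B.⊖ B.const (A ⟨ s ⟩)}))
      hLQ : BD.HasDeg (suc d) (L B.⊛ Q)
      hLQ = BD.HasDeg-cong (B.≋-sym LQ) (BD.hasDeg
        (BD.Deg<-⊕ A (B.⊖ B.const (A ⟨ s ⟩)) (BD.bounded hA) λ { zero () ; (suc i) _ → ≋-refl })
        (λ z → BD.leading hA (≋-trans (≋-sym (≋-trans (BD.coeff-sub A (B.const (A ⟨ s ⟩)) (suc d)) (⊕-identityʳ _))) z)))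
      degreeQ : (Q B.≋ []) ⊎ (∃ λ k → BD.HasDeg k Q) → BD.HasDeg d Q
      degreeQ (inj₁ z) = ⊥-elim (BD.HasDeg-nonzero {p = L B.⊛ Q} hLQ (B.≋-trans (B.⊛-congʳ L z) (B.⊛-zeroʳ L)))
      degreeQ (inj₂ (k , hQ)) = ≡.subst (λ k → BD.HasDeg k Q)
        (ℕ.suc-injective (BD.HasDeg-unique {p = L B.⊛ Q} (BD.HasDeg-⊛ L Q hL hQ) hLQ)) hQ

  Deg<? : ∀ h p → Dec (Deg< h p)
  Deg<? h p with degree? p
  ... | inj₁ z = yes (λ i _ → at z i)
  ... | inj₂ (n , hp) with n ℕ.<? h
  ...   | yes l = yes (Deg<-mono p l (bounded hp))
  ...   | no nl = no λ d → nl (HasDeg-Deg< {p = p} hp d)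

  Deg<-quotient : ∀ {h k} p p′ → ¬ Deg< h p → Deg< (h + k) (p ⊛ p′) → Deg< k p′
  Deg<-quotient {h} {k} p p′ np d with degree? p | degree? p′
  ... | inj₁ z        | _              = ⊥-elim (np (λ i _ → at z i))
  ... | inj₂ _        | inj₁ z         = λ i _ → at z i
  ... | inj₂ (a , ha) | inj₂ (b , hb)  = Deg<-mono p′ b<k (bounded hb)
    where
    h≤a : h ≤ a
    h≤a = ℕ.≮⇒≥ (λ a<h → np (Deg<-mono p a<h (bounded ha)))
    b<k : b < k
    b<k = ℕ.+-cancelˡ-< h b k (≤-<-trans (ℕ.+-monoˡ-≤ b h≤a) (HasDeg-Deg< {p = p ⊛ p′} (HasDeg-⊛ p p′ ha hb) d))

  length-filter-split : ∀ {p} {P : Poly → Set p} (P? : ∀ x → Dec (P x)) xs →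
    length xs ≡ length (List.filter P? xs) + length (List.filter (λ x → ¬? (P? x)) xs)
  length-filter-split P? [] = ≡.refl
  length-filter-split P? (x ∷ xs) with P? x
  ... | yes _ = ≡.cong suc (length-filter-split P? xs)
  ... | no _  = ≡.trans (≡.cong suc (length-filter-split P? xs)) (≡.sym (ℕ.+-suc _ _))

  -- f takes values of degree below d h only on d balls of radius h: on the complement of
  -- the ball around s the divided difference (f(t) − f(s)) / (t − s) has degree below (d − 1) h.
  polynomial-packing : ∀ d f → BD.HasDeg d f → ∀ h b {R : Poly → Poly → Set (c ⊔ ℓ)} →
    (∀ x ys → AllPairs R ys → All (λ y → Deg< h (y PR.- x)) ys → length ys ≤ b) →
    ∀ xs → AllPairs R xs → All (λ x → Deg< (d * h) (f ⟨ ⊖ x ⟩)) xs → length xs ≤ d * b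
  polynomial-packing d f hf h b ball [] ap small = z≤n
  polynomial-packing zero f hf h b ball (x ∷ xs) ap (d ∷ _) = ⊥-elim (BD.leading hf (≋-trans (≋-sym constant) (Deg<-zero {f ⟨ ⊖ x ⟩} d)))
    where
    constant : f ⟨ ⊖ x ⟩ ≋ B.coeff f 0
    constant = ≋-trans (At.ev-cong (⊖ x) {f} {B.const (B.coeff f 0)}
      (record { at = λ { zero → ≋-refl ; (suc i) → BD.bounded hf (suc i) (s≤s z≤n) } })) (At.ev-const (⊖ x) (B.coeff f 0))
  polynomial-packing (suc d) f hf h b {R = R} ball xs@(x ∷ _) ap small@(dx ∷ _) with difference-factors (⊖ x) f hf
  ... | Q , hQ , factors = ≤-trans (≤-reflexive (length-filter-split near? xs)) (ℕ.+-mono-≤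
        (ball x (List.filter near? xs) (AllPairs.filter⁺ near? ap) (All.all-filter near? xs))
        (polynomial-packing d Q hQ h b ball (List.filter far? xs) (AllPairs.filter⁺ far? ap)
          (All.map (λ { (far , dy) → quotient-small far dy }) (All.zip (All.all-filter far? xs , All.filter⁺ far? small)))))
    where
    near? : ∀ y → Dec (Deg< h (y PR.- x))
    near? y = Deg<? h (y PR.- x)
    far? : ∀ y → Dec (¬ Deg< h (y PR.- x))
    far? y = ¬? (near? y)
    quotient-small : ∀ {y} → ¬ Deg< h (y PR.- x) → Deg< (suc d * h) (f ⟨ ⊖ y ⟩) → Deg< (d * h) (Q ⟨ ⊖ y ⟩)
    quotient-small {y} far dy = Deg<-quotient ((⊖ y) PR.- (⊖ x)) (Q ⟨ ⊖ y ⟩)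
      (λ near → far (Deg<-cong (PS.solve 2 (λ x y → PS.:- (PS.:- y PS.:- (PS.:- x)) PS.:= y PS.:- x) ≋-refl x y)
        (Deg<-⊖ ((⊖ y) PR.- (⊖ x)) near)))
      (Deg<-cong (factors (⊖ y)) (Deg<-⊕ (f ⟨ ⊖ y ⟩) (⊖ (f ⟨ ⊖ x ⟩)) dy (Deg<-⊖ (f ⟨ ⊖ x ⟩) dx)))

-- The gauge of γ, for which all solutions are admissible.

module SolutionGauge {q c ℓ} (F : FiniteField q c ℓ)
  (ψ γ : Polynomial.Poly (FiniteField.commRing F)) {n : ℕ}
  (hψ : Degree.HasDeg (FinitePolynomials.domain F) n ψ)
  (ψ-prime : Euclid.Prime (FinitePolynomials.baseField F) ψ)
  (D′ m : ℕ) (D²m<n : suc D′ * suc D′ * m < n) where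
  open FinitePolynomials F
  open SiegelLemma F
  open Weight m
  open FiniteField F using (_≈_; 0#; 1#; Carrier; refl; sym; trans; reflexive)
  open MinimalPolynomial F ψ γ hψ ψ-prime D′ m D²m<n
  open Gauges F D m

  record Solution (l : List (Poly × Poly)) : Set (c ⊔ ℓ) where
    field
      size          : length l ≡ suc D
      small         : All (λ (ε , x) → Deg< m x) l
      signs         : All (λ (ε , x) → Deg< 1 ε × ε ⊛ ε ≋ one) l
      invertible    : All (λ (ε , x) → ¬ (ψ ∣ x ⊕ γ)) l
      vanishes      : ψ ∣ NR.numerator (map (At.at-s γ) l)
  open Solution

  -- Horner recursion: `o` is the weight of the powers of Z already split off, and each of them is
  -- replaced by an s of degree at most m.
  value-bounded : ∀ {w o s} A → Deg< (suc m) s → (∀ i t → w < o + i * m + t → coeff (B.coeff A i) t ≈ 0#) →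
    ∀ t → w < o + t → coeff (A ⟨ s ⟩) t ≈ 0#
  value-bounded [] ds h t l = refl
  value-bounded {w} {o} {s} (a ∷ A) ds h t l = trans (coeff-⊕ a (s ⊛ A ⟨ s ⟩) t)
    (trans (FiniteField.+-cong F (h 0 t (≡.subst (λ o → w < o + t) (≡.sym (ℕ.+-identityʳ o)) l)) product) (FiniteField.+-identityˡ F 0#))
    where
    rest : ∀ t → w < o + m + t → coeff (A ⟨ s ⟩) t ≈ 0#
    rest = value-bounded {o = o + m} A ds (λ i t l → h (suc i) t
      (≡.subst (λ z → w < z + t) (ℕ.+-assoc o m (i * m)) l))
    product : coeff (s ⊛ A ⟨ s ⟩) t ≈ 0#
    product with o + m ℕ.≤? w
    ... | no big = trans (at (⊛-congʳ s (Deg<-zero {A ⟨ s ⟩} (λ i _ → rest i (<-≤-trans (ℕ.≰⇒> big) (ℕ.m≤m+n (o + m) i))))) t) (at (⊛-zeroʳ s) t)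
    ... | yes l′ = trans (at (⊛-comm s (A ⟨ s ⟩)) t) (Deg<-⊛ {suc (w ∸ (o + m))} (A ⟨ s ⟩) s
            (λ i h → rest i (≤-trans (s≤s (≤-reflexive (≡.sym (ℕ.m+[n∸m]≡n l′)))) (≡.subst (ℕ._≤ o + m + i) (ℕ.+-suc (o + m) _) (ℕ.+-monoʳ-≤ (o + m) h))))
            ds t (ℕ.+-cancelˡ-≤ o _ _ (≤-trans (≤-reflexive regroup) l)))
      where
      regroup : o + suc (w ∸ (o + m) + m) ≡ suc w
      regroup = ≡.trans (solve 3 (λ o m k → o :+ (con 1 :+ (k :+ m)) := con 1 :+ (o :+ m :+ k)) ≡.refl o m (w ∸ (o + m)))
        (≡.cong suc (ℕ.m+[n∸m]≡n l′))
        where open NatSolver.+-*-Solver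

  linear-W≤ : ∀ x → Deg< (suc m) x → W≤ m (x ∷ one ∷ [])
  linear-W≤ x d zero          t       l = d t l
  linear-W≤ x d (suc zero)    zero    l = ⊥-elim (ℕ.<-irrefl (≡.sym (≡.trans (ℕ.+-identityʳ (m + 0)) (ℕ.+-identityʳ m))) l)
  linear-W≤ x d (suc zero)    (suc t) l = refl
  linear-W≤ x d (suc (suc i)) t       l = refl

  const-W≤ : ∀ {w} ε → Deg< 1 ε → W≤ w (B.const ε)
  const-W≤ ε d zero    t l = d t (≤-<-trans z≤n l)
  const-W≤ ε d (suc i) t l = refl

  linear-Deg< : ∀ x → BD.Deg< 2 (x ∷ one ∷ [])
  linear-Deg< x (suc zero) (s≤s ())
  linear-Deg< x (suc (suc i)) _ = ≋-refl

  denominator-W≤ : ∀ l → All (λ (ε , x) → Deg< m x) l → W≤ (length l * m) (NB.denominator (map linear l))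
  denominator-W≤ [] [] = const-W≤ one (bounded HasDeg-one)
  denominator-W≤ ((ε , x) ∷ l) (d ∷ ds) = W≤-⊛ (x ∷ one ∷ []) (NB.denominator (map linear l))
    (linear-W≤ x (Deg<-mono x (ℕ.n≤1+n m) d)) (denominator-W≤ l ds)

  denominator-Deg< : ∀ l → BD.Deg< (suc (length l)) (NB.denominator (map linear l))
  denominator-Deg< [] (suc i) _ = ≋-refl
  denominator-Deg< ((ε , x) ∷ l) = BD.Deg<-⊛ {2} (x ∷ one ∷ []) (NB.denominator (map linear l)) (linear-Deg< x) (denominator-Deg< l)

  numerator-W≤ : ∀ l → All (λ (ε , x) → Deg< m x) l → All (λ (ε , x) → Deg< 1 ε × ε ⊛ ε ≋ one) l →
    W≤ (ℕ.pred (length l) * m) (numeratorZ l)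
  numerator-W≤ [] [] [] i t l = refl
  numerator-W≤ ((ε , x) ∷ l) (d ∷ ds) ((dε , _) ∷ es) = W≤-⊕ (B.const ε B.⊛ NB.denominator (map linear l)) ((x ∷ one ∷ []) B.⊛ numeratorZ l)
    (W≤-⊛ {0} (B.const ε) (NB.denominator (map linear l)) (const-W≤ ε dε) (denominator-W≤ l ds)) (tail l ds es)
    where
    -- m + pred (length l) m equals length l m only for nonempty l; for the empty list the numerator
    -- is zero.
    tail : ∀ l → All (λ (ε , x) → Deg< m x) l → All (λ (ε , x) → Deg< 1 ε × ε ⊛ ε ≋ one) l →
      W≤ (length l * m) ((x ∷ one ∷ []) B.⊛ numeratorZ l)
    tail [] _ _ = W≤-cong {A = []} (B.≋-sym (B.⊛-zeroʳ (x ∷ one ∷ []))) (λ _ _ _ → refl)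
    tail l@(_ ∷ _) ds es = W≤-⊛ (x ∷ one ∷ []) (numeratorZ l) (linear-W≤ x (Deg<-mono x (ℕ.n≤1+n m) d)) (numerator-W≤ l ds es)

  numerator-Deg< : ∀ l → BD.Deg< (length l) (numeratorZ l)
  numerator-Deg< [] i _ = ≋-refl
  numerator-Deg< ((ε , x) ∷ l) = BD.Deg<-⊕ (B.const ε B.⊛ NB.denominator (map linear l)) ((x ∷ one ∷ []) B.⊛ numeratorZ l)
    (BD.Deg<-⊛ {1} (B.const ε) (NB.denominator (map linear l)) (λ { (suc i) _ → ≋-refl }) (denominator-Deg< l))
    (≡.subst (λ k → BD.Deg< k ((x ∷ one ∷ []) B.⊛ numeratorZ l)) (ℕ.+-comm (length l) 1)
      (BD.Deg<-cong (B.⊛-comm (numeratorZ l) (x ∷ one ∷ [])) (BD.Deg<-⊛ (numeratorZ l) (x ∷ one ∷ []) (numerator-Deg< l) (linear-Deg< x))))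

  module _ {l} (S : Solution l) where
    solution-W≤ : W≤ (D * m) (numeratorZ l)
    solution-W≤ = ≡.subst (λ k → W≤ (ℕ.pred k * m) (numeratorZ l)) (size S) (numerator-W≤ l (small S) (signs S))

    solution-Deg< : BD.Deg< (suc D) (numeratorZ l)
    solution-Deg< = ≡.subst (λ k → BD.Deg< k (numeratorZ l)) (size S) (numerator-Deg< l)

    solution-Vanishing : Vanishing (numeratorZ l)
    solution-Vanishing = ∣-respʳ-≈ (≋-sym (At.ev-numerator γ l)) (vanishes S)

  module FromMinimal {d} (f : B.Poly) (d≤D : d ≤ D) (C : Class d f) (min : Minimal d) (pf : Primitive f) where
    1≤d : ∀ {d f} → Class d f → 1 ≤ d
    1≤d {zero} {f} C = ⊥-elim (¬Class-0 f C)
    1≤d {suc d}    C = s≤s z≤n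

    predecessor : ∀ {d} → 1 ≤ d → ∃ λ d′ → d ≡ suc d′
    predecessor (s≤s {n = d′} _) = d′ , ≡.refl

    value : Poly → Poly
    value x = f ⟨ ⊖ x ⟩

    gauge : Gauge
    gauge = record
      { value = value ; degree = d ; 1≤degree = 1≤d C ; degree≤D = d≤D
      ; value-Deg< = λ x dx t l → value-bounded {o = 0} f (Deg<-⊖ x dx) (Class.weight C) t l
      ; compatible = compatible
      ; packing = λ h b _ ball xs ap s → polynomial-packing d f (Class.hasDegree C) h b ball xs ap s }
      where
      compatible : ∀ x x′ → (x PR.- x′) ∣ value x PR.- value x′
      compatible x x′ with predecessor (1≤d C)
      ... | d′ , e with difference-factors (⊖ x′) f (≡.subst (λ d → BD.HasDeg d f) e (Class.hasDegree C))
      ...   | Q , _ , factors = ⊖ (Q ⟨ ⊖ x ⟩) , ≋-sym (≋-trans (factors (⊖ x))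
                (PS.solve 3 (λ x x′ q → (PS.:- x PS.:- (PS.:- x′)) PS.:* q PS.:= (PS.:- q) PS.:* (x PS.:- x′)) ≋-refl x x′ (Q ⟨ ⊖ x ⟩)))

    -- If f(-x) = 0 then f = (Z + x) Q. As ψ does not divide x + γ, it divides Q(γ), and Q
    -- contradicts minimality.
    value≉0 : ∀ x → ¬ (ψ ∣ x ⊕ γ) → ¬ (value x ≋ [])
    value≉0 x nx z with remainder-theorem (⊖ x) f | predecessor (1≤d C)
    ... | Q , eq | d′ , e = contradiction (Vanishing-split L Q (∣-respʳ-≈ (At.ev-cong γ f≋LQ) (Class.vanishing C))) (BD.degree? Q)
      where
      L : B.Poly
      L = (⊖ (⊖ x)) ∷ one ∷ []
      hL : BD.HasDeg 1 L
      hL = BD.hasDeg (linear-Deg< (⊖ (⊖ x))) (HasDeg-nonzero {p = one} HasDeg-one)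
      f≋LQ : f B.≋ L B.⊛ Q
      f≋LQ = B.≋-trans eq (B.≋-trans (B.⊕-cong (B.≋-refl {L B.⊛ Q}) (B.∷-≋[] z B.≋-refl)) (B.⊕-identityʳ _))
      contradiction : Vanishing L ⊎ Vanishing Q → (Q B.≋ []) ⊎ (∃ λ k → BD.HasDeg k Q) → ⊥
      contradiction (inj₁ v) _ = nx (∣-respʳ-≈ (≋-trans (At.ev-linear γ (⊖ (⊖ x))) (⊕-cong (PS.solve 1 (λ x → PS.:- (PS.:- x) PS.:= x) ≋-refl x) (≋-refl {γ}))) v)
      contradiction (inj₂ v) (inj₁ qz) = BD.HasDeg-nonzero {p = f} (Class.hasDegree C) (B.≋-trans f≋LQ (B.≋-trans (B.⊛-congʳ L qz) (B.⊛-zeroʳ L)))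
      contradiction (inj₂ v) (inj₂ (k , hQ)) = min Q
        (≡.subst (k <_) (BD.HasDeg-unique {p = f} (BD.HasDeg-cong (B.≋-sym f≋LQ) (BD.HasDeg-⊛ L Q hL hQ)) (Class.hasDegree C)) (ℕ.n<1+n k))
        (factor-Class {A = Q} {L} C (B.≋-trans f≋LQ (B.⊛-comm L Q)) hQ v)

    admissible : ∀ {l} → Solution l → Admissible gauge l
    admissible {l} S = record
      { bounded-terms = small S
      ; nonzero = All.map (λ {(ε , x)} → value≉0 x) (invertible S)
      ; divides-power = divides }
      where
      divides : ∀ pre ε x post → l ≡ pre ++ (ε , x) ∷ post → All≢ x (pre ++ post) → ∀ Λ → AllDivide Λ x (pre ++ post) → value x ∣ Λ ^ d
      divides pre ε x post ≡.refl ne Λ div with minimal-divides C min d≤D (solution-Deg< S) (solution-W≤ S) (solution-Vanishing S)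
      ... | κ , h , nκ , eq = value-divides-power {f} {h} {κ} pre ε x post pf (BD.bounded (Class.hasDegree C)) nκ eq
              (proj₂ (All-middle pre (signs S))) (All.zip (ne , div)) (value≉0 x (All-middle pre (invertible S)))

  module FromNone (none : ∀ {d} f → d ≤ D → ¬ Class d f) where
    -- T^m never has degree below h ≤ m, so `packing` has no case to treat and every x gets height
    -- m. The gcd with a coinciding term is T^m up to a unit, and modulo T^m a polynomial of degree
    -- below m is determined.
    gauge : Gauge
    gauge = record
      { value = λ _ → mono m 1# ; degree = 1 ; 1≤degree = s≤s z≤n ; degree≤D = s≤s z≤n
      ; value-Deg< = λ _ _ → Deg<-mono (mono m 1#) (s≤s (ℕ.m≤m+n m (D′ * m))) (mono-Deg< m 1#)
      ; compatible = λ x x′ → ∣-respʳ-≈ (≋-sym (⊖-inverseʳ (mono m 1#))) ((x PR.- x′) ∣0)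
      ; packing = packing }
      where
      packing : ∀ h b {R : Poly → Poly → Set (c ⊔ ℓ)} → h ≤ m →
        (∀ x ys → AllPairs R ys → All (λ y → Deg< h (y PR.- x)) ys → length ys ≤ b) →
        ∀ xs → AllPairs R xs → All (λ x → Deg< (1 * h) (mono m 1#)) xs → length xs ≤ 1 * b
      packing h b l _ [] _ _ = z≤n
      packing h b l _ (x ∷ xs) _ (d ∷ _) = ⊥-elim (Domain.1≉0 domain (trans (reflexive (≡.sym (coeff-mono m 1#)))
        (d m (≤-trans (≤-reflexive (ℕ.*-identityˡ h)) l))))

    admissible : ∀ {l} → Solution l → Admissible gauge l
    admissible {l} S = record
      { bounded-terms = small S
      ; nonzero = All.map (λ _ z → Domain.1≉0 domain (trans (reflexive (≡.sym (coeff-mono m 1#))) (at z m))) (small S)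
      ; divides-power = λ pre ε x post e ne Λ _ → ⊥-elim (coincidence pre ε x post e ne) }
      where
      identically-zero : numeratorZ l B.≋ []
      identically-zero with BD.degree? (numeratorZ l)
      ... | inj₁ z       = z
      ... | inj₂ (d , h) = ⊥-elim (none (numeratorZ l) (ℕ.≤-pred (BD.HasDeg-Deg< {p = numeratorZ l} h (solution-Deg< S)))
              (record { hasDegree = h ; weight = solution-W≤ S ; vanishing = solution-Vanishing S }))
      -- The numerator vanishes identically, and its value at -x is ε times the product of the
      -- differences x′ - x; so one of them is zero.
      coincidence : ∀ pre ε x post → l ≡ pre ++ (ε , x) ∷ post → ¬ All≢ x (pre ++ post)
      coincidence pre ε x post ≡.refl ne = product≉0 (pre ++ post) ne (begin
          den                          ≈⟨ ⊛-identityˡ den ⟨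
          one ⊛ den                    ≈⟨ ⊛-congˡ den (proj₂ (All-middle pre (signs S))) ⟨
          ε ⊛ ε ⊛ den                  ≈⟨ ⊛-assoc ε ε den ⟩
          ε ⊛ (ε ⊛ den)                ≈⟨ ⊛-congʳ ε ε-den ⟩
          ε ⊛ []                       ≈⟨ ⊛-zeroʳ ε ⟩
          [] ∎)
        where
        open SR ≋-setoid
        at-x : Poly × Poly → Poly × Poly
        at-x = At.at-s (⊖ x)
        den = NR.denominator (map at-x (pre ++ post))
        num = NR.numerator (map at-x (pre ++ post))
        product≉0 : ∀ l → All≢ x l → ¬ (NR.denominator (map at-x l) ≋ [])
        product≉0 []      []        z = Domain.1≉0 polyDomain z
        product≉0 (_ ∷ l) (ne ∷ ns) z = ⊛-nonzero ne (product≉0 l ns) z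
        ε-den : ε ⊛ den ≋ []
        ε-den = begin
          ε ⊛ den                                        ≈⟨ ⊕-identityʳ (ε ⊛ den) ⟨
          ε ⊛ den ⊕ []                                   ≈⟨ ⊕-cong (≋-refl {ε ⊛ den}) (⊛-zeroˡ num (⊖-inverseʳ x)) ⟨
          ε ⊛ den ⊕ (x ⊕ (⊖ x)) ⊛ num
            ≡⟨ ≡.cong (λ l → ε ⊛ NR.denominator l ⊕ (x ⊕ (⊖ x)) ⊛ NR.numerator l) (List.map-++ at-x pre post) ⟩
          ε ⊛ NR.denominator (map at-x pre ++ map at-x post) ⊕ (x ⊕ (⊖ x)) ⊛ NR.numerator (map at-x pre ++ map at-x post)
            ≈⟨ NR.numerator-split (map at-x pre) ε (x ⊕ (⊖ x)) (map at-x post) ⟨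
          NR.numerator (map at-x pre ++ at-x (ε , x) ∷ map at-x post)
            ≡⟨ ≡.cong NR.numerator (List.map-++ at-x pre ((ε , x) ∷ post)) ⟨
          NR.numerator (map at-x (pre ++ (ε , x) ∷ post)) ≈⟨ At.ev-numerator (⊖ x) (pre ++ (ε , x) ∷ post) ⟨
          numeratorZ (pre ++ (ε , x) ∷ post) ⟨ ⊖ x ⟩      ≈⟨ At.ev-≋[] (⊖ x) identically-zero ⟩
          [] ∎

  gauge-exists : ∀ {g} {G : Set g} → (¬ ¬ G → G) →
    ((g : Gauge) → (∀ {l} → Solution l → Admissible g l) → G) → G
  gauge-exists stable use = minimal-or-none stable
    (λ f d≤D C min pf → use (FromMinimal.gauge f d≤D C min pf) (FromMinimal.admissible f d≤D C min pf))
    (λ none → use (FromNone.gauge none) (FromNone.admissible none))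

-- The divisor bound.

length-concatMap : ∀ {a b} {A : Set a} {B : Set b} (f : A → List B) {n} xs → All (λ x → length (f x) ≤ n) xs →
  length (concatMap f xs) ≤ length xs * n
length-concatMap f []       []       = z≤n
length-concatMap f (x ∷ xs) (h ∷ hs) = ≤-trans (≤-reflexive (List.length-++ (f x))) (ℕ.+-mono-≤ h (length-concatMap f xs hs))

module DivisorCovers {q c ℓ} (F : FiniteField q c ℓ) where
  open FinitePolynomials F

  -- Divisors are listed up to associates, which keeps the q - 1 units out of the count.
  record DivisorCover (p : Poly) (n : ℕ) : Set (c ⊔ ℓ) where
    field
      divisors : List Poly
      size     : length divisors ≤ n
      complete : ∀ g → g ∣ p → Any (λ g′ → g′ ∣ g × g ∣ g′) divisors
  open DivisorCover

  unit-cover : ∀ {p} → HasDeg 0 p → DivisorCover p 1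
  unit-cover {p} h = record { divisors = one ∷ [] ; size = ≤-refl
    ; complete = λ g g∣p → here ((1∣ g) , ∣-trans g∣p (HasDeg-0⇒∣one h)) }

  -- From w g = π p, the prime π divides w or g, and can then be cancelled.
  divisor-split : ∀ {π p g} → Prime π → g ∣ π ⊛ p → g ∣ p ⊎ (∃ λ g₁ → g₁ ∣ p × g ≋ π ⊛ g₁)
  divisor-split {π} {p} {g} P (w , e) with Prime.euclid P w g (∣-respʳ-≈ (≋-sym e) (x∣xy π p))
  ... | inj₁ (w₁ , e₁) = inj₁ (w₁ , ⊛-cancelˡ (Prime-nonzero P) (begin
        π ⊛ (w₁ ⊛ g)     ≈⟨ PS.solve 3 (λ π w g → π PS.:* (w PS.:* g) PS.:= w PS.:* π PS.:* g) ≋-refl π w₁ g ⟩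
        w₁ ⊛ π ⊛ g       ≈⟨ ⊛-congˡ g e₁ ⟩
        w ⊛ g            ≈⟨ e ⟩
        π ⊛ p ∎))
    where open SR ≋-setoid
  ... | inj₂ (g₁ , e₁) = inj₂ (g₁ , (w , ⊛-cancelˡ (Prime-nonzero P) (begin
        π ⊛ (w ⊛ g₁)     ≈⟨ PS.solve 3 (λ π w g → π PS.:* (w PS.:* g) PS.:= w PS.:* (g PS.:* π)) ≋-refl π w g₁ ⟩
        w ⊛ (g₁ ⊛ π)     ≈⟨ ⊛-congʳ w e₁ ⟩
        w ⊛ g            ≈⟨ e ⟩
        π ⊛ p ∎)) , ≋-trans (≋-sym e₁) (⊛-comm g₁ π))
    where open SR ≋-setoid

  associate-* : ∀ {π g g₁ g′} → g ≋ π ⊛ g₁ → g′ ∣ g₁ × g₁ ∣ g′ → π ⊛ g′ ∣ g × g ∣ π ⊛ g′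
  associate-* {π} e (h , k) = ∣-respʳ-≈ (≋-sym e) (∣-*-monoʳ π h) , ∣-respˡ-≈ (≋-sym e) (∣-*-monoʳ π k)

  Rough : ℕ → Poly → Set (c ⊔ ℓ)
  Rough s p = ∀ {π} → (P : Prime π) → π ∣ p → s ≤ suc (Prime.degree-1 P)

  -- Each prime factor uses up at least s of the degree and doubles the list of divisors.
  rough-cover : ∀ s k {n p} → n < k → HasDeg n p → Rough s p → ∃ λ ω → s * ω ≤ n × DivisorCover p (2 ℕ.^ ω)
  rough-cover s (suc k) {zero} l h r = 0 , ≤-reflexive (ℕ.*-zeroʳ s) , unit-cover h
  rough-cover s (suc k) {suc n} {p} (s≤s l) h r with primeFactor h
  ... | π , P , π∣p@(p′ , e) with cofactor-degree {d = π} {p′} (≋-trans (≋-sym e) (⊛-comm p′ π)) (Prime.hasDegree P) h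
  ...   | j , hj , ej with rough-cover s k {j} {p′} (<-≤-trans (summand-< ej) l) hj
            (λ Q h → r Q (∣-trans h (∣-respʳ-≈ e (x∣xy p′ π))))
  ...     | ω , sω , C = suc ω ,
            ≤-trans (≤-reflexive (ℕ.*-suc s ω)) (≤-trans (ℕ.+-mono-≤ (r P π∣p) sω) (≤-reflexive ej)) ,
            record { divisors = divisors C ++ map (π ⊛_) (divisors C)
              ; size = ≤-trans (≤-reflexive (≡.trans (List.length-++ (divisors C))
                  (≡.cong (length (divisors C) ℕ.+_) (≡.trans (List.length-map (π ⊛_) (divisors C)) (≡.sym (ℕ.+-identityʳ _))))))
                  (ℕ.*-monoʳ-≤ 2 (size C))
              ; complete = λ g h → [ (λ k → Any.++⁺ˡ (complete C g k))
                  , (λ (g₁ , k , eg) → Any.++⁺ʳ (divisors C) (Any.map⁺ (Any.map (associate-* {π} {g} {g₁} eg) (complete C g₁ k)))) ]′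
                  (divisor-split P (∣-respʳ-≈ (≋-trans (≋-sym e) (⊛-comm p′ π)) h)) }

  Powers : Poly → ℕ → List Poly → List Poly
  Powers π zero    ds = ds
  Powers π (suc a) ds = ds ++ map (π ⊛_) (Powers π a ds)

  power-cover : ∀ {π p n} → Prime π → (C : DivisorCover p n) → ∀ a g → g ∣ π ^ a ⊛ p →
    Any (λ g′ → g′ ∣ g × g ∣ g′) (Powers π a (divisors C))
  power-cover {π} {p} P C zero    g h = complete C g (∣-respʳ-≈ (⊛-identityˡ p) h)
  power-cover {π} {p} P C (suc a) g h with divisor-split P (∣-respʳ-≈ (⊛-assoc π (π ^ a) p) h)
  ... | inj₂ (g₁ , k , e) = Any.++⁺ʳ (divisors C) (Any.map⁺ (Any.map (associate-* {π} {g} {g₁} e) (power-cover P C a g₁ k)))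
  ... | inj₁ k = weaken a (power-cover P C a g k)
    where
    weaken : ∀ {r} {R : Poly → Set r} a → Any R (Powers π a (divisors C)) → Any R (Powers π (suc a) (divisors C))
    weaken zero    h = Any.++⁺ˡ h
    weaken (suc a) h with Any.++⁻ (divisors C) h
    ... | inj₁ k = Any.++⁺ˡ k
    ... | inj₂ k = Any.++⁺ʳ (divisors C) (Any.map⁺ (weaken a (Any.map⁻ k)))

  length-Powers : ∀ π a ds → length (Powers π a ds) ≡ suc a * length ds
  length-Powers π zero    ds = ≡.sym (ℕ.+-identityʳ (length ds))
  length-Powers π (suc a) ds = ≡.trans (List.length-++ ds) (≡.cong (length ds ℕ.+_)
    (≡.trans (List.length-map (π ⊛_) (Powers π a ds)) (length-Powers π a ds)))

  extract : ∀ {π} → Prime π → ∀ k {n p} → n < k → HasDeg n p →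
    ∃ λ a → ∃ λ p′ → ∃ λ n′ → a ≤ n × n′ ≤ n × HasDeg n′ p′ × p ≋ π ^ a ⊛ p′ × ¬ (π ∣ p′)
  extract {π} P (suc k) {n} {p} (s≤s l) h with divides? (Prime-nonzero P) p
  ... | no nd = 0 , p , n , z≤n , ≤-refl , h , ≋-sym (⊛-identityˡ p) , nd
  ... | yes (p₁ , e) with cofactor-degree {d = π} {p₁} (≋-trans (≋-sym e) (⊛-comm p₁ π)) (Prime.hasDegree P) h
  ...   | j , hj , ej with extract P k {j} {p₁} (<-≤-trans (summand-< ej) l) hj
  ...     | a , p′ , n′ , a≤j , n′≤j , h′ , e′ , nd = suc a , p′ , n′ , ≤-<-trans a≤j (summand-< ej) ,
            ≤-trans n′≤j (ℕ.<⇒≤ (summand-< ej)) , h′ ,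
            ≋-trans (≋-sym e) (≋-trans (⊛-comm p₁ π) (≋-trans (⊛-congʳ π e′) (≋-sym (⊛-assoc π (π ^ a) p′)))) , nd

  Prime-resp : ∀ {π π′} → π ≋ π′ → Prime π → Prime π′
  Prime-resp {π} e P = record { hasDegree = HasDeg-cong {p = π} e (Prime.hasDegree P)
    ; euclid = λ a b h → [ (λ k → inj₁ (∣-respˡ-≈ e k)) , (λ k → inj₂ (∣-respˡ-≈ e k)) ]′ (Prime.euclid P a b (∣-respˡ-≈ (≋-sym e) h)) }

  prime? : ∀ π → Dec (Prime π)
  prime? π with degree? π
  ... | inj₁ z = no λ P → Prime-nonzero P z
  ... | inj₂ (zero , h) = no λ P → ℕ.0≢1+n (HasDeg-unique {p = π} h (Prime.hasDegree P))
  ... | inj₂ (suc n , h) with properFactor? h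
  ...   | no none = yes (irreducible⇒prime h λ { {zero} g k hg → inj₁ ≡.refl
                                             ; {suc d} g k hg → irr g k hg (ℕ.m≤n⇒m<n∨m≡n (∣-HasDeg {d = g} {π} hg h k)) })
    where
    irr : ∀ {d} g → g ∣ π → HasDeg (suc d) g → suc d < suc n ⊎ suc d ≡ suc n → suc d ≡ 0 ⊎ suc d ≡ suc n
    irr {d} g k hg (inj₁ l) = ⊥-elim (none (d , g , hg , l , k))
    irr g k hg (inj₂ e) = inj₂ e
  ...   | yes (d , g , hg , l , (w , e)) = no λ P → [ impossible-w , impossible-g ]′ (Prime.euclid P w g (∣-respʳ-≈ (≋-sym e) ∣-refl))
    where
    impossible-g : ¬ (π ∣ g)
    impossible-g k = ℕ.<⇒≱ l (∣-HasDeg {d = π} {g} h hg k)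
    impossible-w : ¬ (π ∣ w)
    impossible-w k with cofactor-degree {d = g} {w} (≋-trans (≋-sym e) (⊛-comm w g)) hg h
    ... | j , hj , ej = ℕ.<⇒≱ (≤-trans (s≤s (ℕ.m≤n+m j d)) (≤-reflexive ej)) (∣-HasDeg {d = π} {w} h hj k)

  -- Covers of the divisors of p: a factor n + 1 for each listed prime, and 2^ω for the
  -- cofactor, which has at most n / s prime factors as they all have degree at least s.
  divisor-cover : ∀ s (Q : List Poly) {N n p} → n ≤ N → HasDeg n p →
    (∀ {π} → (P : Prime π) → π ∣ p → s ≤ suc (Prime.degree-1 P) ⊎ Any (π ≋_) Q) →
    ∃ λ ω → s * ω ≤ N × DivisorCover p (suc N ℕ.^ length Q * 2 ℕ.^ ω)
  divisor-cover s [] {N} {n} {p} l h r with rough-cover s (suc n) ≤-refl h (λ P d → [ (λ k → k) , (λ ()) ]′ (r P d))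
  ... | ω , sω , C = ω , ≤-trans sω l , record { divisors = divisors C
      ; size = ≤-trans (size C) (≤-reflexive (≡.sym (ℕ.+-identityʳ _))) ; complete = complete C }
  divisor-cover s (π ∷ Q) {N} {n} {p} l h r with prime? π
  -- The list may contain polynomials that are not prime; they are skipped at the price of a factor
  -- `suc N`.
  ... | no np with divisor-cover s Q l h (λ P d → [ inj₁ , (λ { (here e) → ⊥-elim (np (Prime-resp e P)) ; (there k) → inj₂ k }) ]′ (r P d))
  ...   | ω , sω , C = ω , sω , record { divisors = divisors C ; complete = complete C
          ; size = ≤-trans (size C) (ℕ.*-monoˡ-≤ (2 ℕ.^ ω) (ℕ.m≤n*m (suc N ℕ.^ length Q) (suc N))) }
  divisor-cover s (π ∷ Q) {N} {n} {p} l h r | yes P with extract P (suc n) ≤-refl h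
  ... | a , p′ , n′ , a≤n , n′≤n , h′ , e , nd with divisor-cover s Q (≤-trans n′≤n l) h′
          (λ P′ d → [ inj₁ , (λ { (here e) → ⊥-elim (nd (∣-respˡ-≈ e d)) ; (there k) → inj₂ k }) ]′
            (r P′ (∣-respʳ-≈ (≋-sym e) (∣-*ˡ (π ^ a) d))))
  ...   | ω , sω , C = ω , sω , record { divisors = Powers π a (divisors C)
          ; complete = λ g k → power-cover P C a g (∣-respʳ-≈ e k)
          ; size = ≤-trans (≤-reflexive (length-Powers π a (divisors C))) (≤-trans (ℕ.*-mono-≤ (s≤s (≤-trans a≤n l)) (size C))
              (≤-reflexive (≡.sym (ℕ.*-assoc (suc N) (suc N ℕ.^ length Q) (2 ℕ.^ ω))))) }

  -- Every prime has degree at least s = 1, so there are at most N of them. The resulting 2^N is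
  -- good enough once q is large.
  divisor-cover-rough : ∀ N {p} → ¬ (p ≋ []) → Deg< (suc N) p → DivisorCover p (2 ℕ.^ N)
  divisor-cover-rough N {p} nz d with nonzero-HasDeg nz
  ... | n , h with rough-cover 1 (suc n) ≤-refl h (λ _ _ → s≤s z≤n)
  ...   | ω , sω , C = record { divisors = divisors C ; complete = complete C
          ; size = ≤-trans (size C) (ℕ.^-monoʳ-≤ 2 (≤-trans (≤-trans (≤-reflexive (≡.sym (ℕ.*-identityˡ ω))) sω) (ℕ.≤-pred (HasDeg-Deg< {p = p} h d)))) }

  length-allVecs : ∀ {a} {A : Set a} (xs : List A) s → length (allVecs xs s) ≤ length xs ℕ.^ s
  length-allVecs xs zero = ≤-refl
  length-allVecs xs (suc s) = length-concatMap _ xs (All.tabulate λ {x} _ →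
    ≤-trans (≤-reflexive (List.length-map (x ∷_) (allVecs xs s))) (length-allVecs xs s))

  length-polynomials : ∀ s → length (polynomials s) ≤ q ℕ.^ s
  length-polynomials s = ≤-trans (≤-reflexive (List.length-map fromIndices (allVecs (allFin q) s)))
    (≤-trans (length-allVecs (allFin q) s) (≤-reflexive (≡.cong (ℕ._^ s) (List.length-tabulate {n = q} (λ i → i)))))

  -- All polynomials of degree below s serve as the list of small primes. Their number q^s appears
  -- in the exponent, so this is meant for bounded q.
  divisor-cover-small : ∀ s N {p} → ¬ (p ≋ []) → Deg< (suc N) p →
    ∃ λ ω → s * ω ≤ N × DivisorCover p (suc N ℕ.^ (q ℕ.^ s) * 2 ℕ.^ ω)
  divisor-cover-small s N {p} nz d with nonzero-HasDeg nz
  ... | n , h with divisor-cover s (polynomials s) (ℕ.≤-pred (HasDeg-Deg< {p = p} h d)) h listed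
    where
    listed : ∀ {π} → (P : Prime π) → π ∣ p → s ≤ suc (Prime.degree-1 P) ⊎ Any (π ≋_) (polynomials s)
    listed {π} P _ with s ℕ.≤? suc (Prime.degree-1 P)
    ... | yes k = inj₁ k
    ... | no nk = inj₂ (Any.map ≋-sym (polynomials-complete π (Deg<-mono π (ℕ.≰⇒> nk) (bounded (Prime.hasDegree P)))))
  ...   | ω , sω , C = ω , sω , record { divisors = divisors C ; complete = complete C
          ; size = ≤-trans (size C) (ℕ.*-monoˡ-≤ (2 ℕ.^ ω) (ℕ.^-monoʳ-≤ (suc N) (length-polynomials s))) }

-- Covering the solutions by reading them in both directions.

AllPairs-× : ∀ {a r p} {A : Set a} {R : A → A → Set r} {P : A → Set p} {xs} → AllPairs R xs → All P xs →
  AllPairs (λ x y → R x y × P x × P y) xs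
AllPairs-× []       []       = []
AllPairs-× (r ∷ rs) (p ∷ ps) = All.map (λ { (r , p′) → r , p , p′ }) (All.zip (r , ps)) ∷ AllPairs-× rs ps

-- This turns the degree y of f(-x) into the radius of the balls in `packing`. The cap m is the
-- radius at which a single ball contains all polynomials of degree below m.
height : ∀ d y m → ∃ λ h → h ≤ m × (y < d * h ⊎ h ≡ m) × d * ℕ.pred h ≤ y
height d y zero = 0 , z≤n , inj₂ ≡.refl , ≤-trans (≤-reflexive (ℕ.*-zeroʳ d)) z≤n
height d y (suc m) with height d y m
... | h , l , inj₁ k , low = h , ℕ.m≤n⇒m≤1+n l , inj₁ k , low
... | h , l , inj₂ ≡.refl , low with y ℕ.<? d * h
...   | yes k = h , ℕ.n≤1+n h , inj₁ k , low
...   | no nk = suc h , ≤-refl , inj₂ ≡.refl , ℕ.≮⇒≥ nk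

-- Without truncation the left side is 2 h - a - b ≤ h + 1. If b > h, the second term is zero and
-- the first at most h.
deficit-sum : ∀ {h a b m} → h ≤ m → ℕ.pred h ≤ a + b → (h ∸ a) + (h ∸ b) ≤ suc m
deficit-sum {h} {a} {b} {m} l k with b ℕ.≤? h
... | yes b≤h = ≤-trans (ℕ.+-monoˡ-≤ (h ∸ b) (ℕ.m≤n+o⇒m∸n≤o h a (≤-trans (h≤ h k) (≤-reflexive (≡.sym (ℕ.+-suc a b))))))
      (≤-trans (≤-reflexive (≡.cong suc (ℕ.m+[n∸m]≡n b≤h))) (s≤s l))
  where
  h≤ : ∀ h → ℕ.pred h ≤ a + b → h ≤ suc (a + b)
  h≤ zero    _ = z≤n
  h≤ (suc h) k = s≤s k
... | no b≰h = ≤-trans (≤-reflexive (≡.trans (≡.cong (h ∸ a ℕ.+_) (ℕ.m≤n⇒m∸n≡0 (ℕ.<⇒≤ (ℕ.≰⇒> b≰h)))) (ℕ.+-identityʳ _)))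
      (≤-trans (ℕ.m∸n≤m h a) (ℕ.m≤n⇒m≤1+n l))

module GaugeCounting {q c ℓ} (F : FiniteField q c ℓ) (D m : ℕ) (G : Gauges.Gauge F D m)
  (τ : ℕ) (covers : ∀ p → ¬ (Polynomial._≋_ (FiniteField.commRing F) p []) →
    Degree.Deg< (FinitePolynomials.domain F) (suc (D * m)) p → DivisorCovers.DivisorCover F p τ) where
  open FinitePolynomials F
  open DivisorCovers F
  open Gauges F D m
  open Gauge G
  open FiniteField F using (0#; Carrier)

  lcm! : ∀ a b → LCM a b
  lcm! a b with ≋[]? a
  ... | no na = lcm-exists a b na
  ... | yes z = record
    { lcm = [] ; x = [] ; y = one ; s = [] ; t = one ; xb = ≋-refl ; ya = ≋-trans (⊛-identityˡ a) z ; coprime = ⊛-identityˡ one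
    ; a∣lcm = a ∣0 ; b∣lcm = b ∣0 ; least = λ { w (u , e) _ → ∣-respʳ-≈ (≋-trans (≋-sym (≋-trans (⊛-congʳ u z) (⊛-zeroʳ u))) e) ([] ∣0) }
    ; ∣product = ∣-respʳ-≈ (≋-sym (⊛-zeroˡ b z)) ([] ∣0) }

  lcmList : List Poly → Poly
  lcmList []       = one
  lcmList (g ∷ gs) = LCM.lcm (lcm! g (lcmList gs))

  lcmList-least : ∀ {z} gs → All (_∣ z) gs → lcmList gs ∣ z
  lcmList-least {z} [] [] = 1∣ z
  lcmList-least {z} (g ∷ gs) (h ∷ hs) = LCM.least (lcm! g (lcmList gs)) z h (lcmList-least gs hs)

  ∣lcmList : ∀ gs → All (_∣ lcmList gs) gs
  ∣lcmList [] = []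
  ∣lcmList (g ∷ gs) = LCM.a∣lcm (lcm! g (lcmList gs)) ∷ All.map (λ h → ∣-trans h (LCM.b∣lcm (lcm! g (lcmList gs)))) (∣lcmList gs)

  lcmList-nonzero : ∀ gs → All (λ g → ¬ (g ≋ [])) gs → ¬ (lcmList gs ≋ [])
  lcmList-nonzero [] [] = HasDeg-nonzero {p = one} HasDeg-one
  lcmList-nonzero (g ∷ gs) (n ∷ ns) = ∣-nonzero (LCM.∣product (lcm! g (lcmList gs))) (⊛-nonzero n (lcmList-nonzero gs ns))

  common : Poly → Poly → Poly
  common x x′ = Bezout.gcd (bezout (value x) (x′ PR.- x))

  commons : Poly → List Poly → List Poly
  commons x = map (common x)

  degree⁰ : Poly → ℕ
  degree⁰ p = [ (λ _ → 0) , proj₁ ]′ (degree? p)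

  nonzero-degree⁰ : ∀ {p} → ¬ (p ≋ []) → HasDeg (degree⁰ p) p
  nonzero-degree⁰ {p} nz with degree? p
  ... | inj₁ z = ⊥-elim (nz z)
  ... | inj₂ (k , h) = h

  E : Poly → List Poly → ℕ
  E x xs = degree⁰ (lcmList (commons x xs))

  H : Poly → ℕ
  H x = proj₁ (height degree (degree⁰ (value x)) m)

  -- The exponent of q in the number of choices for x once `xs` and the gcds are known: x lies in
  -- few balls of radius `H x`, and its residue modulo an lcm of degree `E x xs` is fixed.
  cost : Poly → List Poly → ℕ
  cost x xs = H x ∸ E x xs

  -- The list is read from its end, so each term pays relative to the tail behind it.
  totalCost : List Poly → ℕ
  totalCost []       = 0
  totalCost (x ∷ xs) = cost x xs + totalCost xs

  value-cong : ∀ {x x′} → x ≋ x′ → value x ≋ value x′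
  value-cong {x} {x′} e with compatible x x′
  ... | w , eq = PDom.x-y≈0⇒x≈y (≋-trans (≋-sym eq) (≋-trans (⊛-congʳ w (PDom.x≈y⇒x-y≈0 e)) (⊛-zeroʳ w)))
    where module PDom = DomainProperties polyDomain

  common∣value : ∀ x x′ → common x x′ ∣ value x
  common∣value x x′ = Bezout.gcd∣a (bezout (value x) (x′ PR.- x))

  common∣difference : ∀ x x′ → common x x′ ∣ x′ PR.- x
  common∣difference x x′ = Bezout.gcd∣b (bezout (value x) (x′ PR.- x))

  -- Modulo x′ - x the values at x and x′ agree, so the gcd divides the value at x′ as well. This
  -- allows guessing it from x′ before x is known.
  common∣value′ : ∀ x x′ → common x x′ ∣ value x′
  common∣value′ x x′ = ∣-respʳ-≈ (PS.solve 2 (λ a b → (b PS.:- a) PS.:+ a PS.:= b) ≋-refl (value x) (value x′))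
    (∣-+ (∣-trans (common∣difference x x′) (compatible x′ x)) (common∣value x x′))

  lcm-commons-nonzero : ∀ {x} → ¬ (value x ≋ []) → ∀ xs → ¬ (lcmList (commons x xs) ≋ [])
  lcm-commons-nonzero {x} nz xs = lcmList-nonzero (commons x xs)
    (All.map⁺ (All.tabulate (λ {x′} _ → ∣-nonzero (common∣value x x′) nz)))

  -- Modulo δ, K is β Λ and hence K^d is β^d Λ^d.
  ^-congruence : ∀ {δ K α β Λ} → K ≋ α ⊛ δ ⊕ β ⊛ Λ → ∀ d → δ ∣ Λ ^ d → δ ∣ K ^ d
  ^-congruence {δ} {K} {α} {β} {Λ} e d h = ∣-respʳ-≈ (PS.solve 2 (λ a b → (a PS.:- b) PS.:+ b PS.:= a) ≋-refl (K ^ d) (β ^ d ⊛ Λ ^ d))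
    (∣-+ (difference d) (∣-*ˡ (β ^ d) h))
    where
    open SR ≋-setoid
    difference : ∀ d → δ ∣ K ^ d PR.- β ^ d ⊛ Λ ^ d
    difference zero = ∣-respʳ-≈ (≋-sym (≋-trans (⊕-cong (≋-refl {one}) (⊖-cong (⊛-identityˡ one))) (⊖-inverseʳ one))) (δ ∣0)
    difference (suc d) = ∣-respʳ-≈ (begin
        K ⊛ (K ^ d PR.- β ^ d ⊛ Λ ^ d) ⊕ (α ⊛ β ^ d ⊛ Λ ^ d) ⊛ δ
          ≈⟨ PS.solve 7 (λ K k b l α δ t → K PS.:* (k PS.:- b PS.:* l) PS.:+ (α PS.:* b PS.:* l) PS.:* δ
               PS.:= K PS.:* k PS.:- ((K PS.:- α PS.:* δ) PS.:* (b PS.:* l))) ≋-refl K (K ^ d) (β ^ d) (Λ ^ d) α δ one ⟩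
        K ⊛ K ^ d PR.- (K PR.- α ⊛ δ) ⊛ (β ^ d ⊛ Λ ^ d)
          ≈⟨ ⊕-cong (≋-refl {K ⊛ K ^ d}) (⊖-cong (≋-trans (⊛-congˡ (β ^ d ⊛ Λ ^ d) K-αδ)
               (PS.solve 4 (λ β Λ b l → β PS.:* Λ PS.:* (b PS.:* l) PS.:= β PS.:* b PS.:* (Λ PS.:* l)) ≋-refl β Λ (β ^ d) (Λ ^ d)))) ⟩
        K ⊛ K ^ d PR.- β ⊛ β ^ d ⊛ (Λ ⊛ Λ ^ d) ∎)
      (∣-+ (∣-*ˡ K (difference d)) (x∣yx δ (α ⊛ β ^ d ⊛ Λ ^ d)))
      where
      K-αδ : K PR.- α ⊛ δ ≋ β ⊛ Λ
      K-αδ = ≋-trans (⊕-cong e ≋-refl) (PS.solve 2 (λ a b → (a PS.:+ b) PS.:- a PS.:= b) ≋-refl (α ⊛ δ) (β ⊛ Λ))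

  -- `divides-power` speaks of the differences, while the count controls only their gcds with
  -- `value x`. A common multiple M of these gcds lies in the ideal generated by `value x` and the
  -- lcm Λ of the differences, by iteration of `lcm-combination`.
  ideal-member : ∀ x M l → All≢ x l → All (λ (ε , x′) → common x x′ ∣ M) l →
    ∃ λ Λ → AllDivide Λ x l × ∃ λ α → ∃ λ β → M ≋ α ⊛ value x ⊕ β ⊛ Λ
  ideal-member x M [] [] [] = one , [] , [] , M , ≋-sym (PR.*-identityʳ M)
  ideal-member x M ((ε , x′) ∷ l) (ne ∷ ns) (h ∷ hs) with ideal-member x M l ns hs
  ... | Λ , ds , α , β , e = LCM.lcm L , LCM.a∣lcm L ∷ All.map (λ d → ∣-trans d (LCM.b∣lcm L)) ds ,
        lcm-combination {p = Bezout.s b} {Bezout.t b} {α} {β} L (Bezout.identity b) e h ∣-refl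
    where
    L = lcm! (x′ PR.- x) Λ
    b = bezout (value x) (x′ PR.- x)

  ∣-^ : ∀ {d} a {M} → 1 ≤ d → a ∣ M → a ∣ M ^ d
  ∣-^ {suc d} a {M} _ h = ∣-*ʳ (M ^ d) h

  -- If x coincides with another term, their gcd is `value x` up to a unit. Otherwise M is congruent
  -- to a multiple of Λ modulo `value x`, and the divisibility passes from the power of Λ to that of
  -- M.
  value∣power : ∀ {l} → Admissible G l → ∀ pre ε x post → l ≡ pre ++ (ε , x) ∷ post → ∀ M →
    All (λ (ε , x′) → common x x′ ∣ M) (pre ++ post) → value x ∣ M ^ degree
  value∣power A pre ε x post e M hs with Any.any? (λ (ε , x′) → ≋[]? (x′ PR.- x)) (pre ++ post)
  ... | yes a = ∣-^ (value x) 1≤degree (coincide hs a)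
    where
    coincide : ∀ {l} → All (λ (ε , x′) → common x x′ ∣ M) l → Any (λ (ε , x′) → x′ PR.- x ≋ []) l → value x ∣ M
    coincide (h ∷ _) (here {ε , x′} z) = ∣-trans (s , ≋-sym (≋-trans identity (≋-trans (⊕-cong (≋-refl {s ⊛ value x}) (≋-trans (⊛-congʳ t z) (⊛-zeroʳ t))) (⊕-identityʳ _)))) h
      where open Bezout (bezout (value x) (x′ PR.- x))
    coincide (_ ∷ hs) (there a) = coincide hs a
  ... | no na with ideal-member x M (pre ++ post) (All.¬Any⇒All¬ _ na) hs
  ...   | Λ , ds , α , β , eq = ^-congruence {α = α} {β} eq degree
            (Admissible.divides-power A pre ε x post e (All.¬Any⇒All¬ _ na) Λ ds)

  HasDeg-^ : ∀ {e p} d → HasDeg e p → HasDeg (d * e) (p ^ d)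
  HasDeg-^ zero    h = HasDeg-one
  HasDeg-^ {p = p} (suc d) h = HasDeg-⊛ p (p ^ d) h (HasDeg-^ d h)

  terms : List (Poly × Poly) → List Poly
  terms = map proj₂

  -- The product of the two lcms is a common multiple of all the gcds, so `value x` divides its
  -- power with exponent `degree`. Comparing degrees bounds H x - 1 by the sum of the degrees of the
  -- lcms, the input of `deficit-sum`.
  cost-sum : ∀ {l} → Admissible G l → ∀ pre ε x post → l ≡ pre ++ (ε , x) ∷ post →
    cost x (List.reverse (terms pre)) + cost x (terms post) ≤ suc m
  cost-sum {l} A pre ε x post e = deficit-sum {a = degree⁰ E₁} {degree⁰ E₂} (proj₁ (proj₂ hx)) pred-bound
    where
    hx = height degree (degree⁰ (value x)) m
    nz : ¬ (value x ≋ [])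
    nz = All-middle pre (≡.subst (All _) e (Admissible.nonzero A))
    E₁ E₂ : Poly
    E₁ = lcmList (commons x (List.reverse (terms pre)))
    E₂ = lcmList (commons x (terms post))
    h₁ : HasDeg (degree⁰ E₁) E₁
    h₁ = nonzero-degree⁰ (lcm-commons-nonzero nz (List.reverse (terms pre)))
    h₂ : HasDeg (degree⁰ E₂) E₂
    h₂ = nonzero-degree⁰ (lcm-commons-nonzero nz (terms post))
    divides₁ : All (λ (ε , x′) → common x x′ ∣ E₁ ⊛ E₂) pre
    divides₁ = All.tabulate λ {t} t∈ → ∣-*ʳ E₂ (All.lookup (∣lcmList (commons x (List.reverse (terms pre))))
      (∈.∈-map⁺ (common x) (Any.reverse⁺ (∈.∈-map⁺ proj₂ t∈))))
    divides₂ : All (λ (ε , x′) → common x x′ ∣ E₁ ⊛ E₂) post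
    divides₂ = All.tabulate λ {t} t∈ → ∣-*ˡ E₁ (All.lookup (∣lcmList (commons x (terms post))) (∈.∈-map⁺ (common x) (∈.∈-map⁺ proj₂ t∈)))
    pred-bound : ℕ.pred (proj₁ hx) ≤ degree⁰ E₁ + degree⁰ E₂
    pred-bound = ℕ.*-cancelˡ-≤ degree {{ℕ.>-nonZero 1≤degree}} (≤-trans (proj₂ (proj₂ (proj₂ hx)))
      (∣-HasDeg (nonzero-degree⁰ nz) (HasDeg-^ degree (HasDeg-⊛ E₁ E₂ h₁ h₂))
        (value∣power A pre ε x post e (E₁ ⊛ E₂) (All.++⁺ divides₁ divides₂))))

  costFrom : List Poly → List Poly → ℕ
  costFrom acc []       = 0
  costFrom acc (x ∷ xs) = cost x acc + costFrom (x ∷ acc) xs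

  totalCost-ʳ++ : ∀ xs acc → totalCost (xs ʳ++ acc) ≡ costFrom acc xs + totalCost acc
  totalCost-ʳ++ []       acc = ≡.refl
  totalCost-ʳ++ (x ∷ xs) acc = ≡.trans (totalCost-ʳ++ xs (x ∷ acc))
    (solve 3 (λ c k t → k :+ (c :+ t) := c :+ k :+ t) ≡.refl (cost x acc) (costFrom (x ∷ acc) xs) (totalCost acc))
    where open NatSolver.+-*-Solver

  balance : ∀ {l} → Admissible G l → ∀ pre post → l ≡ pre ++ post →
    costFrom (List.reverse (terms pre)) (terms post) + totalCost (terms post) ≤ length post * suc m
  balance A pre [] e = z≤n
  balance A pre ((ε , x) ∷ post) e = ≤-trans (≤-reflexive
      (solve 4 (λ a b c d → (a :+ b) :+ (c :+ d) := (a :+ c) :+ (b :+ d)) ≡.refl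
        (cost x (List.reverse (terms pre))) (costFrom (x ∷ List.reverse (terms pre)) (terms post)) (cost x (terms post)) (totalCost (terms post))))
    (ℕ.+-mono-≤ (cost-sum A pre ε x post e)
      (≡.subst (λ acc → costFrom acc (terms post) + totalCost (terms post) ≤ length post * suc m) reversed
        (balance A (pre ++ (ε , x) ∷ []) post (≡.trans e (≡.sym (List.++-assoc pre _ post))))))
    where
    open NatSolver.+-*-Solver
    reversed : List.reverse (terms (pre ++ (ε , x) ∷ [])) ≡ x ∷ List.reverse (terms pre)
    reversed = ≡.trans (≡.cong List.reverse (List.map-++ proj₂ pre ((ε , x) ∷ []))) (List.reverse-++ (terms pre) (x ∷ []))

  -- By `balance` the two directions together cost at most 2 b (m + 1), so one of them stays within
  -- half of it.
  cheap-direction : ∀ {l b} → Admissible G l → length l ≡ 2 * b →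
    totalCost (terms l) ≤ b * suc m ⊎ totalCost (List.reverse (terms l)) ≤ b * suc m
  cheap-direction {l} {b} A e with totalCost (terms l) ℕ.≤? b * suc m
  ... | yes k = inj₁ k
  ... | no nk = inj₂ (ℕ.≮⇒≥ λ big → ℕ.<-irrefl ≡.refl (<-≤-trans (ℕ.+-mono-< big (ℕ.≰⇒> nk)) (≤-trans
          (≡.subst (λ c → c + totalCost (terms l) ≤ length l * suc m)
            (≡.sym (≡.trans (totalCost-ʳ++ (terms l) []) (ℕ.+-identityʳ _))) (balance A [] l ≡.refl))
          (≤-reflexive (≡.trans (≡.cong (ℕ._* suc m) e) (solve 2 (λ b m → con 2 :* b :* m := b :* m :+ b :* m) ≡.refl b (suc m)))))))
    where open NatSolver.+-*-Solver

  -- Guesses for the gcds with an unknown x: the gcd with x′ divides the known `value x′`. A zero or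
  -- too large value does not occur for valid terms, and the empty list then keeps the count
  -- bounded.
  choices : List Poly → List (List Poly)
  choices []       = [] ∷ []
  choices (x ∷ xs) with ≋[]? (value x) | Deg<? (suc (D * m)) (value x)
  ... | no nz | yes d = concatMap (λ g → map (g ∷_) (choices xs)) (DivisorCover.divisors (covers (value x) nz d))
  ... | _     | _     = []

  length-choices : ∀ xs → length (choices xs) ≤ τ ℕ.^ length xs
  length-choices []       = ≤-refl
  length-choices (x ∷ xs) with ≋[]? (value x) | Deg<? (suc (D * m)) (value x)
  ... | no nz | yes d = ≤-trans (length-concatMap (λ g → map (g ∷_) (choices xs)) (DivisorCover.divisors (covers (value x) nz d)) (All.tabulate λ {g} _ →
                          ≤-trans (≤-reflexive (List.length-map (g ∷_) (choices xs))) (length-choices xs)))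
                          (ℕ.*-monoˡ-≤ (τ ℕ.^ length xs) (DivisorCover.size (covers (value x) nz d)))
  ... | no _  | no _  = z≤n
  ... | yes _ | _     = z≤n

  Associated : Poly → Poly → Set (c ⊔ ℓ)
  Associated g g′ = g′ ∣ g × g ∣ g′

  choices-complete : ∀ {xs gs} → Pointwiseᴸ (λ x g → g ∣ value x × Deg< m x × ¬ (value x ≋ [])) xs gs →
    Any (Pointwiseᴸ Associated gs) (choices xs)
  choices-complete []ᴸ = here []ᴸ
  choices-complete {x ∷ xs} ((h , d , nz) ∷ᴸ hs) with ≋[]? (value x) | Deg<? (suc (D * m)) (value x)
  ... | yes z | _     = ⊥-elim (nz z)
  ... | no _  | no nd = ⊥-elim (nd (value-Deg< x (Deg<-mono x (ℕ.n≤1+n m) d)))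
  ... | no nz | yes d = Any.concat⁺ (Any.map⁺ (Any.map (λ a → Any.map⁺ (Any.map (a ∷ᴸ_) (choices-complete hs)))
                          (DivisorCover.complete (covers (value x) nz d) _ h)))

  Congruent : List Poly → List Poly → Poly → Set (c ⊔ ℓ)
  Congruent gs xs x = Pointwiseᴸ (λ g x′ → g ∣ x′ PR.- x) gs xs

  congruent? : ∀ gs → All (λ g → ¬ (g ≋ [])) gs → ∀ xs x → Dec (Congruent gs xs x)
  congruent? []       []       []        x = yes []ᴸ
  congruent? []       []       (_ ∷ _)   x = no λ ()
  congruent? (_ ∷ _)  (_ ∷ _)  []        x = no λ ()
  congruent? (g ∷ gs) (n ∷ ns) (x′ ∷ xs) x with divides? n (x′ PR.- x) | congruent? gs ns xs x
  ... | yes h | yes hs = yes (h ∷ᴸ hs)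
  ... | no nh | _      = no λ { (h ∷ᴸ _) → nh h }
  ... | yes _ | no nhs = no λ { (_ ∷ᴸ hs) → nhs hs }

  -- At the cut-off h = m there is no condition on the value.
  Candidate : ℕ → List Poly → List Poly → Poly → Set (c ⊔ ℓ)
  Candidate h gs xs x = (Deg< (degree * h) (value x) ⊎ h ≡ m) × Congruent gs xs x

  candidate? : ∀ h gs → All (λ g → ¬ (g ≋ [])) gs → ∀ xs x → Dec (Candidate h gs xs x)
  candidate? h gs ns xs x = (Deg<? (degree * h) (value x) ⊎-dec h ℕ.≟ m) ×-dec congruent? gs ns xs x

  Close : Poly → Poly → Poly → Set (c ⊔ ℓ)
  Close g x y = ¬ (x ≋ y) × g ∣ x PR.- y

  -- Elements of a ball agree from coefficient h on. If two agree also at the positions e to e + k -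
  -- 1, their difference is a multiple of g of degree below e, hence zero.
  ball-bound : ∀ {e g} → HasDeg e g → ∀ h k → h ≤ e + k → ∀ x ys →
    AllPairs (Close g) ys → All (λ y → Deg< h (y PR.- x)) ys → length ys ≤ q ℕ.^ k
  ball-bound {e} {g} hg h k l x ys close near = length≤codes (window e k) ys (AllPairs.map apart (AllPairs-× close near))
    where
    apart : ∀ {y y′} → Close g y y′ × Deg< h (y PR.- x) × Deg< h (y′ PR.- x) → window e k y ≢ window e k y′
    apart {y} {y′} ((ne , div) , n , n′) same = ne (DomainProperties.x-y≈0⇒x≈y polyDomain (∣-degree hg div small))
      where
      small : Deg< e (y PR.- y′)
      small i e≤i with i ℕ.<? h
      ... | yes i<h = FiniteField.trans F (coeff-sub y y′ i)
              (DomainProperties.x≈y⇒x-y≈0 domain (window-injective {e} {k} {y} {y′} same i e≤i (<-≤-trans i<h l)))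
      ... | no h≤i = Deg<-cong (PS.solve 3 (λ x y z → (y PS.:- x) PS.:- (z PS.:- x) PS.:= y PS.:- z) ≋-refl x y y′)
              (Deg<-⊕ (y PR.- x) (⊖ (y′ PR.- x)) n (Deg<-⊖ (y′ PR.- x) n′)) i (ℕ.≮⇒≥ h≤i)

  -- The second test discards guesses whose lcm has too small a degree for the cost k. It is the
  -- hypothesis of `ball-bound`, and true guesses pass it when the cost of x is at most k.
  candidatesFor : List Poly → ℕ → ℕ → List Poly → List Poly
  candidatesFor xs k h gs with All.all? (λ g → ¬? (≋[]? g)) gs | h ℕ.≤? degree⁰ (lcmList gs) + k
  ... | yes ns | yes _ = List.filter (candidate? h gs ns xs) (polynomials m)
  ... | yes _  | no _  = []
  ... | no _   | _     = []

  congruent⇒∣ : ∀ {gs xs x y} → Congruent gs xs x → Congruent gs xs y → lcmList gs ∣ x PR.- y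
  congruent⇒∣ {gs} {x = x} {y} p p′ = lcmList-least gs (go p p′)
    where
    go : ∀ {gs xs} → Congruent gs xs x → Congruent gs xs y → All (_∣ (x PR.- y)) gs
    go []ᴸ []ᴸ = []
    go {_ ∷ _} {x′ ∷ _} (h ∷ᴸ hs) (h′ ∷ᴸ hs′) = ∣-respʳ-≈
      (PS.solve 3 (λ x y z → (z PS.:- y) PS.:- (z PS.:- x) PS.:= x PS.:- y) ≋-refl x y x′) (∣-sub h′ h) ∷ go hs hs′

  length-candidatesFor : ∀ xs k h gs → h ≤ m → length (candidatesFor xs k h gs) ≤ degree * q ℕ.^ k
  length-candidatesFor xs k h gs h≤m with All.all? (λ g → ¬? (≋[]? g)) gs | h ℕ.≤? degree⁰ (lcmList gs) + k
  ... | no _   | _     = z≤n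
  ... | yes _  | no _  = z≤n
  ... | yes ns | yes l = bound (h ℕ.≟ m)
    where
    test = candidate? h gs ns xs
    ys = List.filter test (polynomials m)
    ball : ∀ x ys → AllPairs (Close (lcmList gs)) ys → All (λ y → Deg< h (y PR.- x)) ys → length ys ≤ q ℕ.^ k
    ball = ball-bound (nonzero-degree⁰ (lcmList-nonzero gs ns)) h k l
    close : AllPairs (Close (lcmList gs)) ys
    close = AllPairs.map (λ { (ne , (_ , p) , (_ , p′)) → ne , congruent⇒∣ p p′ })
      (AllPairs-× (AllPairs.filter⁺ test (polynomials-distinct m)) (All.all-filter test (polynomials m)))
    bound : Dec (h ≡ m) → length ys ≤ degree * q ℕ.^ k
    bound (no h≢m) = packing h (q ℕ.^ k) h≤m ball ys close
      (All.map (λ { (inj₁ d , _) → d ; (inj₂ e , _) → ⊥-elim (h≢m e) }) (All.all-filter test (polynomials m)))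
    -- At the cut-off h = m one ball around 0 contains everything.
    bound (yes e) = ≤-trans (ball [] ys close (≡.subst (λ h → All (λ y → Deg< h (y PR.- [])) ys) (≡.sym e)
        (All.filter⁺ test (All.map (λ {y} d → Deg<-cong (≋-sym (⊕-identityʳ y)) d) (polynomials-Deg< m)))))
      (≤-trans (≤-reflexive (≡.sym (ℕ.*-identityˡ _))) (ℕ.*-monoˡ-≤ (q ℕ.^ k) 1≤degree))

  candidates : List Poly → ℕ → List Poly
  candidates xs k = concatMap (λ h → concatMap (candidatesFor xs k h) (choices xs)) (upTo (suc m))

  length-candidates : ∀ xs k → length (candidates xs k) ≤ suc m * (τ ℕ.^ length xs * (degree * q ℕ.^ k))
  length-candidates xs k = ≤-trans (length-concatMap (λ h → concatMap (candidatesFor xs k h) (choices xs)) (upTo (suc m)) (All.tabulate λ {h} h∈ →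
      ≤-trans (length-concatMap (candidatesFor xs k h) (choices xs) (All.tabulate λ {gs} _ → length-candidatesFor xs k h gs (ℕ.≤-pred (∈.∈-upTo⁻ h∈))))
        (ℕ.*-monoˡ-≤ (degree * q ℕ.^ k) (length-choices xs))))
    (ℕ.*-monoˡ-≤ _ (≤-reflexive (List.length-upTo (suc m))))

  Valid : Poly → Set ℓ
  Valid x = Deg< m x × ¬ (value x ≋ [])

  candidatesFor-complete : ∀ {x xs xs′ gs k} → Valid x → Pointwiseᴸ _≋_ xs xs′ → H x ∸ E x xs ≤ k →
    Pointwiseᴸ Associated (commons x xs) gs → Any (_≋ x) (candidatesFor xs′ k (H x) gs)
  candidatesFor-complete {x} {xs} {xs′} {gs} {k} (dx , nz) e l as with All.all? (λ g → ¬? (≋[]? g)) gs | H x ℕ.≤? degree⁰ (lcmList gs) + k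
  ... | no n | _ = ⊥-elim (n (nonzero xs as))
    where
    nonzero : ∀ xs {gs} → Pointwiseᴸ Associated (commons x xs) gs → All (λ g → ¬ (g ≋ [])) gs
    nonzero []       []ᴸ             = []
    nonzero (x′ ∷ xs) ((d , _) ∷ᴸ as) = ∣-nonzero d (∣-nonzero (common∣value x x′) nz) ∷ nonzero xs as
  ... | yes ns | no n = ⊥-elim (n (≤-trans (≤-trans (ℕ.m≤n+m∸n (H x) (E x xs)) (ℕ.+-monoʳ-≤ (E x xs) l)) (ℕ.+-monoˡ-≤ k
          (∣-HasDeg (nonzero-degree⁰ (lcm-commons-nonzero nz xs)) (nonzero-degree⁰ (lcmList-nonzero gs ns))
            (lcmList-least (commons x xs) (below as (∣lcmList gs)))))))
    where
    below : ∀ {gs gs′ z} → Pointwiseᴸ Associated gs gs′ → All (_∣ z) gs′ → All (_∣ z) gs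
    below []ᴸ []                    = []
    below ((_ , d) ∷ᴸ as) (h ∷ hs) = ∣-trans d h ∷ below as hs
  ... | yes ns | yes _ with find (polynomials-complete x dx)
  ...   | p , p∈ , p≋x = lose (∈.∈-filter⁺ (candidate? (H x) gs ns xs′) p∈ (small , congruent e as)) p≋x
    where
    small : Deg< (degree * H x) (value p) ⊎ H x ≡ m
    small with proj₁ (proj₂ (proj₂ (height degree (degree⁰ (value x)) m)))
    ... | inj₁ l = inj₁ (Deg<-cong (value-cong (≋-sym p≋x)) (Deg<-mono (value x) l (bounded (nonzero-degree⁰ nz))))
    ... | inj₂ e = inj₂ e
    congruent : ∀ {xs xs′ gs} → Pointwiseᴸ _≋_ xs xs′ → Pointwiseᴸ Associated (commons x xs) gs → Congruent gs xs′ p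
    congruent []ᴸ []ᴸ = []ᴸ
    congruent {x′ ∷ _} (e ∷ᴸ es) ((d , _) ∷ᴸ as) = ∣-trans d
      (∣-respʳ-≈ (⊕-cong e (⊖-cong (≋-sym p≋x))) (common∣difference x x′)) ∷ᴸ congruent es as

  candidates-complete : ∀ {x xs xs′ k} → Valid x → All Valid xs → Pointwiseᴸ _≋_ xs xs′ → cost x xs ≤ k →
    Any (_≋ x) (candidates xs′ k)
  candidates-complete {x} {xs} {xs′} {k} vx vs e l = Any.concat⁺ (Any.map⁺ (Any.map choose
      (∈.∈-upTo⁺ (s≤s (proj₁ (proj₂ (height degree (degree⁰ (value x)) m)))))))
    where
    divides : ∀ {xs xs′} → All Valid xs → Pointwiseᴸ _≋_ xs xs′ → Pointwiseᴸ (λ x g → g ∣ value x × Deg< m x × ¬ (value x ≋ [])) xs′ (commons x xs)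
    divides [] []ᴸ = []ᴸ
    divides {x′ ∷ _} ((d , nz) ∷ vs) (e ∷ᴸ es) = (∣-respʳ-≈ (value-cong e) (common∣value′ x x′) , Deg<-cong e d ,
      λ z → nz (≋-trans (value-cong e) z)) ∷ᴸ divides vs es
    choose : ∀ {h} → H x ≡ h → Any (_≋ x) (concatMap (candidatesFor xs′ k h) (choices xs′))
    choose ≡.refl = Any.concat⁺ (Any.map⁺ (Any.map (candidatesFor-complete vx e l) (choices-complete (divides vs e))))

  -- b is a budget for the total cost; k is the share of the head, which is read last, and b - k
  -- remains for the tail.
  cover : ℕ → ℕ → List (List Poly)
  cover zero    b = [] ∷ []
  cover (suc r) b = concatMap (λ k → concatMap (λ xs → map (_∷ xs) (candidates xs k)) (cover r (b ∸ k))) (upTo (suc b))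

  cover-complete : ∀ b xs → All Valid xs → totalCost xs ≤ b → Any (Pointwiseᴸ _≋_ xs) (cover (length xs) b)
  cover-complete b []       []       l = here []ᴸ
  cover-complete b (x ∷ xs) (v ∷ vs) l = Any.concat⁺ (Any.map⁺ (Any.map
      (λ { {k} ≡.refl → Any.concat⁺ (Any.map⁺ (Any.map (λ e → Any.map⁺ (Any.map (λ e′ → ≋-sym e′ ∷ᴸ e) (candidates-complete v vs e ≤-refl)))
        (cover-complete (b ∸ k) xs vs (ℕ.m+n≤o⇒m≤o∸n (totalCost xs) (≤-trans (≤-reflexive (ℕ.+-comm (totalCost xs) (cost x xs))) l))))) })
      (∈.∈-upTo⁺ {i = cost x xs} (s≤s (ℕ.m+n≤o⇒m≤o (cost x xs) l)))))

  All-concatMap : ∀ {a b p r} {A : Set a} {B : Set b} {P : A → Set p} {R : B → Set r} (f : A → List B) {xs} →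
    All P xs → (∀ {x} → P x → All R (f x)) → All R (concatMap f xs)
  All-concatMap f ps h = All.concat⁺ (All.map⁺ (All.map h ps))

  cover-lengths : ∀ r b → All (λ xs → length xs ≡ r) (cover r b)
  cover-lengths zero    b = ≡.refl ∷ []
  cover-lengths (suc r) b = All-concatMap _ (All.tabulate {xs = upTo (suc b)} (λ {k} _ → k)) (λ k →
    All-concatMap _ (cover-lengths r _) (λ e → All.map⁺ (All.tabulate (λ _ → ≡.cong suc e))))

  module Size (b₀ R : ℕ) (1≤τ : 1 ≤ τ) where
    -- The loss per term: the choice of its share of the cost, of its height, of the gcds, and of
    -- one of `degree` balls.
    K : ℕ
    K = suc b₀ * (suc m * (τ ℕ.^ R * degree))

    length-cover : ∀ r b → r ≤ R → b ≤ b₀ → length (cover r b) ≤ K ℕ.^ r * q ℕ.^ b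
    length-cover zero    b _ _ = ≤-trans (ℕ.m^n>0 q {{ℕ.>-nonZero (≤-trans (s≤s z≤n) 2≤q)}} b) (≤-reflexive (≡.sym (ℕ.+-identityʳ _)))
    length-cover (suc r) b r<R b≤b₀ = ≤-trans
      (length-concatMap (λ k → concatMap (λ xs → map (_∷ xs) (candidates xs k)) (cover r (b ∸ k))) (upTo (suc b)) (All.tabulate λ {k} k∈ → step k (ℕ.≤-pred (∈.∈-upTo⁻ k∈))))
      (≤-trans (ℕ.*-monoˡ-≤ _ (≤-trans (≤-reflexive (List.length-upTo (suc b))) (s≤s b≤b₀)))
        (≤-reflexive (solve 4 (λ s κ k q → s :* (k :* κ :* q) := s :* κ :* k :* q) ≡.refl
          (suc b₀) (suc m * (τ ℕ.^ R * degree)) (K ℕ.^ r) (q ℕ.^ b))))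
      where
      open NatSolver.+-*-Solver
      r≤R : r ≤ R
      r≤R = ℕ.<⇒≤ r<R
      bound : ∀ k xs → length xs ≡ r → length (candidates xs k) ≤ suc m * (τ ℕ.^ R * (degree * q ℕ.^ k))
      bound k xs e = ≤-trans (length-candidates xs k) (ℕ.*-monoʳ-≤ (suc m) (ℕ.*-monoˡ-≤ (degree * q ℕ.^ k)
        (ℕ.^-monoʳ-≤ τ {{ℕ.>-nonZero 1≤τ}} (≤-trans (≤-reflexive e) r≤R))))
      step : ∀ k → k ≤ b → length (concatMap (λ xs → map (_∷ xs) (candidates xs k)) (cover r (b ∸ k)))
        ≤ K ℕ.^ r * (suc m * (τ ℕ.^ R * degree)) * q ℕ.^ b
      step k k≤b = ≤-trans (length-concatMap (λ xs → map (_∷ xs) (candidates xs k)) (cover r (b ∸ k)) (All.map (λ {xs} e →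
          ≤-trans (≤-reflexive (List.length-map (_∷ xs) (candidates xs k))) (bound k xs e)) (cover-lengths r (b ∸ k))))
        (≤-trans (ℕ.*-monoˡ-≤ _ (length-cover r (b ∸ k) r≤R (≤-trans (ℕ.m∸n≤m b k) b≤b₀)))
          (≤-reflexive (≡.trans
            (solve 6 (λ K p s t d q → K :* p :* (s :* (t :* (d :* q))) := K :* (s :* (t :* d)) :* (p :* q)) ≡.refl
              (K ℕ.^ r) (q ℕ.^ (b ∸ k)) (suc m) (τ ℕ.^ R) degree (q ℕ.^ k))
            (≡.cong (K ℕ.^ r * (suc m * (τ ℕ.^ R * degree)) ℕ.*_)
              (≡.trans (≡.sym (ℕ.^-distribˡ-+-* q (b ∸ k) k)) (≡.cong (q ℕ.^_) (ℕ.m∸n+n≡m k≤b)))))))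

  solutionCover : ℕ → List (List Poly)
  solutionCover k = cover (2 * k) (k * suc m) ++ map List.reverse (cover (2 * k) (k * suc m))

  solutionCover-complete : ∀ {k l} → Admissible G l → length l ≡ 2 * k → Any (Pointwiseᴸ _≋_ (terms l)) (solutionCover k)
  solutionCover-complete {k} {l} A e = [ (λ c → Any.++⁺ˡ (covered (terms l) valid size c))
    , (λ c → Any.++⁺ʳ (cover (2 * k) (k * suc m)) (Any.map⁺ (Any.map unreverse (covered (List.reverse (terms l))
        (All.tabulate (λ x∈ → All.lookup valid (Any.reverse⁻ x∈))) (≡.trans (List.length-reverse (terms l)) size) c)))) ]′
    (cheap-direction {b = k} A e)
    where
    size : length (terms l) ≡ 2 * k
    size = ≡.trans (List.length-map proj₂ l) e
    valid : All Valid (terms l)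
    valid = All.map⁺ (All.zip (Admissible.bounded-terms A , Admissible.nonzero A))
    covered : ∀ xs → All Valid xs → length xs ≡ 2 * k → totalCost xs ≤ k * suc m → Any (Pointwiseᴸ _≋_ xs) (cover (2 * k) (k * suc m))
    covered xs vs e c = ≡.subst (λ n → Any (Pointwiseᴸ _≋_ xs) (cover n (k * suc m))) e (cover-complete _ xs vs c)
    unreverse : ∀ {ys} → Pointwiseᴸ _≋_ (List.reverse (terms l)) ys → Pointwiseᴸ _≋_ (terms l) (List.reverse ys)
    unreverse {ys} p = ≡.subst (λ zs → Pointwiseᴸ _≋_ zs (List.reverse ys)) (List.reverse-involutive (terms l)) (LP.reverse⁺ p)

  length-solutionCover : ∀ k → 1 ≤ τ → length (solutionCover k) ≤
    2 * ((suc (k * suc m) * (suc m * (τ ℕ.^ (2 * k) * degree))) ℕ.^ (2 * k) * q ℕ.^ (k * suc m))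
  length-solutionCover k 1≤τ = ≤-trans (≤-reflexive (≡.trans (List.length-++ (cover (2 * k) (k * suc m)))
      (≡.cong (length (cover (2 * k) (k * suc m)) ℕ.+_) (≡.trans (List.length-map List.reverse (cover (2 * k) (k * suc m))) (≡.sym (ℕ.+-identityʳ _))))))
    (ℕ.*-monoʳ-≤ 2 (Size.length-cover (k * suc m) (2 * k) 1≤τ (2 * k) (k * suc m) ≤-refl ≤-refl))

-- Asymptotics in m, uniform in q.

open import Data.Nat using (_^_)

^-distribʳ-* : ∀ a b n → (a * b) ^ n ≡ a ^ n * b ^ n
^-distribʳ-* a b zero    = ≡.refl
^-distribʳ-* a b (suc n) = ≡.trans (≡.cong (a * b ℕ.*_) (^-distribʳ-* a b n))
  (solve 4 (λ a b x y → (a :* b) :* (x :* y) := (a :* x) :* (b :* y)) ≡.refl a b (a ^ n) (b ^ n))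
  where open NatSolver.+-*-Solver

^-reflects-≤ : ∀ {a b} n → a ^ suc n ≤ b ^ suc n → a ≤ b
^-reflects-≤ {a} {b} n l with a ℕ.≤? b
... | yes h = h
... | no nh = ⊥-elim (ℕ.<⇒≱ (ℕ.^-monoˡ-< (suc n) (ℕ.≰⇒> nh)) l)

1+n≤2^n : ∀ n → suc n ≤ 2 ^ n
1+n≤2^n zero    = ≤-refl
1+n≤2^n (suc n) = ≤-trans (ℕ.+-mono-≤ (ℕ.m^n>0 2 n) (1+n≤2^n n))
  (≤-reflexive (≡.cong (2 ^ n ℕ.+_) (≡.sym (ℕ.+-identityʳ _))))

-- Put p = 2 a and t = m / p. Then m + 1 ≤ (t + 1) p, and both c p and t + 1 are at most 2^t when m
-- ≥ c p². The a-th power of 2^t 2^t is 2^(t p) ≤ 2^m.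
polynomial≤exponential : ∀ c a → ∃ λ M → ∀ m → M ≤ m → (c * suc m) ^ a ≤ 2 ^ m
polynomial≤exponential c zero    = 0 , λ m _ → ℕ.m^n>0 2 m
polynomial≤exponential c a@(suc a′) = c * p * p , bound
  where
  open NatSolver.+-*-Solver
  p = 2 * a
  bound : ∀ m → c * p * p ≤ m → (c * suc m) ^ a ≤ 2 ^ m
  bound m l = begin
      (c * suc m) ^ a                  ≤⟨ ℕ.^-monoˡ-≤ a (ℕ.*-monoʳ-≤ c m<) ⟩
      (c * (suc t * p)) ^ a          ≡⟨ ≡.cong (ℕ._^ a) (solve 3 (λ c t p → c :* (t :* p) := (c :* p) :* t) ≡.refl c (suc t) p) ⟩
      (c * p * suc t) ^ a            ≤⟨ ℕ.^-monoˡ-≤ a (ℕ.*-mono-≤ (≤-trans cp≤t (≤-trans (ℕ.n≤1+n t) (1+n≤2^n t))) (1+n≤2^n t)) ⟩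
      (2 ^ t * 2 ^ t) ^ a          ≡⟨ ≡.cong (ℕ._^ a) (≡.sym (ℕ.^-distribˡ-+-* 2 t t)) ⟩
      (2 ^ (t + t)) ^ a              ≡⟨ ℕ.^-*-assoc 2 (t + t) a ⟩
      2 ^ ((t + t) * a)              ≡⟨ ≡.cong (2 ℕ.^_) (solve 2 (λ t a → (t :+ t) :* a := t :* (con 2 :* a)) ≡.refl t a) ⟩
      2 ^ (t * p)                      ≤⟨ ℕ.^-monoʳ-≤ 2 (ℕ.m/n*n≤m m p) ⟩
      2 ^ m ∎
    where
    open ℕ.≤-Reasoning
    t = m ℕ./ p
    m< : suc m ≤ suc t * p
    m< = ≤-trans (s≤s (≤-reflexive (ℕ.m≡m%n+[m/n]*n m p))) (ℕ.+-monoˡ-≤ (t * p) (ℕ.m%n<n m p))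
    cp≤t : c * p ≤ t
    cp≤t = ℕ.≮⇒≥ λ t<cp → ℕ.<⇒≱ (≤-trans m< (≤-trans (ℕ.*-monoˡ-≤ p t<cp) l)) ≤-refl

divisor-bound-large : ∀ {D L q} m → 2 ^ (D * L) ≤ q → (2 ^ (D * m)) ^ L ≤ q ^ m
divisor-bound-large {D} {L} {q} m l = begin
    (2 ^ (D * m)) ^ L    ≡⟨ ℕ.^-*-assoc 2 (D * m) L ⟩
    2 ^ (D * m * L)      ≡⟨ ≡.cong (2 ℕ.^_) (solve 3 (λ D m L → D :* m :* L := D :* L :* m) ≡.refl D m L) ⟩
    2 ^ (D * L * m)      ≡⟨ ≡.sym (ℕ.^-*-assoc 2 (D * L) m) ⟩
    (2 ^ (D * L)) ^ m    ≤⟨ ℕ.^-monoˡ-≤ m l ⟩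
    q ^ m ∎
  where
  open ℕ.≤-Reasoning
  open NatSolver.+-*-Solver

-- The choice s = 2 D L forces ω ≤ m / (2 L), so 2^(ω L) is at most the square root of 2^m. As q ≤
-- 2^(D L), the exponent q^s is bounded and the other factor is polynomial in m. Comparing squares
-- avoids halves.
divisor-bound-small : ∀ D L → 1 ≤ D → ∃ λ M → ∀ {q} m ω → M ≤ m → 2 ≤ q → q ≤ 2 ^ (D * L) → 2 * D * L * ω ≤ D * m →
  (suc (D * m) ^ (q ^ (2 * D * L)) * 2 ^ ω) ^ L ≤ q ^ m
divisor-bound-small D L 1≤D = proj₁ growth , bound
  where
  open NatSolver.+-*-Solver
  s = 2 * D * L
  Q = (2 ^ (D * L)) ^ s
  growth = polynomial≤exponential D (Q * (L * 2))
  bound : ∀ {q} m ω → proj₁ growth ≤ m → 2 ≤ q → q ≤ 2 ^ (D * L) → s * ω ≤ D * m →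
    (suc (D * m) ^ (q ^ s) * 2 ^ ω) ^ L ≤ q ^ m
  bound {q} m ω M≤m 2≤q q≤ sω = ≤-trans (^-reflects-≤ 1 square) (ℕ.^-monoˡ-≤ m 2≤q)
    where
    open ℕ.≤-Reasoning
    u = suc (D * m)
    u≤ : u ≤ D * suc m
    u≤ = ≤-trans (ℕ.+-monoˡ-≤ (D * m) 1≤D) (≤-reflexive (≡.sym (ℕ.*-suc D m)))
    ωL : ω * (L * 2) ≤ m
    ωL = ℕ.*-cancelˡ-≤ D {{ℕ.>-nonZero 1≤D}} (≤-trans
      (≤-reflexive (solve 3 (λ D L w → D :* (w :* (L :* con 2)) := con 2 :* D :* L :* w) ≡.refl D L ω)) sω)
    square : ((u ^ (q ^ s) * 2 ^ ω) ^ L) ^ 2 ≤ (2 ^ m) ^ 2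
    square = begin
      ((u ^ (q ^ s) * 2 ^ ω) ^ L) ^ 2      ≡⟨ ℕ.^-*-assoc (u ^ (q ^ s) * 2 ^ ω) L 2 ⟩
      (u ^ (q ^ s) * 2 ^ ω) ^ (L * 2)      ≡⟨ ^-distribʳ-* (u ^ (q ^ s)) (2 ^ ω) (L * 2) ⟩
      (u ^ (q ^ s)) ^ (L * 2) * (2 ^ ω) ^ (L * 2)
        ≡⟨ ≡.cong₂ ℕ._*_ (ℕ.^-*-assoc u (q ^ s) (L * 2)) (ℕ.^-*-assoc 2 ω (L * 2)) ⟩
      u ^ (q ^ s * (L * 2)) * 2 ^ (ω * (L * 2))
        ≤⟨ ℕ.*-mono-≤ (≤-trans (ℕ.^-monoʳ-≤ u (ℕ.*-monoˡ-≤ (L * 2) (ℕ.^-monoˡ-≤ s q≤)))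
             (≤-trans (ℕ.^-monoˡ-≤ (Q * (L * 2)) u≤) (proj₂ growth m M≤m))) (ℕ.^-monoʳ-≤ 2 ωL) ⟩
      2 ^ m * 2 ^ m                               ≡⟨ ≡.cong (2 ^ m ℕ.*_) (≡.sym (ℕ.*-identityʳ _)) ⟩
      (2 ^ m) ^ 2 ∎

-- Each of the 2k terms brings τ to the power 2k, and the J-th power of the bound is taken; the
-- factor 3 restricts the total to a third of the slack q^m.
divisorExponent : ℕ → ℕ → ℕ
divisorExponent k J = 2 * k * (2 * k * J) * 3

-- The slack q^m pays in three equal parts for the factors polynomial in m, for the divisors, and
-- for the q^(k J) by which q^(k (m + 1) J) exceeds q^(k m J). Comparing cubes avoids thirds of m.
cover-asymptotics : ∀ k J D → 1 ≤ k → 1 ≤ D → ∃ λ M → ∀ {q} m τ d → M ≤ m → 2 ≤ q → d ≤ D → τ ^ divisorExponent k J ≤ q ^ m →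
  (2 * ((suc (k * suc m) * (suc m * (τ ^ (2 * k) * d))) ^ (2 * k) * q ^ (k * suc m))) ^ J
    ≤ q ^ ((k * J + 1) * m)
cover-asymptotics k J D 1≤k 1≤D = proj₁ growth + k * J * 3 , bound
  where
  open NatSolver.+-*-Solver
  e = 2 * k * J
  c = 2 * suc k * D
  growth = polynomial≤exponential c (2 * (e * 3))
  bound : ∀ {q} m τ d → proj₁ growth + k * J * 3 ≤ m → 2 ≤ q → d ≤ D → τ ^ divisorExponent k J ≤ q ^ m →
    (2 * ((suc (k * suc m) * (suc m * (τ ^ (2 * k) * d))) ^ (2 * k) * q ^ (k * suc m))) ^ J
      ≤ q ^ ((k * J + 1) * m)
  bound {q} m τ d M≤m 2≤q d≤D hτ = begin
      (2 * (Y ^ (2 * k) * q ^ (k * suc m))) ^ J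
        ≡⟨ ≡.trans (^-distribʳ-* 2 (Y ^ (2 * k) * q ^ (k * suc m)) J)
             (≡.cong (2 ^ J ℕ.*_) (≡.trans (^-distribʳ-* (Y ^ (2 * k)) (q ^ (k * suc m)) J)
               (≡.cong₂ ℕ._*_ (ℕ.^-*-assoc Y (2 * k) J) (ℕ.^-*-assoc q (k * suc m) J)))) ⟩
      2 ^ J * (Y ^ e * q ^ (k * suc m * J))
        ≤⟨ ℕ.*-mono-≤ (ℕ.^-monoʳ-≤ 2 J≤e) (ℕ.*-monoˡ-≤ (q ^ (k * suc m * J)) (ℕ.^-monoˡ-≤ e Y≤)) ⟩
      2 ^ e * ((X * T) ^ e * q ^ (k * suc m * J))
        ≡⟨ ≡.cong (2 ^ e ℕ.*_) (≡.cong₂ ℕ._*_ (^-distribʳ-* X T e) (≡.trans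
             (≡.cong (q ℕ.^_) (solve 3 (λ k m J → k :* (con 1 :+ m) :* J := k :* J :+ k :* J :* m) ≡.refl k m J))
             (ℕ.^-distribˡ-+-* q (k * J) (k * J * m)))) ⟩
      2 ^ e * (X ^ e * T ^ e * (q ^ (k * J) * q ^ (k * J * m)))
        ≡⟨ solve 5 (λ a b c d e → a :* (b :* c :* (d :* e)) := e :* (a :* b :* c :* d)) ≡.refl
             (2 ^ e) (X ^ e) (T ^ e) (q ^ (k * J)) (q ^ (k * J * m)) ⟩
      q ^ (k * J * m) * (2 ^ e * X ^ e * T ^ e * q ^ (k * J))
        ≤⟨ ℕ.*-monoʳ-≤ (q ^ (k * J * m)) (^-reflects-≤ 2 cube) ⟩
      q ^ (k * J * m) * q ^ m    ≡⟨ ≡.sym (ℕ.^-distribˡ-+-* q (k * J * m) m) ⟩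
      q ^ (k * J * m + m)
        ≡⟨ ≡.cong (q ℕ.^_) (solve 2 (λ a m → a :* m :+ m := (a :+ con 1) :* m) ≡.refl (k * J) m) ⟩
      q ^ ((k * J + 1) * m) ∎
    where
    open ℕ.≤-Reasoning
    T = τ ^ (2 * k)
    Y = suc (k * suc m) * (suc m * (T * d))
    X = suc (k * suc m) * (suc m * D)
    instance
      q≢0 : ℕ.NonZero q
      q≢0 = ℕ.>-nonZero (≤-trans (s≤s z≤n) 2≤q)
    J≤e : J ≤ e
    J≤e = ≤-trans (≤-reflexive (≡.sym (ℕ.*-identityˡ J))) (ℕ.*-monoˡ-≤ J (≤-trans 1≤k (ℕ.m≤n*m k 2)))
    Y≤ : Y ≤ X * T
    Y≤ = ≤-trans (ℕ.*-monoʳ-≤ (suc (k * suc m)) (ℕ.*-monoʳ-≤ (suc m) (ℕ.*-monoʳ-≤ T d≤D)))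
      (≤-reflexive (solve 4 (λ a b T D → a :* (b :* (T :* D)) := a :* (b :* D) :* T) ≡.refl (suc (k * suc m)) (suc m) T D))
    2X≤ : 2 * X ≤ (c * suc m) ^ 2
    2X≤ = begin
      2 * X                                        ≤⟨ ℕ.*-monoʳ-≤ 2 (ℕ.*-monoˡ-≤ (suc m * D) (ℕ.+-monoˡ-≤ (k * suc m) (s≤s (z≤n {m})))) ⟩
      2 * (suc k * suc m * (suc m * D))      ≡⟨ solve 3 (λ k m D → con 2 :* (k :* m :* (m :* D)) := con 2 :* k :* D :* m :* m) ≡.refl (suc k) (suc m) D ⟩
      c * suc m * suc m                          ≤⟨ ℕ.*-monoʳ-≤ (c * suc m) (≤-trans (≤-reflexive (≡.sym (ℕ.*-identityˡ (suc m))))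
                                                          (ℕ.*-monoˡ-≤ (suc m) (ℕ.*-mono-≤ {1} {2 * suc k} (s≤s z≤n) 1≤D))) ⟩
      c * suc m * (c * suc m)                  ≡⟨ ≡.cong (c * suc m ℕ.*_) (≡.sym (ℕ.*-identityʳ _)) ⟩
      (c * suc m) ^ 2 ∎
    poly³ : (2 ^ e * X ^ e) ^ 3 ≤ q ^ m
    poly³ = begin
      (2 ^ e * X ^ e) ^ 3        ≡⟨ ≡.cong (ℕ._^ 3) (≡.sym (^-distribʳ-* 2 X e)) ⟩
      ((2 * X) ^ e) ^ 3            ≡⟨ ℕ.^-*-assoc (2 * X) e 3 ⟩
      (2 * X) ^ (e * 3)            ≤⟨ ℕ.^-monoˡ-≤ (e * 3) 2X≤ ⟩
      ((c * suc m) ^ 2) ^ (e * 3) ≡⟨ ℕ.^-*-assoc (c * suc m) 2 (e * 3) ⟩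
      (c * suc m) ^ (2 * (e * 3)) ≤⟨ proj₂ growth m (ℕ.m+n≤o⇒m≤o (proj₁ growth) M≤m) ⟩
      2 ^ m                            ≤⟨ ℕ.^-monoˡ-≤ m 2≤q ⟩
      q ^ m ∎
    cube : (2 ^ e * X ^ e * T ^ e * q ^ (k * J)) ^ 3 ≤ (q ^ m) ^ 3
    cube = begin
      (2 ^ e * X ^ e * T ^ e * q ^ (k * J)) ^ 3
        ≡⟨ ≡.trans (^-distribʳ-* (2 ^ e * X ^ e * T ^ e) (q ^ (k * J)) 3)
             (≡.cong (ℕ._* (q ^ (k * J)) ^ 3) (^-distribʳ-* (2 ^ e * X ^ e) (T ^ e) 3)) ⟩
      (2 ^ e * X ^ e) ^ 3 * (T ^ e) ^ 3 * (q ^ (k * J)) ^ 3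
        ≤⟨ ℕ.*-mono-≤ (ℕ.*-mono-≤ poly³
             (≤-trans (≤-reflexive (≡.trans (≡.cong (ℕ._^ 3) (ℕ.^-*-assoc τ (2 * k) e)) (ℕ.^-*-assoc τ (2 * k * e) 3))) hτ))
             (≤-trans (≤-reflexive (ℕ.^-*-assoc q (k * J) 3)) (ℕ.^-monoʳ-≤ q (ℕ.m+n≤o⇒n≤o (proj₁ growth) M≤m))) ⟩
      q ^ m * q ^ m * q ^ m
        ≡⟨ solve 1 (λ a → a :* a :* a := a :* (a :* (a :* con 1))) ≡.refl (q ^ m) ⟩
      (q ^ m) ^ 3 ∎

-- The polynomials and residues of the statement in terms of divisibility by ψ.

module CoefficientLists {q c ℓ} (F : FiniteField q c ℓ) where
  open FinitePolynomials F
  open FiniteField F using (_≈_; 0#; 1#; Carrier)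
  private
    module F = FiniteField F
    module P = Defs.Poly F

  +ₚ≡⊕ : ∀ a b → a P.+ₚ b ≡ a ⊕ b
  +ₚ≡⊕ []      b       = ≡.refl
  +ₚ≡⊕ (x ∷ a) []      = ≡.refl
  +ₚ≡⊕ (x ∷ a) (y ∷ b) = ≡.cong (x F.+ y ∷_) (+ₚ≡⊕ a b)

  *ₚ≡⊛ : ∀ a b → a P.*ₚ b ≡ a ⊛ b
  *ₚ≡⊛ []      b = ≡.refl
  *ₚ≡⊛ (x ∷ a) b = ≡.trans (+ₚ≡⊕ (x · b) (0# ∷ (a P.*ₚ b))) (≡.cong (λ z → x · b ⊕ (0# ∷ z)) (*ₚ≡⊛ a b))

  All⇒≋[] : ∀ {p} → All (_≈ 0#) p → p ≋ []
  All⇒≋[] []       = ≋-refl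
  All⇒≋[] (e ∷ es) = ∷-≋[] e (All⇒≋[] es)

  ≋[]⇒All : ∀ {p} → p ≋ [] → All (_≈ 0#) p
  ≋[]⇒All {[]}    e = []
  ≋[]⇒All {a ∷ p} e = at e 0 ∷ ≋[]⇒All (≋-tail-[] e)

  ≈ₚ⇒≋ : ∀ {a b} → a P.≈ₚ b → a ≋ b
  ≈ₚ⇒≋ {a} {b} h = DomainProperties.x-y≈0⇒x≈y polyDomain (≋-trans (PR.reflexive (≡.sym (+ₚ≡⊕ a (⊖ b)))) (All⇒≋[] h))

  ≋⇒≈ₚ : ∀ {a b} → a ≋ b → a P.≈ₚ b
  ≋⇒≈ₚ {a} {b} e = ≋[]⇒All (≋-trans (PR.reflexive (+ₚ≡⊕ a (⊖ b))) (DomainProperties.x≈y⇒x-y≈0 polyDomain e))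

  toList-Deg< : ∀ {n} (v : Vec Carrier n) → Deg< n (Vec.toList v)
  toList-Deg< []      i       l       = F.refl
  toList-Deg< (x ∷ v) (suc i) (s≤s l) = toList-Deg< v i l

  monic-HasDeg : ∀ {n} (p : Vec Carrier n) → HasDeg n (P.monic p)
  monic-HasDeg [] = HasDeg-one
  monic-HasDeg (a ∷ p) = hasDeg (λ { (suc i) (s≤s l) → bounded (monic-HasDeg p) i l }) (leading (monic-HasDeg p))

  unit-HasDeg : ∀ {n a} → P.IsUnitP a → HasDeg n a → n ≡ 0
  unit-HasDeg {n} {a} (u , nu , e) h = HasDeg-unique {p = a} h (HasDeg-cong (≋-sym (≈ₚ⇒≋ {a} {u ∷ []} e)) (hasDeg (λ { (suc i) _ → F.refl }) nu))

  monic-prime : ∀ {n} (p : Vec Carrier (suc n)) → P.Irreducible (P.monic p) → Prime (P.monic p)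
  monic-prime {n} p (_ , irr) = irreducible⇒prime (monic-HasDeg p) split
    where
    split : ∀ {d} g → g ∣ P.monic p → HasDeg d g → d ≡ 0 ⊎ d ≡ suc n
    split {d} g (w , e) hg with irr w g (≋⇒≈ₚ (≋-trans (PR.reflexive (*ₚ≡⊛ w g)) e))
    ... | inj₂ ug = inj₁ (unit-HasDeg {a = g} ug hg)
    ... | inj₁ uw with cofactor-degree {d = g} {w} (≋-trans (≋-sym e) (⊛-comm w g)) hg (monic-HasDeg p)
    ...   | k , hw , ek = inj₂ (≡.trans (≡.sym (ℕ.+-identityʳ d)) (≡.trans (≡.cong (d ℕ.+_) (≡.sym (unit-HasDeg {a = w} uw hw))) ek))

  toList-zipWith-+ : ∀ {n} (r s : Vec Carrier n) → Vec.toList (Vec.zipWith F._+_ r s) ≋ Vec.toList r ⊕ Vec.toList s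
  toList-zipWith-+ []      []      = ≋-refl
  toList-zipWith-+ (a ∷ r) (b ∷ s) = ∷-cong F.refl (toList-zipWith-+ r s)

  module Residues {n : ℕ} (p : Vec Carrier (suc n)) (irr : P.Irreducible (P.monic p)) where
    open P.Residue p
    ψ : Poly
    ψ = P.monic p
    hψ : HasDeg (suc n) ψ
    hψ = monic-HasDeg p
    ψ-prime : Prime ψ
    ψ-prime = monic-prime p irr

    zeroR-≋ : ∀ k → Vec.toList (Vec.replicate k 0#) ≋ []
    zeroR-≋ zero    = ≋-refl
    zeroR-≋ (suc k) = ∷-≋[] F.refl (zeroR-≋ k)

    subtract-multiple : ∀ {k} c x (v p : Vec Carrier k) → x ≈ c F.* 1# →
      Vec.toList v ++ x ∷ [] ≋ Vec.toList (Vec.zipWith (λ a b → a F.- (c F.* b)) v p) ⊕ c · (Vec.toList p ++ 1# ∷ [])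
    subtract-multiple c x []      []      e = ∷-cong e ≋-refl
    subtract-multiple c x (a ∷ v) (b ∷ p) e = ∷-cong
      (S.solve 2 (λ a cb → a S.:= (a S.:- cb) S.:+ cb) F.refl a (c F.* b)) (subtract-multiple c x v p e)
      where module S = RingSolver F.commRing

    -- T r has top coefficient `last r`, and `timesT` subtracts that multiple of the monic ψ.
    timesT-congruent : ∀ r → ψ ∣ (0# ∷ Vec.toList r) PR.- Vec.toList (timesT r)
    timesT-congruent r@(_ ∷ _) = const (Vec.last r) , (begin
        const (Vec.last r) ⊛ ψ    ≈⟨ const-⊛ (Vec.last r) ψ ⟩
        Vec.last r · ψ            ≈⟨ PS.solve 2 (λ t c → c PS.:= (t PS.:+ c) PS.:- t) ≋-refl (Vec.toList (timesT r)) (Vec.last r · ψ) ⟩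
        (Vec.toList (timesT r) ⊕ Vec.last r · ψ) PR.- Vec.toList (timesT r)
          ≈⟨ ⊕-cong (subtract-multiple (Vec.last r) (Vec.last r) (0# ∷ Vec.init r) p (F.sym (F.*-identityʳ _))) ≋-refl ⟨
        (0# ∷ (Vec.toList (Vec.init r) ++ Vec.last r ∷ [])) PR.- Vec.toList (timesT r)
          ≡⟨ ≡.cong (λ z → (0# ∷ z) PR.- Vec.toList (timesT r)) (≡.trans (≡.cong Vec.toList (proj₂ (proj₂ (Vec.initLast r)))) (Vec.toList-∷ʳ (Vec.last r) (Vec.init r))) ⟨
        (0# ∷ Vec.toList r) PR.- Vec.toList (timesT r) ∎)
      where open SR ≋-setoid

    reduce-congruent : ∀ a → ψ ∣ a PR.- Vec.toList (reduce a)
    reduce-congruent [] = ∣-respʳ-≈ (≋-sym (≋-trans (⊕-cong (≋-refl {[]}) (⊖-cong (zeroR-≋ (suc n)))) ≋-refl)) (ψ ∣0)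
    reduce-congruent (a ∷ as) = ∣-respʳ-≈ (begin
        X ⊛ (as PR.- r) ⊕ ((0# ∷ r) PR.- t)
          ≈⟨ ⊕-cong (≋-trans (PR.distribˡ X as (⊖ r)) (⊕-cong (X⊛ as) (≋-trans (PS.solve 2 (λ x r → x PS.:* (PS.:- r) PS.:= PS.:- (x PS.:* r)) ≋-refl X r) (⊖-cong (X⊛ r))))) ≋-refl ⟩
        ((0# ∷ as) PR.- (0# ∷ r)) ⊕ ((0# ∷ r) PR.- t)
          ≈⟨ PS.solve 4 (λ a s r t → (s PS.:- r) PS.:+ (r PS.:- t) PS.:= (a PS.:+ s) PS.:- (a PS.:+ t)) ≋-refl (const a) (0# ∷ as) (0# ∷ r) t ⟩
        (const a ⊕ (0# ∷ as)) PR.- (const a ⊕ t)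
          ≈⟨ ⊕-cong (∷-cong (F.+-identityʳ a) ≋-refl) (⊖-cong (addConst-≋ (timesT (reduce as)))) ⟩
        (a ∷ as) PR.- Vec.toList (reduce (a ∷ as)) ∎)
      (∣-+ (∣-*ˡ X (reduce-congruent as)) (timesT-congruent (reduce as)))
      where
      open SR ≋-setoid
      X r t : Poly
      X = 0# ∷ 1# ∷ []
      r = Vec.toList (reduce as)
      t = Vec.toList (timesT (reduce as))
      X⊛ : ∀ p → X ⊛ p ≋ 0# ∷ p
      X⊛ p = ≋-trans (shift-⊛ one p) (∷-cong F.refl (⊛-identityˡ p))
      addConst-≋ : ∀ (v : Vec Carrier (suc n)) → const a ⊕ Vec.toList v ≋ Vec.toList (addConst a v)
      addConst-≋ (x ∷ v) = ≋-refl

    eqVec?-sound : ∀ {k} (v w : Vec Carrier k) → eqVec? v w ≡ true → Vec.toList v ≋ Vec.toList w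
    eqVec?-sound []      []      e = ≋-refl
    eqVec?-sound (a ∷ v) (b ∷ w) e with a F.≟ b
    ... | yes h = ∷-cong h (eqVec?-sound v w e)

    eqVec?-complete : ∀ {k} (v w : Vec Carrier k) → Vec.toList v ≋ Vec.toList w → eqVec? v w ≡ true
    eqVec?-complete []      []      e = ≡.refl
    eqVec?-complete (a ∷ v) (b ∷ w) e with a F.≟ b
    ... | yes h = eqVec?-complete v w (≋-tail e)
    ... | no nh = ⊥-elim (nh (at e 0))

    reduce-cong : ∀ a b → ψ ∣ a PR.- b → Vec.toList (reduce a) ≋ Vec.toList (reduce b)
    reduce-cong a b h = DomainProperties.x-y≈0⇒x≈y polyDomain (∣-degree hψ
      (∣-respʳ-≈ (PS.solve 4 (λ a b r s → ((a PS.:- b) PS.:- (a PS.:- r)) PS.:+ (b PS.:- s) PS.:= r PS.:- s) ≋-refl a b (Vec.toList (reduce a)) (Vec.toList (reduce b)))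
        (∣-+ (∣-sub h (reduce-congruent a)) (reduce-congruent b)))
      (Deg<-⊕ (Vec.toList (reduce a)) (⊖ Vec.toList (reduce b)) (toList-Deg< (reduce a)) (Deg<-⊖ (Vec.toList (reduce b)) (toList-Deg< (reduce b)))))

    reduce-reflects : ∀ a b → Vec.toList (reduce a) ≋ Vec.toList (reduce b) → ψ ∣ a PR.- b
    reduce-reflects a b e = ∣-respʳ-≈
      (≋-trans (⊕-cong ≋-refl (⊖-cong (⊕-cong (≋-refl {b}) (⊖-cong (≋-sym e)))))
        (PS.solve 3 (λ a b r → (a PS.:- r) PS.:- (b PS.:- r) PS.:= a PS.:- b) ≋-refl a b (Vec.toList (reduce a))))
      (∣-sub (reduce-congruent a) (reduce-congruent b))

    nonzero⇒∤ : ∀ a → isZeroR (reduce a) ≡ false → ¬ (ψ ∣ a)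
    nonzero⇒∤ a nz h = false≢true (≡.trans (≡.sym nz)
      (eqVec?-complete (reduce a) zeroR (reduce-cong a [] (∣-respʳ-≈ (≋-sym (⊕-identityʳ a)) h))))
      where
      false≢true : false ≢ true
      false≢true ()

    findInv-correct : ∀ r ss → Any (λ s → ((r *ᵣ s) ≈ᵣ? oneR) ≡ true) ss → ((r *ᵣ findInv r ss) ≈ᵣ? oneR) ≡ true
    findInv-correct r (s ∷ ss) a with (r *ᵣ s) ≈ᵣ? oneR in e
    ... | true = e
    findInv-correct r (s ∷ ss) (here h)  | false with ≡.trans (≡.sym e) h
    ... | ()
    findInv-correct r (s ∷ ss) (there a) | false = findInv-correct r ss a

    ∤⇒invertible : ∀ a → ¬ (ψ ∣ a) → ∃ λ b → ψ ∣ a ⊛ b PR.- one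
    ∤⇒invertible a na with nonzero-HasDeg (∣-nonzero (Bezout.gcd∣a (bezout ψ a)) (Prime-nonzero ψ-prime))
    ... | zero , h with HasDeg-0⇒∣one h
    ...   | i , ei = i ⊛ t , ∣-respʳ-≈ (begin
            ⊖ (i ⊛ s ⊛ ψ)               ≈⟨ PS.solve 5 (λ a i t s ψ → PS.:- (i PS.:* s PS.:* ψ) PS.:= a PS.:* (i PS.:* t) PS.:- i PS.:* (s PS.:* ψ PS.:+ t PS.:* a)) ≋-refl a i t s ψ ⟩
            a ⊛ (i ⊛ t) PR.- i ⊛ (s ⊛ ψ ⊕ t ⊛ a) ≈⟨ ⊕-cong (≋-refl {a ⊛ (i ⊛ t)}) (⊖-cong (≋-trans (⊛-congʳ i (≋-sym identity)) ei)) ⟩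
            a ⊛ (i ⊛ t) PR.- one ∎) (∣-neg (∣-*ˡ (i ⊛ s) ∣-refl))
      where
      open SR ≋-setoid
      open Bezout (bezout ψ a)
    ∤⇒invertible a na | suc d , h = ⊥-elim (na (∣-trans ψ∣g (Bezout.gcd∣b (bezout ψ a))))
      where
      g = Bezout.gcd (bezout ψ a)
      ψ∣g : ψ ∣ g
      ψ∣g with Bezout.gcd∣a (bezout ψ a)
      ... | w , e with Prime.euclid ψ-prime w g (∣-respʳ-≈ (≋-sym e) ∣-refl)
      ...   | inj₂ k = k
      ...   | inj₁ k with cofactor-degree {d = g} {w} (≋-trans (≋-sym e) (⊛-comm w g)) h hψ
      ...     | j , hj , ej = ⊥-elim (ℕ.<⇒≱ (≤-trans (s≤s (ℕ.m≤n+m j d)) (≤-reflexive ej)) (∣-HasDeg {d = ψ} {w} hψ hj k))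

    -- `findInv` returns the first residue passing its test, so it suffices that some enumerated
    -- residue passes. Bézout supplies an inverse, whose reduction is enumerated up to `_≋_`.
    inv-correct : ∀ a → ¬ (ψ ∣ a) → ψ ∣ a ⊛ Vec.toList (inv (reduce a)) PR.- one
    inv-correct a na = ∣-respʳ-≈ (PS.solve 4 (λ a r i o → (a PS.:- r) PS.:* i PS.:+ (r PS.:* i PS.:- o) PS.:= a PS.:* i PS.:- o) ≋-refl a r (Vec.toList (inv (reduce a))) one)
      (∣-+ (∣-*ʳ (Vec.toList (inv (reduce a))) (reduce-congruent a))
        (∣-respʳ-≈ (⊕-cong (PR.reflexive (*ₚ≡⊛ r (Vec.toList (inv (reduce a))))) ≋-refl)
          (reduce-reflects (r P.*ₚ Vec.toList (inv (reduce a))) one (eqVec?-sound (reduce (r P.*ₚ Vec.toList (inv (reduce a)))) oneR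
            (findInv-correct (reduce a) allRes (Any.map⁺ (Any.map (λ { ≡.refl → found }) (∈-allVecs ∈.∈-allFin (indices (suc n) s)))))))))
      where
      r s : Poly
      r = Vec.toList (reduce a)
      s = Vec.toList (reduce (proj₁ (∤⇒invertible a na)))
      found : ((reduce a *ᵣ Vec.map F.enum (indices (suc n) s)) ≈ᵣ? oneR) ≡ true
      found = eqVec?-complete (reduce a *ᵣ Vec.map F.enum (indices (suc n) s)) oneR
        (reduce-cong (r P.*ₚ s′) one (∣-respʳ-≈ (⊕-cong (PR.reflexive (≡.sym (*ₚ≡⊛ r s′))) ≋-refl) product))
        where
        s′ b : Poly
        s′ = fromIndices (indices (suc n) s)
        b = proj₁ (∤⇒invertible a na)
        s′≋s : s′ ≋ s
        s′≋s = fromIndices-indices (suc n) s (toList-Deg< (reduce b))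
        product : ψ ∣ r ⊛ s′ PR.- one
        product = ∣-respʳ-≈ (≋-trans
            (PS.solve 5 (λ a b r s o → ((a PS.:* b PS.:- o) PS.:- b PS.:* (a PS.:- r)) PS.:- r PS.:* (b PS.:- s) PS.:= r PS.:* s PS.:- o) ≋-refl a b r s one)
            (⊕-cong (⊛-congʳ r (≋-sym s′≋s)) ≋-refl))
          (∣-sub (∣-sub (proj₂ (∤⇒invertible a na)) (∣-*ˡ b (reduce-congruent a))) (∣-*ˡ r (reduce-congruent b)))

-- From the counting function to lists of signed terms.

module CountSolutions {q c ℓ} (F : FiniteField q c ℓ) (k : ℕ) (γ : List (FiniteField.Carrier F)) (m : ℕ) {n : ℕ}
  (p : Vec (FiniteField.Carrier F) (suc n)) (irr : Defs.Poly.Irreducible F (Defs.Poly.monic F p)) where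
  open FinitePolynomials F
  open CoefficientLists F
  open Residues p irr
  open FiniteField F using (Carrier)
  private module P = Defs.Poly F
  open P.Residue p

  -- This and the next two definitions repeat the local ones of `Count.N`, so that the count unfolds
  -- to the length of the list filtered in `N≤cover`.
  shifted : Poly → Res
  shifted x = reduce (x P.+ₚ γ)

  nonzeroAll : ∀ {j} → Vec Poly j → Bool
  nonzeroAll = Vec.foldr _ (λ x b → not (isZeroR (shifted x)) ∧ b) true

  goodB : Vec Poly k → Vec Poly k → Bool
  goodB xs ys = nonzeroAll xs ∧ nonzeroAll ys ∧ (sumR (Vec.map (inv ∘ shifted) xs) ≈ᵣ? sumR (Vec.map (inv ∘ shifted) ys))

  signed : Vec Poly k → Vec Poly k → List (Poly × Poly)
  signed xs ys = map (one ,_) (Vec.toList xs) ++ map ((⊖ one) ,_) (Vec.toList ys)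

  nonzeroAll⇒∤ : ∀ {j} (xs : Vec Poly j) → nonzeroAll xs ≡ true → All (λ x → ¬ (ψ ∣ x ⊕ γ)) (Vec.toList xs)
  nonzeroAll⇒∤ []       e = []
  nonzeroAll⇒∤ (x ∷ xs) e = nonzero⇒∤ (x ⊕ γ) (≡.subst (λ a → isZeroR (reduce a) ≡ false) (+ₚ≡⊕ x γ)
      (Bool.not-injective (Bool.∧-conicalˡ _ _ e))) ∷ nonzeroAll⇒∤ xs (Bool.∧-conicalʳ (not (isZeroR (shifted x))) _ e)

  withInverse : Poly × Poly → Poly × Poly × Poly
  withInverse (ε , x) = ε , x ⊕ γ , Vec.toList (inv (shifted x))

  inverses : ∀ l → All (λ (ε , x) → ¬ (ψ ∣ x ⊕ γ)) l → All (λ (ε , s , t) → ψ ∣ s ⊛ t PR.- one) (map withInverse l)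
  inverses l h = All.map⁺ (All.map (λ {(ε , x)} nx → ≡.subst (λ a → ψ ∣ (x ⊕ γ) ⊛ Vec.toList (inv (reduce a)) PR.- one) (≡.sym (+ₚ≡⊕ x γ)) (inv-correct (x ⊕ γ) nx)) h)

  signedSum-++ : ∀ l l′ → NR.signedSum (l ++ l′) ≋ NR.signedSum l ⊕ NR.signedSum l′
  signedSum-++ []                l′ = ≋-refl
  signedSum-++ ((ε , s , t) ∷ l) l′ = ≋-trans (⊕-cong (≋-refl {ε ⊛ t}) (signedSum-++ l l′)) (≋-sym (⊕-assoc (ε ⊛ t) _ _))

  signedSum-constant : ∀ ε {j} (xs : Vec Poly j) → NR.signedSum (map withInverse (map (ε ,_) (Vec.toList xs)))
    ≋ ε ⊛ Vec.toList (sumR (Vec.map (inv ∘ shifted) xs))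
  signedSum-constant ε []       = ≋-sym (≋-trans (⊛-congʳ ε (zeroR-≋ (suc n))) (⊛-zeroʳ ε))
  signedSum-constant ε (x ∷ xs) = ≋-trans (⊕-cong (≋-refl {ε ⊛ Vec.toList (inv (shifted x))}) (signedSum-constant ε xs))
    (≋-trans (≋-sym (PR.distribˡ ε (Vec.toList (inv (shifted x))) (Vec.toList (sumR (Vec.map (inv ∘ shifted) xs)))))
      (⊛-congʳ ε (≋-sym (toList-zipWith-+ (inv (shifted x)) (sumR (Vec.map (inv ∘ shifted) xs))))))

  -- Modulo ψ the numerator is the denominator times the signed sum of the inverses, and the
  -- congruence makes this sum zero.
  good⇒vanishes : ∀ xs ys → goodB xs ys ≡ true → ψ ∣ NR.numerator (map (At.at-s γ) (signed xs ys))
  good⇒vanishes xs ys e = ≡.subst (λ l → ψ ∣ NR.numerator l) (≡.sym (List.map-∘ l))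
    (∣-respʳ-≈ (≋-trans (⊕-cong (≋-refl {NR.numerator l′}) (⊖-cong (≋-trans (⊛-congʳ (NR.denominator l′) sum≋[]) (⊛-zeroʳ (NR.denominator l′))))) (⊕-identityʳ _))
      (NR.numerator≡denominator*sum (map withInverse l) (inverses l units)))
    where
    l = signed xs ys
    l′ = map NR.forgetInverse (map withInverse l)
    rest : nonzeroAll ys ∧ (sumR (Vec.map (inv ∘ shifted) xs) ≈ᵣ? sumR (Vec.map (inv ∘ shifted) ys)) ≡ true
    rest = Bool.∧-conicalʳ (nonzeroAll xs) _ e
    units : All (λ (ε , x) → ¬ (ψ ∣ x ⊕ γ)) l
    units = All.++⁺ (All.map⁺ (nonzeroAll⇒∤ xs (Bool.∧-conicalˡ _ _ e))) (All.map⁺ (nonzeroAll⇒∤ ys (Bool.∧-conicalˡ _ _ rest)))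
    A B′ : Poly
    A = Vec.toList (sumR (Vec.map (inv ∘ shifted) xs))
    B′ = Vec.toList (sumR (Vec.map (inv ∘ shifted) ys))
    A≋B : A ≋ B′
    A≋B = eqVec?-sound (sumR (Vec.map (inv ∘ shifted) xs)) (sumR (Vec.map (inv ∘ shifted) ys)) (Bool.∧-conicalʳ (nonzeroAll ys) _ rest)
    sum≋[] : NR.signedSum (map withInverse l) ≋ []
    sum≋[] = begin
      NR.signedSum (map withInverse l)
        ≡⟨ ≡.cong NR.signedSum (List.map-++ withInverse (map (one ,_) (Vec.toList xs)) _) ⟩
      NR.signedSum (map withInverse (map (one ,_) (Vec.toList xs)) ++ map withInverse (map ((⊖ one) ,_) (Vec.toList ys)))
        ≈⟨ signedSum-++ (map withInverse (map (one ,_) (Vec.toList xs))) _ ⟩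
      NR.signedSum (map withInverse (map (one ,_) (Vec.toList xs))) ⊕ NR.signedSum (map withInverse (map ((⊖ one) ,_) (Vec.toList ys)))
        ≈⟨ ⊕-cong (signedSum-constant one xs) (signedSum-constant (⊖ one) ys) ⟩
      one ⊛ A ⊕ (⊖ one) ⊛ B′
        ≈⟨ ⊕-cong (⊛-congʳ one A≋B) ≋-refl ⟩
      one ⊛ B′ ⊕ (⊖ one) ⊛ B′
        ≈⟨ PS.solve 2 (λ o b → o PS.:* b PS.:+ (PS.:- o) PS.:* b PS.:= PS.con (0 , 0)) ≋-refl one B′ ⟩
      [] ∎
      where open SR ≋-setoid

  tuples : List (Vec Poly k × Vec Poly k)
  tuples = cartesian (allVecs (polynomials m) k) (allVecs (polynomials m) k)

  Same : Vec Poly k × Vec Poly k → Vec Poly k × Vec Poly k → Set (c ⊔ ℓ)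
  Same (xs , ys) (xs′ , ys′) = Pointwise _≋_ xs xs′ × Pointwise _≋_ ys ys′

  tuples-distinct : AllPairs (λ t t′ → ¬ Same t t′) tuples
  tuples-distinct = concatMap-AllPairs (λ xs → map (xs ,_) vecs) distinct
    (λ xs → AllPairs.map⁺ (AllPairs.map (λ ne (_ , e) → ne e) distinct))
    (λ {xs} {xs′} ne u∈ v∈ → differ ne (∈.∈-map⁻ (xs ,_) u∈) (∈.∈-map⁻ (xs′ ,_) v∈))
    where
    vecs = allVecs (polynomials m) k
    distinct : AllPairs (λ v w → ¬ Pointwise _≋_ v w) vecs
    distinct = allVecs-AllPairs (polynomials-distinct m) k
    differ : ∀ {xs xs′ u v} → ¬ Pointwise _≋_ xs xs′ → (∃ λ ys → ys ∈ vecs × u ≡ (xs , ys)) → (∃ λ ys → ys ∈ vecs × v ≡ (xs′ , ys)) → ¬ Same u v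
    differ ne (_ , _ , ≡.refl) (_ , _ , ≡.refl) (e , _) = ne e

  Small : Vec Poly k × Vec Poly k → Set (c ⊔ ℓ)
  Small (xs , ys) = All (Deg< m) (Vec.toList xs) × All (Deg< m) (Vec.toList ys)

  tuples-small : All Small tuples
  tuples-small = All.concat⁺ (All.map⁺ (All.map (λ dx → All.map⁺ (All.map (dx ,_) small)) small))
    where
    small : All (λ v → All (Deg< m) (Vec.toList v)) (allVecs (polynomials m) k)
    small = All.tabulate (All-allVecs (polynomials-Deg< m) k)

  terms : Vec Poly k × Vec Poly k → List Poly
  terms (xs , ys) = map proj₂ (signed xs ys)

  -- The signs are dropped, but the common length k shows where `xs` ends.
  terms-injective : ∀ t t′ c → Pointwiseᴸ _≋_ (terms t) c → Pointwiseᴸ _≋_ (terms t′) c → Same t t′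
  terms-injective (xs , ys) (xs′ , ys′) _ h h′ = first xs xs′ _ h h′
    where
    second : ∀ {j} (ys ys′ : Vec Poly j) c → Pointwiseᴸ _≋_ (map proj₂ (map ((⊖ one) ,_) (Vec.toList ys))) c →
      Pointwiseᴸ _≋_ (map proj₂ (map ((⊖ one) ,_) (Vec.toList ys′))) c → Pointwise _≋_ ys ys′
    second []       []         _ []ᴸ       []ᴸ         = []
    second (y ∷ ys) (y′ ∷ ys′) _ (e ∷ᴸ es) (e′ ∷ᴸ es′) = ≋-trans e (≋-sym e′) ∷ second ys ys′ _ es es′
    first : ∀ {j} (xs xs′ : Vec Poly j) c → Pointwiseᴸ _≋_ (map proj₂ (map (one ,_) (Vec.toList xs) ++ map ((⊖ one) ,_) (Vec.toList ys))) c →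
      Pointwiseᴸ _≋_ (map proj₂ (map (one ,_) (Vec.toList xs′) ++ map ((⊖ one) ,_) (Vec.toList ys′))) c → Pointwise _≋_ xs xs′ × Pointwise _≋_ ys ys′
    first []       []         c h         h′          = [] , second ys ys′ c h h′
    first (x ∷ xs) (x′ ∷ xs′) _ (e ∷ᴸ es) (e′ ∷ᴸ es′) = let a , b = first xs xs′ _ es es′ in ≋-trans e (≋-sym e′) ∷ a , b

  N≤cover : (cover : List (List Poly)) →
    (∀ xs ys → Small (xs , ys) → goodB xs ys ≡ true → Any (Pointwiseᴸ _≋_ (terms (xs , ys))) cover) →
    Count.N F k γ m p ≤ length cover
  N≤cover cover h = length≤cover (λ t c → Pointwiseᴸ _≋_ (terms t) c) (List.filter good? tuples) cover
    (All.map (λ { {(xs , ys)} (s , g) → h xs ys s g }) (All.zip (All.filter⁺ good? tuples-small , All.all-filter good? tuples)))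
    (AllPairs.filter⁺ good? (AllPairs.map (λ {t} {t′} ne c e e′ → ne (terms-injective t t′ c e e′)) tuples-distinct))
    where
    good? : ∀ t → Dec (goodB (proj₁ t) (proj₂ t) ≡ true)
    good? t = goodB (proj₁ t) (proj₂ t) Bool.≟ true

  module _ (D′ : ℕ) (2k : 2 * k ≡ suc (suc D′)) (D²m<n : suc D′ * suc D′ * m < suc n) where
    open SolutionGauge F ψ γ hψ ψ-prime D′ m D²m<n

    signed-length : ∀ xs ys → length (signed xs ys) ≡ 2 * k
    signed-length xs ys = ≡.trans (List.length-++ (map (one ,_) (Vec.toList xs))) (≡.trans
      (≡.cong₂ ℕ._+_ (≡.trans (List.length-map (one ,_) (Vec.toList xs)) (Vec.length-toList xs))
        (≡.trans (List.length-map ((⊖ one) ,_) (Vec.toList ys)) (Vec.length-toList ys)))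
      (≡.cong (k ℕ.+_) (≡.sym (ℕ.+-identityʳ k))))

    good⇒solution : ∀ xs ys → Small (xs , ys) → goodB xs ys ≡ true → Solution (signed xs ys)
    good⇒solution xs ys (dx , dy) e = record
      { size = ≡.trans (signed-length xs ys) 2k
      ; small = All.++⁺ (All.map⁺ dx) (All.map⁺ dy)
      ; signs = All.++⁺ (All.map⁺ (All.map (λ _ → bounded HasDeg-one , ⊛-identityˡ one) dx))
                        (All.map⁺ (All.map (λ _ → Deg<-⊖ one (bounded HasDeg-one) ,
                          ≋-trans (PS.solve 1 (λ o → (PS.:- o) PS.:* (PS.:- o) PS.:= o PS.:* o) ≋-refl one) (⊛-identityˡ one)) dy))
      ; invertible = All.++⁺ (All.map⁺ (nonzeroAll⇒∤ xs (Bool.∧-conicalˡ _ _ e)))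
                             (All.map⁺ (nonzeroAll⇒∤ ys (Bool.∧-conicalˡ _ _ (Bool.∧-conicalʳ (nonzeroAll xs) _ e))))
      ; vanishes = good⇒vanishes xs ys e }

    -- A continuation is used because the gauge, and with it the degree d, is available only on the
    -- way to a stable goal.
    N-bound : ∀ {g} {G : Set g} → (¬ ¬ G → G) → ∀ τ → 1 ≤ τ →
      (∀ p → ¬ (p ≋ []) → Deg< (suc (suc D′ * m)) p → DivisorCovers.DivisorCover F p τ) →
      (∀ d → d ≤ suc D′ → Count.N F k γ m p ≤
        2 * ((suc (k * suc m) * (suc m * (τ ℕ.^ (2 * k) * d))) ℕ.^ (2 * k) * q ℕ.^ (k * suc m)) → G) → G
    N-bound stable τ 1≤τ covers use = gauge-exists stable λ gauge admissible →
      let open GaugeCounting F (suc D′) m gauge τ covers in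
      use (Gauges.Gauge.degree gauge) (Gauges.Gauge.degree≤D gauge)
        (≤-trans (N≤cover (solutionCover k) (λ xs ys s e → solutionCover-complete {k} (admissible (good⇒solution xs ys s e)) (signed-length xs ys)))
          (length-solutionCover k 1≤τ))


-- The constant 4k² - 2k and the case distinction on q.

threshold : ∀ k′ → suc (2 * k′) * suc (2 * k′) ≤ 4 * suc k′ * suc k′ ∸ 2 * suc k′
-- For k = k′ + 1 the identity behind it is 4k² = (2k - 1)² + 2k + (2k - 1).
threshold k′ = ℕ.m+n≤o⇒m≤o∸n (suc (2 * k′) * suc (2 * k′)) (≤-trans (ℕ.m≤m+n _ (suc (2 * k′)))
  (≤-reflexive (solve 1 (λ k → (con 1 :+ con 2 :* k) :* (con 1 :+ con 2 :* k) :+ con 2 :* (con 1 :+ k) :+ (con 1 :+ con 2 :* k)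
    := con 4 :* (con 1 :+ k) :* (con 1 :+ k)) ≡.refl k′)))
  where open NatSolver.+-*-Solver

-- The o(1) is quantified by `j`: taking (j + 1)-th roots gives the exponent (k + 1/(j + 1)) m, and
-- M depends on k and j alone.
theorem1p1 : (k : ℕ) → 1 ≤ k → (j : ℕ) →
    Σ ℕ λ M →
    (q : ℕ) (F : FiniteField q 0ℓ 0ℓ) (n : ℕ) → 1 ≤ n →
    (p : Vec (FiniteField.Carrier F) n) → Poly.Irreducible F (Poly.monic F p) →
    (γ : Poly.Pol F) (m : ℕ) → 1 ≤ m → M ≤ m →
    m * (4 * k * k ∸ 2 * k) < n →
    Count.N F k γ m p ^ suc j ≤ q ^ ((k * suc j + 1) * m)
theorem1p1 (suc k′) 1≤k j = proj₁ divisor-growth + proj₁ cover-growth , bound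
  where
  k = suc k′
  J = suc j
  D′ = 2 * k′
  D = suc D′
  L = divisorExponent k J
  s = 2 * D * L
  divisor-growth = divisor-bound-small D L (s≤s z≤n)
  cover-growth = cover-asymptotics k J D 1≤k (s≤s z≤n)
  bound : (q : ℕ) (F : FiniteField q 0ℓ 0ℓ) (n : ℕ) → 1 ≤ n →
    (p : Vec (FiniteField.Carrier F) n) → Poly.Irreducible F (Poly.monic F p) →
    (γ : Poly.Pol F) (m : ℕ) → 1 ≤ m → proj₁ divisor-growth + proj₁ cover-growth ≤ m →
    m * (4 * k * k ∸ 2 * k) < n →
    Count.N F k γ m p ^ suc j ≤ q ^ ((k * suc j + 1) * m)
  -- Above 2^(D L) the q-power slack absorbs even 2^(D m) divisors; below it, q^s is bounded in
  -- terms of k and j.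
  bound q F (suc n) _ p irr γ m _ M≤m h = [ large , small ]′ (ℕ.≤-total (2 ^ (D * L)) q)
    where
    open FinitePolynomials F using (2≤q; _≋_; Deg<)
    open DivisorCovers F
    open CountSolutions F k γ m p irr
    D²m<n : D * D * m < suc n
    D²m<n = ≤-<-trans (≤-trans (ℕ.*-monoˡ-≤ m (threshold k′)) (≤-reflexive (ℕ.*-comm (4 * k * k ∸ 2 * k) m))) h
    Goal : Set
    Goal = Count.N F k γ m p ^ suc j ≤ q ^ ((k * suc j + 1) * m)
    conclude : ∀ τ → 1 ≤ τ → (∀ p → ¬ (p ≋ []) → Deg< (suc (D * m)) p → DivisorCover p τ) → τ ^ L ≤ q ^ m → Goal
    conclude τ 1≤τ covers τ^L≤ = N-bound D′ (solve 1 (λ k′ → con 2 :* (con 1 :+ k′) := con 2 :+ con 2 :* k′) ≡.refl k′) D²m<n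
        -- An inequality between naturals is decidable, hence stable, which licenses the classical
        -- choice of the gauge.
        (decidable-stable (Count.N F k γ m p ^ suc j ℕ.≤? q ^ ((k * suc j + 1) * m))) τ 1≤τ covers
        (λ d d≤D N≤ → ≤-trans (ℕ.^-monoˡ-≤ J N≤)
          (proj₂ cover-growth m τ d (ℕ.m+n≤o⇒n≤o (proj₁ divisor-growth) M≤m) 2≤q d≤D τ^L≤))
      where open NatSolver.+-*-Solver
    large : 2 ^ (D * L) ≤ q → Goal
    large q-large = conclude (2 ^ (D * m)) (ℕ.m^n>0 2 (D * m)) (λ p nz d → divisor-cover-rough (D * m) nz d) (divisor-bound-large {D} {L} m q-large)
    small : q ≤ 2 ^ (D * L) → Goal
    small q-small = conclude τ (ℕ.*-mono-≤ (ℕ.m^n>0 (suc (D * m)) (q ^ s)) (ℕ.m^n>0 2 ω₀)) covers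
        (proj₂ divisor-growth m ω₀ (ℕ.m+n≤o⇒m≤o (proj₁ divisor-growth) M≤m) 2≤q q-small
          (≤-trans (≤-reflexive (ℕ.*-comm s ω₀)) (ℕ.m/n*n≤m (D * m) s)))
      where
      instance
        s≢0 : ℕ.NonZero s
        s≢0 = ℕ.>-nonZero (ℕ.*-mono-≤ {1} {2 * D} (s≤s z≤n) (s≤s z≤n))
      -- The largest ω with s ω ≤ D m, so that a single τ serves all values.
      ω₀ = D * m ℕ./ s
      τ = suc (D * m) ^ (q ^ s) * 2 ^ ω₀
      covers : ∀ p → ¬ (p ≋ []) → Deg< (suc (D * m)) p → DivisorCover p τ
      covers p nz d with divisor-cover-small s (D * m) nz d
      ... | ω , sω , C = record { divisors = DivisorCover.divisors C ; complete = DivisorCover.complete C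
            ; size = ≤-trans (DivisorCover.size C) (ℕ.*-monoʳ-≤ (suc (D * m) ^ (q ^ s)) (ℕ.^-monoʳ-≤ 2 ω≤ω₀)) }
        where
        ω≤ω₀ : ω ≤ ω₀
        ω≤ω₀ = ≤-trans (≤-reflexive (≡.sym (ℕ.m*n/n≡m ω s)))
          (ℕ./-monoˡ-≤ s (≤-trans (≤-reflexive (ℕ.*-comm ω s)) sω))
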